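{- Let $n\ge1$ and $x\ge0$ be integers, and let $L(C_{n,x})$ be the number of lozenge tilings of the region $C_{n,x}$ defined in the context. Then $$L(C_{n,x})=\det\left(\binom{x+i+j}{2j-i}\right)_{0\le i,j\le n-1}.$$ Moreover, the determinant $$\det\left(\binom{x+i+j}{2j-i}\right)_{0\le i,j\le n-1}$$ can be expressed as a product of linear factors in $x$.
   Context: Work on the regular triangular lattice with unit edges, with one family of lattice lines horizontal. A lozenge is a unit rhombus with angles $60^\circ$ and $120^\circ$ (the union of two unit triangles sharing an edge). A lozenge tiling of a region (a finite union of unit triangles) is a covering of it by lozenges without gaps or overlaps. $C_{n,x}$ is the pentagonal region whose top side is horizontal of length $x$, whose southeastern side is straight of length $n$, whose western and northeastern sides follow zig-zag lattice paths of length $2n$, and whose bottom side is horizontal. Explicitly, with directions measured counterclockwise from east: starting at the left end of the top side, the western side goes downward by $2n$ unit steps alternately in directions $-60^\circ,-120^\circ,-60^\circ,-120^\circ,\dots$. Starting at the right end of the top side, the northeastern side consists of $2n$ unit steps alternately in directions $-60^\circ,0^\circ,-60^\circ,0^\circ,\dots$; it is followed by the southeastern side, $n$ unit steps in direction $-120^\circ$. The bottom side joins the lower ends of the western and southeastern sides. All tile positions have weight $1$, so $L(C_{n,x})$ is simply the number of lozenge tilings. Binomial coefficients: $\binom{a}{m}=a(a-1)\cdots(a-m+1)/m!$ for integers $m\ge0$ and $\binom{a}{m}=0$ for integers $m<0$, so the entries of the matrix are polynomials in $x$. -}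

module Defs where

open import Data.Fin.Base using (Fin; zero; suc; toℕ)
open import Data.Integer.Base using (ℤ; +_; -[1+_]; 0ℤ; 1ℤ; -1ℤ; _⊖_)
import Data.Integer.Base as ℤ
import Data.Integer.Properties as ℤ
open import Data.List.Base
  using (List; []; _∷_; _++_; map; concat; zipWith; filter; replicate; upTo;
         cartesianProduct; length; foldr)
open import Data.List.Relation.Unary.All using (All; all?)
open import Data.List.Relation.Unary.Any using (Any; any?)
open import Data.Nat.Base using (ℕ; zero; suc; _!)
import Data.Nat.Base as ℕ
import Data.Nat.Properties as ℕ
open import Data.Product.Base using (_×_; _,_; proj₁; proj₂)
import Data.Product.Properties as Product
open import Data.Rational.Base using (ℚ; 0ℚ; 1ℚ; _/_)
import Data.Rational.Base as ℚ
import Data.Rational.Properties as ℚ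
open import Data.Rational.Literals using (fromℤ)
open import Data.Sum.Base using (_⊎_)
open import Data.Vec.Functional using (removeAt)
open import Algebra.Properties.CommutativeMonoid.Sum ℚ.+-0-commutativeMonoid
  using (sum)
open import Relation.Binary.Definitions using (DecidableEquality)
open import Relation.Binary.PropositionalEquality.Core using (_≡_; refl)
open import Relation.Nullary.Decidable using (yes; no; _⊎-dec_; ¬?)
open import Relation.Unary using (Decidable)

------------------------------------------------------------------------
-- The triangular lattice

-- (a , b) stands for a·u + b·v, where u and v are the unit vectors in the
-- directions 0° and -60°.  So b is the depth, in rows, below the
-- horizontal line through the origin.
Point : Set
Point = ℤ × ℤ

infixl 6 _⊕_

_⊕_ : Point → Point → Point
(a , b) ⊕ (c , d) = (a ℤ.+ c , b ℤ.+ d)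

-- The unit vectors in the directions 0°, -60°, -120° and 60°.
E SE SW NE : Point
E  = (1ℤ  , 0ℤ)
SE = (0ℤ  , 1ℤ)
SW = (-1ℤ , 1ℤ)
NE = (1ℤ  , -1ℤ)

-- A unit lattice edge: its starting point and one of E, SE, SW.  With these
-- three directions every undirected edge has exactly one representation.
Edge : Set
Edge = Point × Point

_≟ᴱ_ : DecidableEquality Edge
_≟ᴱ_ = Product.≡-dec ≟ᴾ ≟ᴾ
  where
  ≟ᴾ : DecidableEquality Point
  ≟ᴾ = Product.≡-dec ℤ._≟_ ℤ._≟_

data Orientation : Set where
  up down : Orientation

_≟ᴼ_ : DecidableEquality Orientation
up   ≟ᴼ up   = yes refl
up   ≟ᴼ down = no λ ()
down ≟ᴼ up   = no λ ()
down ≟ᴼ down = yes refl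

-- (up , s) and (down , s) are the unit triangles lying above and below the
-- horizontal edge from s to s ⊕ E.
Triangle : Set
Triangle = Orientation × Point

_≟ᵀ_ : DecidableEquality Triangle
_≟ᵀ_ = Product.≡-dec _≟ᴼ_ (Product.≡-dec ℤ._≟_ ℤ._≟_)

edges : Triangle → List Edge
edges (up   , s) = (s , E) ∷ (s ⊕ NE , SW) ∷ (s ⊕ NE , SE) ∷ []
edges (down , s) = (s , E) ∷ (s , SE) ∷ (s ⊕ E , SW) ∷ []

------------------------------------------------------------------------
-- Lozenge tilings

-- A region is a list, without repetitions, of unit triangles.
Region : Set
Region = List Triangle

ShareEdge : Triangle × Triangle → Set
ShareEdge (t , u) = Any (λ e → Any (e ≡_) (edges u)) (edges t)

shareEdge? : Decidable ShareEdge
shareEdge? (t , u) = any? (λ e → any? (e ≟ᴱ_) (edges u)) (edges t)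

-- The two triangles of a lozenge have opposite orientations; listing the
-- up-pointing one first makes the representation unique.
Lozenge : Set
Lozenge = Triangle × Triangle

oriented : Orientation → Region → List Triangle
oriented o = filter (λ t → proj₁ t ≟ᴼ o)

lozengesIn : Region → List Lozenge
lozengesIn R =
  filter shareEdge? (cartesianProduct (oriented up R) (oriented down R))

Covers : Triangle → Lozenge → Set
Covers t (u , d) = t ≡ u ⊎ t ≡ d

covers? : ∀ t → Decidable (Covers t)
covers? t (u , d) = (t ≟ᵀ u) ⊎-dec (t ≟ᵀ d)

IsTiling : Region → List Lozenge → Set
IsTiling R T = All (λ t → length (filter (covers? t) T) ≡ 1) R

isTiling? : ∀ R → Decidable (IsTiling R)
isTiling? R T = all? (λ t → length (filter (covers? t) T) ℕ.≟ 1) R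

sublists : ∀ {A : Set} → List A → List (List A)
sublists []       = [] ∷ []
sublists (x ∷ xs) = map (x ∷_) (sublists xs) ++ sublists xs

-- Tilings are sets of lozenges contained in R; each such set is counted
-- once, as a sublist of the repetition-free list lozengesIn R.
L : Region → ℕ
L R = length (filter (isTiling? R) (sublists (lozengesIn R)))

------------------------------------------------------------------------
-- The region C n x

walk : Point → List Point → List Edge
walk p []       = []
walk p (d ∷ ds) = (p , d) ∷ walk (p ⊕ d) ds

repeat : ℕ → List Point → List Point
repeat n ds = concat (replicate n ds)

westSide : ℕ → List Edge
westSide n = walk (0ℤ , 0ℤ) (repeat n (SE ∷ SW ∷ []))

-- The northeastern side followed by the southeastern side.
eastSide : ℕ → ℕ → List Edge
eastSide n x =
  walk (+ x , 0ℤ) (repeat n (SE ∷ E ∷ []) ++ repeat n (SW ∷ []))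

descending : List Edge → List Edge
descending = filter (λ e → ¬? (proj₂ (proj₂ e) ℤ.≟ 0ℤ))

-- The left ends of the unit segments making up the horizontal segment from
-- p to q, for p and q at the same depth with p weakly to the left of q.
segments : Point → Point → List Point
segments (a , b) (c , _) with c ℤ.- a
... | + k      = map (λ i → (a ℤ.+ + i , b)) (upTo k)
... | -[1+ _ ] = []

-- The trapezoid (or parallelogram) of height one row between two
-- descending edges of the same row.
strip : Edge → Edge → List Triangle
strip (w , d) (e , d′) =
  map (down ,_) (segments w e) ++ map (up ,_) (segments (w ⊕ d) (e ⊕ d′))

-- Both the western side and the northeastern-southeastern side cross each of
-- the 2n rows, from the top down, in exactly one non-horizontal edge.  The
-- region consists, in each row, of what lies between these two edges.
C : ℕ → ℕ → Region
C n x =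
  concat (zipWith strip (descending (westSide n)) (descending (eastSide n x)))

------------------------------------------------------------------------
-- Determinants and binomial coefficients

Matrix : ℕ → Set
Matrix n = Fin n → Fin n → ℚ

sign : ℕ → ℚ
sign zero    = 1ℚ
sign (suc k) = ℚ.- sign k

-- Expansion along the first row.
det : ∀ {n} → Matrix n → ℚ
det {zero}  A = 1ℚ
det {suc n} A = sum λ j →
  sign (toℕ j) ℚ.* A zero j ℚ.* det (λ i → removeAt (A (suc i)) j)

fallingFactorial : ℚ → ℕ → ℚ
fallingFactorial a zero    = 1ℚ
fallingFactorial a (suc m) = fallingFactorial a m ℚ.* (a ℚ.- fromℤ (+ m))

binomial : ℚ → ℤ → ℚ
binomial a (+ m)    = fallingFactorial a m ℚ.* (+ 1 / m !)
  where instance _ = m ℕ.!≢0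
binomial a -[1+ _ ] = 0ℚ

binomialMatrix : ∀ n → ℚ → Matrix n
binomialMatrix n x i j =
  binomial (x ℚ.+ fromℤ (+ (toℕ i ℕ.+ toℕ j))) ((2 ℕ.* toℕ j) ⊖ toℕ i)

------------------------------------------------------------------------
-- Products of linear factors

productℚ : List ℚ → ℚ
productℚ = foldr ℚ._*_ 1ℚ

{-# OPTIONS --safe #-}
module Submission where

-- Let M(x) be the matrix of the C(x+i+j, 2j-i).
--
-- Tilings.  The lozenges with a side in direction -60° form paths that start
-- at the sides of this direction in the western boundary (rows 0, 2, 4, …) and
-- move east, or up across a row boundary, to those in the northeastern boundary
-- (rows 0, …, n-1); C(x+i+j, 2j-i) counts the paths from row 2j to row i.
-- Instead of cancelling intersecting paths, the region is built up from the
-- bottom row, two triangles at a time and from west to east.  A partial region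
-- together with the set of places where paths leave it has as many tilings as
-- the determinant of the numbers of paths from its sources to these places says:
-- by Pascal's rule, adding two triangles changes one row of the determinant to
-- a sum of two neighbouring ones, and the claim follows from multilinearity and
-- from the vanishing of determinants with two equal adjacent rows.
--
-- Product formula.  The entries B(i,j;x) = C(x+i+j, 2j-i) satisfy
--   2(2j+1)(3j+2x+5) B(i+1,j+1;x) + (3j-x-1)(j+x+2) B(i+1,j;x)
--     = 2(x+i+2)(2x+6i+5) B(i,j;x+2) + i(4x+3i+7) B(i-1,j;x+2),
-- so triangular column operations on M(x), without its trivial first row and
-- column, and triangular row operations on M(x+2) give the same matrix.  Hence
-- det M(x) in size N+1 and det M(x+2) in size N differ by quotients of products
-- of linear factors, and a polynomial which is such a quotient is a product of
-- linear factors itself.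

-- The induction over partial regions closes only if it speaks about every set of exits, also about
-- those that no tiling realises. `D` takes rows and columns as separate lists and is 0 when their
-- lengths differ, so sets of exits of the wrong size need no separate treatment: both sides are 0.
-- A state of the induction is a function counting how often each triangle is already covered. It
-- encodes the exits, because a path leaves upwards through a down-pointing triangle exactly when
-- that triangle is already covered from above. In the product formula the obstacle is division. The
-- recurrence is stated without quotients and says nothing about the larger determinant at the zeros
-- of the column factors. No closed form is guessed; that the determinant is a polynomial in x
-- excludes exceptional values at these zeros.

open import Defs
open import Data.Integer.Base using (+_)
open import Data.List.Base using (List; map)
open import Data.Nat.Base using (ℕ; _≤_)
open import Data.Product.Base using (_×_; ∃-syntax)
open import Data.Rational.Base using (ℚ; 0ℚ; _+_; _*_)
open import Data.Rational.Literals using (fromℤ)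
open import Relation.Binary.PropositionalEquality.Core using (_≡_; _≢_)
import Data.Rational.Properties as ℚ
open import Algebra.Properties.CommutativeMonoid.Sum ℚ.+-0-commutativeMonoid using (sum; sum-cong-≗)
open import Data.Bool.Base using (Bool; true; false; if_then_else_; _∨_; not; _∧_)
open import Data.Fin.Base using (Fin; zero; suc; toℕ)
import Data.Integer.Base as ℤ
open import Data.Integer.Base using (ℤ; -[1+_]; 0ℤ; 1ℤ; _⊖_; -1ℤ)
import Data.Integer.Properties as ℤ
open import Data.List.Base using ([]; _∷_; _++_; tabulate; applyUpTo; upTo; length; filter; cartesianProduct; [_]; concat; zipWith)
open import Data.List.Membership.Propositional using (_∈_; _∉_)
open import Data.List.Membership.Propositional.Properties using (∈-++⁺ˡ; ∈-++⁺ʳ; ∈-map⁺; ∈-map⁻; ∈-filter⁺; ∈-filter⁻; ∈-cartesianProduct⁺; ∈-cartesianProduct⁻)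
open import Data.List.Membership.Propositional.Properties.WithK using (unique∧set⇒bag)
open import Data.List.Properties using (++-assoc; map-++; map-upTo; map-applyUpTo; ++-identityʳ; filter-++; length-++; applyUpTo-∷ʳ)
open import Data.List.Relation.Binary.BagAndSetEquality using (∼bag⇒↭)
import Data.List.Relation.Binary.Permutation.Propositional as ↭
open import Data.List.Relation.Binary.Permutation.Propositional using (_↭_; ↭-sym; ↭-refl)
import Data.List.Relation.Binary.Permutation.Propositional.Properties as ↭
open import Data.List.Relation.Binary.Pointwise using (Pointwise; []; _∷_)
import Data.List.Relation.Unary.All as All
open import Data.List.Relation.Unary.All using (All; []; _∷_; all?)
import Data.List.Relation.Unary.All.Properties as All
open import Data.List.Relation.Unary.AllPairs using ([]; _∷_)
open import Data.List.Relation.Unary.Any using (here; there)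
open import Data.List.Relation.Unary.Unique.Propositional using (Unique)
import Data.List.Relation.Unary.Unique.Propositional.Properties as Unique
import Data.Nat.Base as ℕ
open import Data.Nat.Base using (zero; suc; _!; _≡ᵇ_; ⌊_/2⌋)
import Data.Nat.Properties as ℕ
open import Data.Product.Base using (_,_; proj₁; proj₂)
import Data.Rational.Base as ℚ
open import Data.Rational.Base using (1ℚ; _-_; -_; ½; _/_; 1/_)
open import Data.Rational.Properties using (+-identityʳ; *-zeroˡ; *-zeroʳ; *-identityˡ; *-assoc; *-comm)
open import Data.Rational.Solver using (module +-*-Solver)
import Data.Rational.Unnormalised.Base as ℚᵘ
import Data.Rational.Unnormalised.Properties as ℚᵘ
import Data.Sum.Base as Sum
open import Data.Sum.Base using (_⊎_; inj₁; inj₂; [_,_]′)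
open import Data.Vec.Functional using (removeAt)
open import Function.Base using (_∘_; id)
open import Function.Bundles using (_⇔_; mk⇔)
open import Relation.Binary.Definitions using (DecidableEquality)
open import Relation.Binary.PropositionalEquality using (refl; sym; trans; cong; cong₂; _≗_; module ≡-Reasoning; subst)
open import Relation.Nullary.Decidable using (yes; no; does; _⊎-dec_; _×-dec_; map′; dec-true; dec-false; does-⇔)
open import Relation.Nullary.Negation using (contradiction)
open import Relation.Unary using (Decidable)

open +-*-Solver using (solve; _:=_; _:+_; _:*_; _:-_; :-_; con)

-- Determinants

-- D rs cs expands the determinant of the matrix (r c) along its first row; a
-- minor is given by the remaining rows and the list of remaining columns.
module _ {K : Set} where

  -- Contraction by `a` as in exterior algebra: a signed sum over the ways of removing one entry,
  -- each skipped entry contributing one change of sign.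
  contract : (K → ℚ) → (List K → ℚ) → List K → ℚ
  contract a g []       = 0ℚ
  contract a g (c ∷ cs) = a c * g cs - contract a (λ ds → g (c ∷ ds)) cs

  D : List (K → ℚ) → List K → ℚ
  D []       []      = 1ℚ
  D []       (_ ∷ _) = 0ℚ
  D (r ∷ rs) cs      = contract r (D rs) cs

  contract-cong : ∀ {a b g h} → a ≗ b → g ≗ h → contract a g ≗ contract b h
  contract-cong p q []       = refl
  contract-cong p q (c ∷ cs) =
    cong₂ _-_ (cong₂ _*_ (p c) (q cs)) (contract-cong p (λ ds → q (c ∷ ds)) cs)

  contract-+ˡ : ∀ a b g cs →
    contract (λ c → a c + b c) g cs ≡ contract a g cs + contract b g cs
  contract-+ˡ a b g []       = refl
  contract-+ˡ a b g (c ∷ cs) = trans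
    (cong (λ z → (a c + b c) * g cs - z) (contract-+ˡ a b (λ ds → g (c ∷ ds)) cs))
    (solve 5 (λ x y z u v → (x :+ y) :* z :- (u :+ v) := (x :* z :- u) :+ (y :* z :- v))
      refl (a c) (b c) (g cs) _ _)

  contract-*ˡ : ∀ s a g cs → contract (λ c → s * a c) g cs ≡ s * contract a g cs
  contract-*ˡ s a g []       = sym (*-zeroʳ s)
  contract-*ˡ s a g (c ∷ cs) = trans
    (cong (λ z → s * a c * g cs - z) (contract-*ˡ s a (λ ds → g (c ∷ ds)) cs))
    (solve 4 (λ s x z u → s :* x :* z :- s :* u := s :* (x :* z :- u)) refl s (a c) (g cs) _)

  contract-+ʳ : ∀ a g h cs →
    contract a (λ ds → g ds + h ds) cs ≡ contract a g cs + contract a h cs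
  contract-+ʳ a g h []       = refl
  contract-+ʳ a g h (c ∷ cs) = trans
    (cong (λ z → a c * (g cs + h cs) - z)
      (contract-+ʳ a (λ ds → g (c ∷ ds)) (λ ds → h (c ∷ ds)) cs))
    (solve 5 (λ x y z u v → x :* (y :+ z) :- (u :+ v) := (x :* y :- u) :+ (x :* z :- v))
      refl (a c) (g cs) (h cs) _ _)

  contract-*ʳ : ∀ s a g cs → contract a (λ ds → s * g ds) cs ≡ s * contract a g cs
  contract-*ʳ s a g []       = sym (*-zeroʳ s)
  contract-*ʳ s a g (c ∷ cs) = trans
    (cong (λ z → a c * (s * g cs) - z) (contract-*ʳ s a (λ ds → g (c ∷ ds)) cs))
    (solve 4 (λ s x z u → x :* (s :* z) :- s :* u := s :* (x :* z :- u)) refl s (a c) (g cs) _)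

  contract-zeroʳ : ∀ a {g} → (∀ cs → g cs ≡ 0ℚ) → ∀ cs → contract a g cs ≡ 0ℚ
  contract-zeroʳ a g≡0 []       = refl
  contract-zeroʳ a g≡0 (c ∷ cs) = trans
    (cong₂ (λ y z → a c * y - z) (g≡0 cs) (contract-zeroʳ a (λ ds → g≡0 (c ∷ ds)) cs))
    (solve 1 (λ x → x :* con 0ℚ :- con 0ℚ := con 0ℚ) refl (a c))

  -- Removing `c` first and another entry second cancels against the opposite order. The remaining
  -- terms never remove `c` and form an instance for `cs`.
  contract-twice : ∀ a g cs → contract a (contract a g) cs ≡ 0ℚ
  contract-twice a g []       = refl
  contract-twice a g (c ∷ cs) = begin
    a c * y - contract a (λ ds → a c * g ds - contract a g′ ds) cs
      ≡⟨ cong (λ z → a c * y - z) (contract-cong (λ _ → refl) (λ ds → minus (a c * g ds) _) cs) ⟩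
    a c * y - contract a (λ ds → a c * g ds + - 1ℚ * contract a g′ ds) cs
      ≡⟨ cong (λ z → a c * y - z) (contract-+ʳ a (λ ds → a c * g ds) _ cs) ⟩
    a c * y - (contract a (λ ds → a c * g ds) cs + contract a (λ ds → - 1ℚ * contract a g′ ds) cs)
      ≡⟨ cong₂ (λ u v → a c * y - (u + v)) (contract-*ʳ (a c) a g cs) (contract-*ʳ (- 1ℚ) a _ cs) ⟩
    a c * y - (a c * y + - 1ℚ * contract a (contract a g′) cs)
      ≡⟨ cong (λ z → a c * y - (a c * y + - 1ℚ * z)) (contract-twice a g′ cs) ⟩
    a c * y - (a c * y + - 1ℚ * 0ℚ)
      ≡⟨ solve 1 (λ u → u :- (u :+ :- con 1ℚ :* con 0ℚ) := con 0ℚ) refl (a c * y) ⟩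
    0ℚ ∎
    where
    open ≡-Reasoning
    g′ : List K → ℚ
    g′ ds = g (c ∷ ds)
    y : ℚ
    y = contract a g cs
    minus : ∀ u v → u - v ≡ u + - 1ℚ * v
    minus = solve 2 (λ u v → u :- v := u :+ :- con 1ℚ :* v) refl

  D-zero-column : ∀ {c rs} → All (λ r → r c ≡ 0ℚ) rs → ∀ cs → D rs (c ∷ cs) ≡ 0ℚ
  D-zero-column         []       cs = refl
  D-zero-column {rs = r ∷ rs} (z ∷ zs) cs = trans
    (cong₂ (λ u v → u * D rs cs - v) z (contract-zeroʳ r (D-zero-column zs) cs))
    (solve 1 (λ y → con 0ℚ :* y :- con 0ℚ := con 0ℚ) refl (D rs cs))

  D-unit-column : ∀ {c r rs} → r c ≡ 1ℚ → All (λ r → r c ≡ 0ℚ) rs →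
                  ∀ cs → D (r ∷ rs) (c ∷ cs) ≡ D rs cs
  D-unit-column {r = r} {rs} e zs cs = trans
    (cong₂ (λ u v → u * D rs cs - v) e (contract-zeroʳ r (D-zero-column zs) cs))
    (solve 1 (λ y → con 1ℚ :* y :- con 0ℚ := y) refl (D rs cs))

-- Alternating multilinear functions of lists of vectors

record Alternating {X : Set} (F : List (X → ℚ) → ℚ) : Set where
  field
    congruent : ∀ us {v w} vs → v ≗ w → F (us ++ v ∷ vs) ≡ F (us ++ w ∷ vs)
    additive  : ∀ us v w vs →
      F (us ++ (λ c → v c + w c) ∷ vs) ≡ F (us ++ v ∷ vs) + F (us ++ w ∷ vs)
    scalable  : ∀ us s v vs → F (us ++ (λ c → s * v c) ∷ vs) ≡ s * F (us ++ v ∷ vs)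
    adjacent  : ∀ us v vs → F (us ++ v ∷ v ∷ vs) ≡ 0ℚ

  congruent₂ : ∀ us {v w} vs → v ≗ w → ∀ u → F (us ++ u ∷ v ∷ vs) ≡ F (us ++ u ∷ w ∷ vs)
  congruent₂ us {v} {w} vs e u = begin
    F (us ++ u ∷ v ∷ vs)          ≡⟨ cong F (++-assoc us (u ∷ []) (v ∷ vs)) ⟨
    F ((us ++ u ∷ []) ++ v ∷ vs)  ≡⟨ congruent (us ++ u ∷ []) vs e ⟩
    F ((us ++ u ∷ []) ++ w ∷ vs)  ≡⟨ cong F (++-assoc us (u ∷ []) (w ∷ vs)) ⟩
    F (us ++ u ∷ w ∷ vs)          ∎
    where open ≡-Reasoning

  -- The multiple of `u` contributes a list with two equal neighbours.
  combination : ∀ us s t v u vs →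
    F (us ++ u ∷ (λ c → s * v c + t * u c) ∷ vs) ≡ s * F (us ++ u ∷ v ∷ vs)
  combination us s t v u vs = begin
    F (us ++ u ∷ (λ c → s * v c + t * u c) ∷ vs)
      ≡⟨ split ((λ c → s * v c + t * u c) ∷ vs) ⟩
    F (us′ ++ (λ c → s * v c + t * u c) ∷ vs)
      ≡⟨ additive us′ (λ c → s * v c) (λ c → t * u c) vs ⟩
    F (us′ ++ (λ c → s * v c) ∷ vs) + F (us′ ++ (λ c → t * u c) ∷ vs)
      ≡⟨ cong₂ _+_ (scalable us′ s v vs) (scalable us′ t u vs) ⟩
    s * F (us′ ++ v ∷ vs) + t * F (us′ ++ u ∷ vs)
      ≡⟨ cong₂ (λ y z → s * y + t * z) (sym (split (v ∷ vs))) (trans (sym (split (u ∷ vs))) (adjacent us u vs)) ⟩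
    s * F (us ++ u ∷ v ∷ vs) + t * 0ℚ
      ≡⟨ solve 2 (λ t y → y :+ t :* con 0ℚ := y) refl t _ ⟩
    s * F (us ++ u ∷ v ∷ vs) ∎
    where
    open ≡-Reasoning
    us′ : List (_ → ℚ)
    us′ = us ++ u ∷ []
    split : ∀ ws → F (us ++ u ∷ ws) ≡ F (us′ ++ ws)
    split ws = sym (cong F (++-assoc us (u ∷ []) ws))


open Alternating

D-rows : ∀ {K : Set} (cs : List K) → Alternating (λ rs → D rs cs)
D-rows cs = record
  { congruent = λ us vs e → cg us vs e cs
  ; additive  = λ us v w vs → ad us v w vs cs
  ; scalable  = λ us s v vs → sc us s v vs cs
  ; adjacent  = λ us v vs → aj us v vs cs
  }
  where
  cg : ∀ us {v w} vs → v ≗ w → ∀ cs → D (us ++ v ∷ vs) cs ≡ D (us ++ w ∷ vs) cs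
  cg []       vs e cs = contract-cong e (λ _ → refl) cs
  cg (u ∷ us) vs e cs = contract-cong (λ _ → refl) (cg us vs e) cs
  ad : ∀ us v w vs cs →
    D (us ++ (λ c → v c + w c) ∷ vs) cs ≡ D (us ++ v ∷ vs) cs + D (us ++ w ∷ vs) cs
  ad []       v w vs cs = contract-+ˡ v w (D vs) cs
  ad (u ∷ us) v w vs cs = trans
    (contract-cong (λ _ → refl) (ad us v w vs) cs) (contract-+ʳ u (D (us ++ v ∷ vs)) (D (us ++ w ∷ vs)) cs)
  sc : ∀ us s v vs cs → D (us ++ (λ c → s * v c) ∷ vs) cs ≡ s * D (us ++ v ∷ vs) cs
  sc []       s v vs cs = contract-*ˡ s v (D vs) cs
  sc (u ∷ us) s v vs cs = trans
    (contract-cong (λ _ → refl) (sc us s v vs) cs) (contract-*ʳ s u (D (us ++ v ∷ vs)) cs)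
  aj : ∀ us v vs cs → D (us ++ v ∷ v ∷ vs) cs ≡ 0ℚ
  aj []       v vs cs = contract-twice v (D vs) cs
  aj (u ∷ us) v vs cs = contract-zeroʳ u (aj us v vs) cs

module _ {X : Set} where

  after : ∀ {F : List (X → ℚ) → ℚ} u → Alternating F → Alternating (λ cs → F (u ∷ cs))
  after u A = record
    { congruent = λ us vs e → congruent A (u ∷ us) vs e
    ; additive  = λ us → additive A (u ∷ us)
    ; scalable  = λ us → scalable A (u ∷ us)
    ; adjacent  = λ us → adjacent A (u ∷ us)
    }

  -- Alternation in the columns passes from the minors to the expansion along a row. For two equal
  -- leading columns, removing the first and removing the second give opposite terms, and every
  -- other term has a vanishing minor.
  contract-alternating : ∀ {g : List (X → ℚ) → ℚ} i → Alternating g →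
                         Alternating (contract (λ c → c i) g)
  contract-alternating i A = record
    { congruent = λ us vs e → cg us A vs e
    ; additive  = λ us → ad us A
    ; scalable  = λ us → sc us A
    ; adjacent  = λ us → aj us A
    }
    where
    a : (X → ℚ) → ℚ
    a c = c i
    cg : ∀ {g} us → Alternating g → ∀ {v w} vs → v ≗ w →
         contract a g (us ++ v ∷ vs) ≡ contract a g (us ++ w ∷ vs)
    cg {g} [] A vs e = cong₂ (λ y z → y * g vs - z) (e i)
      (contract-cong (λ _ → refl) (λ ds → congruent A [] ds e) vs)
    cg (u ∷ us) A vs e = cong₂ (λ y z → u i * y - z) (congruent A us vs e) (cg us (after u A) vs e)
    ad : ∀ {g} us → Alternating g → ∀ v w vs → contract a g (us ++ (λ c → v c + w c) ∷ vs)
         ≡ contract a g (us ++ v ∷ vs) + contract a g (us ++ w ∷ vs)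
    ad {g} [] A v w vs = trans
      (cong (λ z → (v i + w i) * g vs - z) (trans
        (contract-cong (λ _ → refl) (additive A [] v w) vs)
        (contract-+ʳ a (λ ds → g (v ∷ ds)) (λ ds → g (w ∷ ds)) vs)))
      (solve 5 (λ x y z u v → (x :+ y) :* z :- (u :+ v) := (x :* z :- u) :+ (y :* z :- v))
        refl (v i) (w i) (g vs) _ _)
    ad {g} (u ∷ us) A v w vs = trans
      (cong₂ (λ y z → u i * y - z) (additive A us v w vs) (ad us (after u A) v w vs))
      (solve 5 (λ x y z u v → x :* (y :+ z) :- (u :+ v) := (x :* y :- u) :+ (x :* z :- v))
        refl (u i) (g (us ++ v ∷ vs)) (g (us ++ w ∷ vs)) _ _)
    sc : ∀ {g} us → Alternating g → ∀ s v vs →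
         contract a g (us ++ (λ c → s * v c) ∷ vs) ≡ s * contract a g (us ++ v ∷ vs)
    sc {g} [] A s v vs = trans
      (cong (λ z → s * v i * g vs - z) (trans
        (contract-cong (λ _ → refl) (scalable A [] s v) vs)
        (contract-*ʳ s a (λ ds → g (v ∷ ds)) vs)))
      (solve 4 (λ s x z u → s :* x :* z :- s :* u := s :* (x :* z :- u)) refl s (v i) (g vs) _)
    sc {g} (u ∷ us) A s v vs = trans
      (cong₂ (λ y z → u i * y - z) (scalable A us s v vs) (sc us (after u A) s v vs))
      (solve 4 (λ s x z u → x :* (s :* z) :- s :* u := s :* (x :* z :- u)) refl s (u i) (g (us ++ v ∷ vs)) _)
    aj : ∀ {g} us → Alternating g → ∀ v vs → contract a g (us ++ v ∷ v ∷ vs) ≡ 0ℚ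
    aj {g} [] A v vs = trans
      (cong (λ z → v i * g (v ∷ vs) - (v i * g (v ∷ vs) - z)) (contract-zeroʳ a (adjacent A [] v) vs))
      (solve 1 (λ y → y :- (y :- con 0ℚ) := con 0ℚ) refl (v i * g (v ∷ vs)))
    aj (u ∷ us) A v vs = trans
      (cong₂ (λ y z → u i * y - z) (adjacent A us v vs) (aj us (after u A) v vs))
      (solve 1 (λ y → y :* con 0ℚ :- con 0ℚ := con 0ℚ) refl (u i))

  -- Here the columns are the vectors and the rows are the evaluations at indices. Having
  -- alternation in the same form for rows and for columns lets one lemma on bidiagonal changes
  -- serve both sides of the recurrence.
  D-columns : ∀ (is : List X) → Alternating (D (map (λ i c → c i) is))
  D-columns []       = record
    { congruent = λ { [] vs e → refl ; (_ ∷ _) vs e → refl }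
    ; additive  = λ { [] v w vs → refl ; (_ ∷ _) v w vs → refl }
    ; scalable  = λ { [] s v vs → sym (*-zeroʳ s) ; (_ ∷ _) s v vs → sym (*-zeroʳ s) }
    ; adjacent  = λ { [] v vs → refl ; (_ ∷ _) v vs → refl }
    }
  D-columns (i ∷ is) = contract-alternating i (D-columns is)

module _ {K K′ : Set} (f : K → K′) where

  contract-map : ∀ a g cs → contract a g (map f cs) ≡ contract (λ c → a (f c)) (λ ds → g (map f ds)) cs
  contract-map a g []       = refl
  contract-map a g (c ∷ cs) = cong (λ z → a (f c) * g (map f cs) - z) (contract-map a (λ ds → g (f c ∷ ds)) cs)

  D-map : ∀ rs cs → D rs (map f cs) ≡ D (map (λ r c → r (f c)) rs) cs
  D-map []       []      = refl
  D-map []       (_ ∷ _) = refl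
  D-map (r ∷ rs) cs      = trans (contract-map r (D rs) cs) (contract-cong (λ _ → refl) (D-map rs) cs)

-- Bidiagonal changes of vectors

∏ : (ℕ → ℚ) → ℕ → ℚ
∏ s zero    = 1ℚ
∏ s (suc m) = s 0 * ∏ (s ∘ suc) m

previous : ∀ {A : Set} → A → (ℕ → A) → ℕ → A
previous u v zero    = u
previous u v (suc k) = v k

module _ {X : Set} {F : List (X → ℚ) → ℚ} (A : Alternating F) where

  -- The list is processed from the front: when `w k` is reached, the vector just before it has
  -- already been turned back into the previous `v`, so the `t k` part drops out and only the factor
  -- `s k` survives. The prefix `us` and the vector `u` carry this situation through the induction.
  bidiagonal-after : ∀ us u (s t : ℕ → ℚ) (v w : ℕ → X → ℚ) m →
    (∀ k c → w k c ≡ s k * v k c + t k * previous u v k c) →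
    F (us ++ u ∷ applyUpTo w m) ≡ ∏ s m * F (us ++ u ∷ applyUpTo v m)
  bidiagonal-after us u s t v w zero    e = sym (*-identityˡ _)
  bidiagonal-after us u s t v w (suc m) e = begin
    F (us ++ u ∷ w 0 ∷ ws)
      ≡⟨ congruent₂ A us ws (e 0) u ⟩
    F (us ++ u ∷ (λ c → s 0 * v 0 c + t 0 * u c) ∷ ws)
      ≡⟨ combination A us (s 0) (t 0) (v 0) u ws ⟩
    s 0 * F (us ++ u ∷ v 0 ∷ ws)
      ≡⟨ cong (s 0 *_) (split ws) ⟩
    s 0 * F ((us ++ u ∷ []) ++ v 0 ∷ ws)
      ≡⟨ cong (s 0 *_) (bidiagonal-after (us ++ u ∷ []) (v 0) (s ∘ suc) (t ∘ suc) (v ∘ suc) (w ∘ suc) m e′) ⟩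
    s 0 * (∏ (s ∘ suc) m * F ((us ++ u ∷ []) ++ v 0 ∷ vs))
      ≡⟨ *-assoc (s 0) _ _ ⟨
    s 0 * ∏ (s ∘ suc) m * F ((us ++ u ∷ []) ++ v 0 ∷ vs)
      ≡⟨ cong (λ z → s 0 * ∏ (s ∘ suc) m * z) (sym (split vs)) ⟩
    s 0 * ∏ (s ∘ suc) m * F (us ++ u ∷ v 0 ∷ vs) ∎
    where
    open ≡-Reasoning
    ws vs : List (X → ℚ)
    ws = applyUpTo (w ∘ suc) m
    vs = applyUpTo (v ∘ suc) m
    split : ∀ ys → F (us ++ u ∷ v 0 ∷ ys) ≡ F ((us ++ u ∷ []) ++ v 0 ∷ ys)
    split ys = cong F (sym (++-assoc us (u ∷ []) (v 0 ∷ ys)))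
    e′ : ∀ k c → w (suc k) c ≡ s (suc k) * v (suc k) c + t (suc k) * previous (v 0) (v ∘ suc) k c
    e′ zero    c = e 1 c
    e′ (suc k) c = e (suc (suc k)) c

  bidiagonal : ∀ (s t : ℕ → ℚ) (v w : ℕ → X → ℚ) m →
    (∀ k c → w k c ≡ s k * v k c + t k * previous (λ _ → 0ℚ) v k c) →
    F (applyUpTo w m) ≡ ∏ s m * F (applyUpTo v m)
  bidiagonal s t v w zero    e = sym (*-identityˡ _)
  bidiagonal s t v w (suc m) e = begin
    F (w 0 ∷ ws)
      ≡⟨ congruent A [] ws (λ c → trans (e 0 c) (zero-tail (s 0 * v 0 c) (t 0))) ⟩
    F ((λ c → s 0 * v 0 c) ∷ ws)
      ≡⟨ scalable A [] (s 0) (v 0) ws ⟩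
    s 0 * F (v 0 ∷ ws)
      ≡⟨ cong (s 0 *_) (bidiagonal-after [] (v 0) (s ∘ suc) (t ∘ suc) (v ∘ suc) (w ∘ suc) m e′) ⟩
    s 0 * (∏ (s ∘ suc) m * F (v 0 ∷ vs))
      ≡⟨ *-assoc (s 0) _ _ ⟨
    s 0 * ∏ (s ∘ suc) m * F (v 0 ∷ vs) ∎
    where
    open ≡-Reasoning
    ws vs : List (X → ℚ)
    ws = applyUpTo (w ∘ suc) m
    vs = applyUpTo (v ∘ suc) m
    zero-tail : ∀ y t → y + t * 0ℚ ≡ y
    zero-tail = solve 2 (λ y t → y :+ t :* con 0ℚ := y) refl
    e′ : ∀ k c → w (suc k) c ≡ s (suc k) * v (suc k) c + t (suc k) * previous (v 0) (v ∘ suc) k c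
    e′ zero    c = e 1 c
    e′ (suc k) c = e (suc (suc k)) c

-- Comparison with the determinant over finite index sets

det-cong : ∀ {n} {A B : Matrix n} → (∀ i j → A i j ≡ B i j) → det A ≡ det B
det-cong {zero}  e = refl
det-cong {suc n} e = sum-cong-≗ λ j →
  cong₂ (λ y z → sign (toℕ j) * y * z) (e zero j) (det-cong λ i k → removeAt-cong (e (suc i)) j k)
  where
  removeAt-cong : ∀ {m} {f g : Fin (suc m) → ℚ} → f ≗ g → ∀ j → removeAt f j ≗ removeAt g j
  removeAt-cong {m}     e zero    k       = e (suc k)
  removeAt-cong {suc m} e (suc j) zero    = e zero
  removeAt-cong {suc m} e (suc j) (suc k) = removeAt-cong (λ l → e (suc l)) j k

removeAt-∘ : ∀ {A : Set} (r : A → ℚ) {m} (h : Fin (suc m) → A) j →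
             removeAt (λ k → r (h k)) j ≗ λ k → r (removeAt h j k)
removeAt-∘ r {m}     h zero    k       = refl
removeAt-∘ r {suc m} h (suc j) zero    = refl
removeAt-∘ r {suc m} h (suc j) (suc k) = removeAt-∘ r (h ∘ suc) j k

sum-neg : ∀ {n} (f : Fin n → ℚ) → sum (λ j → - f j) ≡ - sum f
sum-neg {zero}  f = refl
sum-neg {suc n} f = trans (cong (λ z → - f zero + z) (sum-neg (f ∘ suc)))
  (solve 2 (λ a b → :- a :+ :- b := :- (a :+ b)) refl (f zero) _)

-- Passing the first column negates the whole remaining sum, so the nested subtractions unfold to
-- the alternating signs.
contract-tabulate : ∀ {K : Set} n (a : K → ℚ) (g : List K → ℚ) (h : Fin (suc n) → K) →
  contract a g (tabulate h) ≡ sum (λ j → sign (toℕ j) * a (h j) * g (tabulate (removeAt h j)))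
contract-tabulate zero    a g h =
  solve 2 (λ x y → x :* y :- con 0ℚ := con 1ℚ :* x :* y :+ con 0ℚ) refl (a (h zero)) (g [])
contract-tabulate (suc n) a g h = begin
  a (h zero) * y - contract a g′ (tabulate (h ∘ suc))
    ≡⟨ cong (λ z → a (h zero) * y - z) (contract-tabulate n a g′ (h ∘ suc)) ⟩
  a (h zero) * y - sum f
    ≡⟨ cong₂ _+_ (solve 2 (λ x y → x :* y := con 1ℚ :* x :* y) refl (a (h zero)) y)
                 (trans (sym (sum-neg f)) (sum-cong-≗ λ j →
                   solve 3 (λ x y z → :- (x :* y :* z) := :- x :* y :* z) refl
                     (sign (toℕ j)) (a (h (suc j))) (g′ (tabulate (removeAt (h ∘ suc) j))))) ⟩
  1ℚ * a (h zero) * y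
    + sum (λ j → - sign (toℕ j) * a (h (suc j)) * g (h zero ∷ tabulate (removeAt (h ∘ suc) j))) ∎
  where
  open ≡-Reasoning
  g′ : List _ → ℚ
  g′ ds = g (h zero ∷ ds)
  y : ℚ
  y = g (tabulate (h ∘ suc))
  f : Fin (suc n) → ℚ
  f j = sign (toℕ j) * a (h (suc j)) * g′ (tabulate (removeAt (h ∘ suc) j))

det≡D : ∀ {K : Set} n (r : Fin n → K → ℚ) (h : Fin n → K) →
        det (λ i j → r i (h j)) ≡ D (tabulate r) (tabulate h)
det≡D zero    r h = refl
det≡D (suc n) r h = sym (trans (contract-tabulate n (r zero) (D (tabulate (r ∘ suc))) h)
  (sum-cong-≗ λ j → cong (λ z → sign (toℕ j) * r zero (h j) * z) (trans
    (sym (det≡D n (r ∘ suc) (removeAt h j)))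
    (det-cong λ i k → sym (removeAt-∘ (r (suc i)) h j k)))))

-- Integers inside the rationals, cancellation

fromℤ-/1 : ∀ z → z / 1 ≡ fromℤ z
fromℤ-/1 z = ℚ.↥p/↧p≡p (fromℤ z)

fromℤ-+ : ∀ y z → fromℤ (y ℤ.+ z) ≡ fromℤ y + fromℤ z
fromℤ-+ y z = trans (sym (fromℤ-/1 (y ℤ.+ z)))
  (cong₂ (λ u v → (u ℤ.+ v) / 1) (sym (ℤ.*-identityʳ y)) (sym (ℤ.*-identityʳ z)))

fromℤ-* : ∀ y z → fromℤ (y ℤ.* z) ≡ fromℤ y * fromℤ z
fromℤ-* y z = sym (fromℤ-/1 (y ℤ.* z))

fromℤ-neg : ∀ z → fromℤ (ℤ.- z) ≡ - fromℤ z
fromℤ-neg (+ zero)  = refl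
fromℤ-neg (+ suc _) = refl
fromℤ-neg -[1+ _ ]  = refl

fromℤ-injective : ∀ {y z} → fromℤ y ≡ fromℤ z → y ≡ z
fromℤ-injective e = cong ℚ.numerator e

fromℕ : ℕ → ℚ
fromℕ k = fromℤ (+ k)

fromℕ-+ : ∀ j k → fromℕ (j ℕ.+ k) ≡ fromℕ j + fromℕ k
fromℕ-+ j k = fromℤ-+ (+ j) (+ k)

fromℕ-suc : ∀ k → fromℕ (suc k) ≡ 1ℚ + fromℕ k
fromℕ-suc k = fromℕ-+ 1 k

fromℕ-* : ∀ j k → fromℕ (j ℕ.* k) ≡ fromℕ j * fromℕ k
fromℕ-* j k = trans (cong fromℤ (ℤ.pos-* j k)) (fromℤ-* (+ j) (+ k))

fromℤ-⊖ : ∀ j k → fromℤ (j ⊖ k) ≡ fromℕ j - fromℕ k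
fromℤ-⊖ j k = begin
  fromℤ (j ⊖ k)           ≡⟨ cong fromℤ (ℤ.m-n≡m⊖n j k) ⟨
  fromℤ (+ j ℤ.+ ℤ.- + k) ≡⟨ fromℤ-+ (+ j) (ℤ.- + k) ⟩
  fromℕ j + fromℤ (ℤ.- + k) ≡⟨ cong (λ z → fromℕ j + z) (fromℤ-neg (+ k)) ⟩
  fromℕ j - fromℕ k       ∎
  where open ≡-Reasoning

reciprocal : ∀ n .{{_ : ℕ.NonZero n}} → (+ 1 / n) * fromℕ n ≡ 1ℚ
reciprocal (suc n) = ℚ.toℚᵘ-injective (begin-equality
  ℚ.toℚᵘ ((+ 1 / suc n) * fromℕ (suc n))
    ≃⟨ ℚ.toℚᵘ-homo-* (+ 1 / suc n) (fromℕ (suc n)) ⟩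
  ℚ.toℚᵘ (+ 1 / suc n) ℚᵘ.* ℚᵘ.mkℚᵘ (+ suc n) 0
    ≃⟨ ℚᵘ.*-congʳ {ℚᵘ.mkℚᵘ (+ suc n) 0} (ℚ.toℚᵘ-fromℚᵘ (ℚᵘ.mkℚᵘ (+ 1) n)) ⟩
  ℚᵘ.mkℚᵘ (+ 1) n ℚᵘ.* ℚᵘ.mkℚᵘ (+ suc n) 0
    ≃⟨ ℚᵘ.*-inverseˡ (ℚᵘ.mkℚᵘ (+ suc n) 0) ⟩
  ℚᵘ.1ℚᵘ ∎)
  where open ℚᵘ.≤-Reasoning

*-cancel-nonzero : ∀ {p q r} → p ≢ 0ℚ → p * q ≡ p * r → q ≡ r
*-cancel-nonzero {p} {q} {r} p≢0 e = begin
  q                ≡⟨ ℚ.*-identityˡ q ⟨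
  1ℚ * q           ≡⟨ cong (_* q) (ℚ.*-inverseˡ p) ⟨
  (1/ p) * p * q   ≡⟨ *-assoc (1/ p) p q ⟩
  (1/ p) * (p * q) ≡⟨ cong ((1/ p) *_) e ⟩
  (1/ p) * (p * r) ≡⟨ *-assoc (1/ p) p r ⟨
  (1/ p) * p * r   ≡⟨ cong (_* r) (ℚ.*-inverseˡ p) ⟩
  1ℚ * r           ≡⟨ ℚ.*-identityˡ r ⟩
  r                ∎
  where
  open ≡-Reasoning
  instance _ = ℚ.≢-nonZero p≢0

no-zero-divisors : ∀ {p q} → p * q ≡ 0ℚ → p ≡ 0ℚ ⊎ q ≡ 0ℚ
no-zero-divisors {p} {q} e with p ℚ.≟ 0ℚ
... | yes p≡0 = inj₁ p≡0
... | no  p≢0 = inj₂ (*-cancel-nonzero p≢0 (trans e (sym (*-zeroʳ p))))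

*-nonzero : ∀ {p q} → p ≢ 0ℚ → q ≢ 0ℚ → p * q ≢ 0ℚ
*-nonzero p≢0 q≢0 e with no-zero-divisors e
... | inj₁ p≡0 = p≢0 p≡0
... | inj₂ q≡0 = q≢0 q≡0

-- Binomial coefficients with rational upper argument

-- The definition splits off the last factor; Pascal's rule needs the first one.
fallingFactorial-suc : ∀ a k →
  fallingFactorial (a + 1ℚ) (suc k) ≡ (a + 1ℚ) * fallingFactorial a k
fallingFactorial-suc a zero    =
  solve 1 (λ a → con 1ℚ :* (a :+ con 1ℚ :- con 0ℚ) := (a :+ con 1ℚ) :* con 1ℚ) refl a
fallingFactorial-suc a (suc k) = begin
  fallingFactorial (a + 1ℚ) (suc k) * (a + 1ℚ - fromℕ (suc k))
    ≡⟨ cong₂ (λ f g → f * (a + 1ℚ - g)) (fallingFactorial-suc a k) (fromℕ-suc k) ⟩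
  (a + 1ℚ) * fallingFactorial a k * (a + 1ℚ - (1ℚ + fromℕ k))
    ≡⟨ solve 3 (λ a f k → (a :+ con 1ℚ) :* f :* (a :+ con 1ℚ :- (con 1ℚ :+ k))
                       := (a :+ con 1ℚ) :* (f :* (a :- k))) refl a (fallingFactorial a k) (fromℕ k) ⟩
  (a + 1ℚ) * (fallingFactorial a k * (a - fromℕ k)) ∎
  where open ≡-Reasoning

1/! : ℕ → ℚ
1/! k = + 1 / k !
  where instance _ = k ℕ.!≢0

1/!-suc : ∀ k → fromℕ (suc k) * 1/! (suc k) ≡ 1/! k
1/!-suc k = *-cancel-nonzero {fromℕ (k !)} k!≢0 (begin
  fromℕ (k !) * (fromℕ (suc k) * 1/! (suc k))
    ≡⟨ solve 3 (λ a b c → a :* (b :* c) := c :* (b :* a)) refl (fromℕ (k !)) (fromℕ (suc k)) (1/! (suc k)) ⟩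
  1/! (suc k) * (fromℕ (suc k) * fromℕ (k !))
    ≡⟨ cong (1/! (suc k) *_) (fromℕ-* (suc k) (k !)) ⟨
  1/! (suc k) * fromℕ (suc k !)
    ≡⟨ reciprocal (suc k !) ⟩
  1ℚ
    ≡⟨ reciprocal (k !) ⟨
  1/! k * fromℕ (k !)
    ≡⟨ *-comm (1/! k) _ ⟩
  fromℕ (k !) * 1/! k ∎)
  where
  open ≡-Reasoning
  instance
    _ = k ℕ.!≢0
    _ = suc k ℕ.!≢0
  k!≢0 : fromℕ (k !) ≢ 0ℚ
  k!≢0 e = ℕ.≢-nonZero⁻¹ (k !) (ℤ.+-injective (fromℤ-injective e))

binomial-absorb : ∀ a m → (fromℤ m + 1ℚ) * binomial a (1ℤ ℤ.+ m) ≡ (a - fromℤ m) * binomial a m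
binomial-absorb a (+ k) = begin
  (fromℕ k + 1ℚ) * (f * (a - fromℕ k) * 1/! (suc k))
    ≡⟨ solve 4 (λ k a f d → (k :+ con 1ℚ) :* (f :* (a :- k) :* d)
                          := (a :- k) :* (f :* ((con 1ℚ :+ k) :* d))) refl (fromℕ k) a f (1/! (suc k)) ⟩
  (a - fromℕ k) * (f * ((1ℚ + fromℕ k) * 1/! (suc k)))
    ≡⟨ cong (λ z → (a - fromℕ k) * (f * (z * 1/! (suc k)))) (fromℕ-suc k) ⟨
  (a - fromℕ k) * (f * (fromℕ (suc k) * 1/! (suc k)))
    ≡⟨ cong (λ z → (a - fromℕ k) * (f * z)) (1/!-suc k) ⟩
  (a - fromℕ k) * (f * 1/! k) ∎
  where
  open ≡-Reasoning
  f : ℚ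
  f = fallingFactorial a k
-- At m = -1 the factor m + 1 is 0, which compensates for C(a,0) = 1 against C(a,-1) = 0.
binomial-absorb a -[1+ zero ]  =
  solve 1 (λ a → con 0ℚ :* (con 1ℚ :* con 1ℚ) := (a :+ con 1ℚ) :* con 0ℚ) refl a
binomial-absorb a -[1+ suc k ] = trans (*-zeroʳ (fromℤ -[1+ suc k ] + 1ℚ)) (sym (*-zeroʳ (a - fromℤ -[1+ suc k ])))

binomial-pascal : ∀ a m → binomial (a + 1ℚ) (1ℤ ℤ.+ m) ≡ binomial a m + binomial a (1ℤ ℤ.+ m)
binomial-pascal a (+ k) = begin
  fallingFactorial (a + 1ℚ) (suc k) * 1/! (suc k)
    ≡⟨ cong (_* 1/! (suc k)) (fallingFactorial-suc a k) ⟩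
  (a + 1ℚ) * f * 1/! (suc k)
    ≡⟨ solve 4 (λ k a f d → (a :+ con 1ℚ) :* f :* d
          := f :* ((con 1ℚ :+ k) :* d) :+ f :* (a :- k) :* d) refl (fromℕ k) a f (1/! (suc k)) ⟩
  f * ((1ℚ + fromℕ k) * 1/! (suc k)) + f * (a - fromℕ k) * 1/! (suc k)
    ≡⟨ cong (λ z → f * (z * 1/! (suc k)) + f * (a - fromℕ k) * 1/! (suc k)) (fromℕ-suc k) ⟨
  f * (fromℕ (suc k) * 1/! (suc k)) + f * (a - fromℕ k) * 1/! (suc k)
    ≡⟨ cong (λ z → f * z + f * (a - fromℕ k) * 1/! (suc k)) (1/!-suc k) ⟩
  f * 1/! k + f * (a - fromℕ k) * 1/! (suc k) ∎
  where
  open ≡-Reasoning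
  f : ℚ
  f = fallingFactorial a k
binomial-pascal a -[1+ zero ]  = refl
binomial-pascal a -[1+ suc k ] = refl

fallingFactorial-zero : ∀ {j k} → j ℕ.< k → fallingFactorial (fromℕ j) k ≡ 0ℚ
fallingFactorial-zero {j} {suc k} j<1+k with ℕ.m≤n⇒m<n∨m≡n (ℕ.s≤s⁻¹ j<1+k)
... | inj₁ j<k  = trans (cong (_* (fromℕ j - fromℕ k)) (fallingFactorial-zero j<k)) (*-zeroˡ (fromℕ j - fromℕ k))
... | inj₂ refl = solve 2 (λ f k → f :* (k :- k) := con 0ℚ) refl (fallingFactorial (fromℕ j) j) (fromℕ j)

binomial-zero : ∀ {j k} → j ℕ.< k → binomial (fromℕ j) (+ k) ≡ 0ℚ
binomial-zero {j} {k} j<k = trans (cong (_* 1/! k) (fallingFactorial-zero j<k)) (*-zeroˡ (1/! k))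

-- The matrix entries and the recurrence for their determinant

entry : ℚ → ℕ → ℕ → ℚ
entry x i j = binomial (x + fromℕ (i ℕ.+ j)) ((2 ℕ.* j) ⊖ i)

-- The scales are written as a nonzero constant times factors x + b, whence the halves, so that
-- their products visibly split. The shifts need no such form, since they disappear from the
-- determinants.
colScale rowScale colShift rowShift : ℚ → ℕ → ℚ
colScale x j = fromℕ (4 ℕ.* (suc (2 ℕ.* j))) * (x + ½ * fromℕ (5 ℕ.+ 3 ℕ.* j))
colShift x j = (fromℕ (3 ℕ.* j) - x - 1ℚ) * (fromℕ j + x + fromℕ 2)
rowScale x i = fromℕ 4 * ((x + fromℕ (2 ℕ.+ i)) * (x + ½ * fromℕ (5 ℕ.+ 6 ℕ.* i)))
rowShift x i = fromℕ i * (fromℕ 4 * x + fromℕ (7 ℕ.+ 3 ℕ.* i))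

-- Both sides are combinations of u = C(a,m), v = C(a,m+1) and w = C(a,m+2);
-- their difference is a combination of the two relations
-- (m+1) v = (a-m) u and (m+2) w = (a-m-1) v.
binomial-contiguous : ∀ x i j m → fromℤ m ≡ fromℕ 2 * fromℕ j - (1ℚ + fromℕ i) →
  let a = x + fromℕ (suc i ℕ.+ j) in
  colScale x j * binomial (a + 1ℚ) (1ℤ ℤ.+ (1ℤ ℤ.+ m)) + colShift x j * binomial a m
  ≡ rowScale x i * binomial (a + 1ℚ) (1ℤ ℤ.+ m) + rowShift x i * binomial a (1ℤ ℤ.+ (1ℤ ℤ.+ m))
binomial-contiguous x i j m m≡ = begin
  colScale x j * binomial (a + 1ℚ) (1ℤ ℤ.+ (1ℤ ℤ.+ m)) + colShift x j * u
    ≡⟨ cong₂ (λ f g → f * binomial (a + 1ℚ) (1ℤ ℤ.+ (1ℤ ℤ.+ m)) + g * u) cs≡ ct≡ ⟩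
  p * binomial (a + 1ℚ) (1ℤ ℤ.+ (1ℤ ℤ.+ m)) + q * u
    ≡⟨ cong (λ z → p * z + q * u) (binomial-pascal a (1ℤ ℤ.+ m)) ⟩
  p * (v + w) + q * u
    ≡⟨ identity x I J u v w ⟩
  (r * (u + v) + s * w) + α * ((M + 1ℚ) * v - (A - M) * u) + β * ((1ℚ + M + 1ℚ) * w - (A - (1ℚ + M)) * v)
    ≡⟨ cong₂ (λ y z → (r * (u + v) + s * w) + α * y + β * z) (vanish e₁) (vanish e₂) ⟩
  (r * (u + v) + s * w) + α * 0ℚ + β * 0ℚ
    ≡⟨ solve 3 (λ y α β → y :+ α :* con 0ℚ :+ β :* con 0ℚ := y) refl (r * (u + v) + s * w) α β ⟩
  r * (u + v) + s * w
    ≡⟨ cong (λ z → r * z + s * w) (binomial-pascal a m) ⟨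
  r * binomial (a + 1ℚ) (1ℤ ℤ.+ m) + s * w
    ≡⟨ cong₂ (λ f g → f * binomial (a + 1ℚ) (1ℤ ℤ.+ m) + g * w) rs≡ rt≡ ⟨
  rowScale x i * binomial (a + 1ℚ) (1ℤ ℤ.+ m) + rowShift x i * w ∎
  where
  open ≡-Reasoning
  a I J A M u v w p q r s α β : ℚ
  a = x + fromℕ (suc i ℕ.+ j)
  I = fromℕ i
  J = fromℕ j
  A = x + (1ℚ + (I + J))
  M = fromℕ 2 * J - (1ℚ + I)
  u = binomial a m
  v = binomial a (1ℤ ℤ.+ m)
  w = binomial a (1ℤ ℤ.+ (1ℤ ℤ.+ m))
  p = fromℕ 4 * (1ℚ + fromℕ 2 * J) * (x + ½ * (fromℕ 5 + fromℕ 3 * J))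
  q = (fromℕ 3 * J - x - 1ℚ) * (J + x + fromℕ 2)
  r = fromℕ 4 * ((x + (fromℕ 2 + I)) * (x + ½ * (fromℕ 5 + fromℕ 6 * I)))
  s = I * (fromℕ 4 * x + (fromℕ 7 + fromℕ 3 * I))
  -- Comparing the coefficients of `u` and `w` forces α = (r - q) / (A - M) and β = (p - s) / (M +
  -- 2); both quotients are exact.
  α = fromℕ 3 * J + fromℕ 5 * x + fromℕ 6 * I + fromℕ 11
  β = fromℕ 6 * J + fromℕ 4 * x + fromℕ 3 * I + fromℕ 10
  cs≡ : colScale x j ≡ p
  cs≡ = cong₂ (λ f g → f * (x + ½ * g))
    (trans (fromℕ-* 4 (suc (2 ℕ.* j))) (cong (fromℕ 4 *_) (trans (fromℕ-suc (2 ℕ.* j)) (cong (λ z → 1ℚ + z) (fromℕ-* 2 j)))))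
    (trans (fromℕ-+ 5 (3 ℕ.* j)) (cong (λ z → fromℕ 5 + z) (fromℕ-* 3 j)))
  ct≡ : colShift x j ≡ q
  ct≡ = cong (λ f → (f - x - 1ℚ) * (J + x + fromℕ 2)) (fromℕ-* 3 j)
  rs≡ : rowScale x i ≡ r
  rs≡ = cong₂ (λ f g → fromℕ 4 * ((x + f) * (x + ½ * g))) (fromℕ-+ 2 i)
    (trans (fromℕ-+ 5 (6 ℕ.* i)) (cong (λ z → fromℕ 5 + z) (fromℕ-* 6 i)))
  rt≡ : rowShift x i ≡ s
  rt≡ = cong (λ f → I * (fromℕ 4 * x + f)) (trans (fromℕ-+ 7 (3 ℕ.* i)) (cong (λ z → fromℕ 7 + z) (fromℕ-* 3 i)))
  a≡ : a ≡ A
  a≡ = cong (λ z → x + z) (trans (fromℕ-suc (i ℕ.+ j)) (cong (λ z → 1ℚ + z) (fromℕ-+ i j)))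
  m+1≡ : fromℤ (1ℤ ℤ.+ m) ≡ 1ℚ + M
  m+1≡ = trans (fromℤ-+ 1ℤ m) (cong (λ z → 1ℚ + z) m≡)
  e₁ : (M + 1ℚ) * v ≡ (A - M) * u
  e₁ = trans (cong (λ z → (z + 1ℚ) * v) (sym m≡))
    (trans (binomial-absorb a m) (cong₂ (λ y z → (y - z) * u) a≡ m≡))
  e₂ : (1ℚ + M + 1ℚ) * w ≡ (A - (1ℚ + M)) * v
  e₂ = trans (cong (λ z → (z + 1ℚ) * w) (sym m+1≡))
    (trans (binomial-absorb a (1ℤ ℤ.+ m)) (cong₂ (λ y z → (y - z) * v) a≡ m+1≡))
  vanish : ∀ {y z} → y ≡ z → y - z ≡ 0ℚ
  vanish {y} refl = ℚ.+-inverseʳ y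
  c : ∀ {n} → ℕ → +-*-Solver.Polynomial n
  c k = con (fromℕ k)
  identity : ∀ x I J u v w → let A = x + (1ℚ + (I + J)); M = fromℕ 2 * J - (1ℚ + I) in
    (fromℕ 4 * (1ℚ + fromℕ 2 * J) * (x + ½ * (fromℕ 5 + fromℕ 3 * J))) * (v + w)
      + ((fromℕ 3 * J - x - 1ℚ) * (J + x + fromℕ 2)) * u
    ≡ ((fromℕ 4 * ((x + (fromℕ 2 + I)) * (x + ½ * (fromℕ 5 + fromℕ 6 * I)))) * (u + v)
        + (I * (fromℕ 4 * x + (fromℕ 7 + fromℕ 3 * I))) * w)
      + (fromℕ 3 * J + fromℕ 5 * x + fromℕ 6 * I + fromℕ 11) * ((M + 1ℚ) * v - (A - M) * u)
      + (fromℕ 6 * J + fromℕ 4 * x + fromℕ 3 * I + fromℕ 10) * ((1ℚ + M + 1ℚ) * w - (A - (1ℚ + M)) * v)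
  identity = solve 6 (λ x I J u v w →
    let A = x :+ (c 1 :+ (I :+ J)) ; M = c 2 :* J :- (c 1 :+ I) in
    (c 4 :* (c 1 :+ c 2 :* J) :* (x :+ con ½ :* (c 5 :+ c 3 :* J))) :* (v :+ w)
      :+ ((c 3 :* J :- x :- c 1) :* (J :+ x :+ c 2)) :* u
    := ((c 4 :* ((x :+ (c 2 :+ I)) :* (x :+ con ½ :* (c 5 :+ c 6 :* I)))) :* (u :+ v)
        :+ (I :* (c 4 :* x :+ (c 7 :+ c 3 :* I))) :* w)
      :+ (c 3 :* J :+ c 5 :* x :+ c 6 :* I :+ c 11) :* ((M :+ c 1) :* v :- (A :- M) :* u)
      :+ (c 6 :* J :+ c 4 :* x :+ c 3 :* I :+ c 10) :* ((c 1 :+ M :+ c 1) :* w :- (A :- (c 1 :+ M)) :* v)) refl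

-- Only the presentation changes: the matrix stays the same, but its columns become the functions,
-- so that column operations act on a list of vectors.
D-transpose : ∀ (m : ℕ → ℕ → ℚ) N →
  D (applyUpTo (λ i j → m i j) N) (upTo N) ≡
  D (map (λ i c → c i) (upTo N)) (applyUpTo (λ j i → m i j) N)
D-transpose m N = sym (begin
  D (map (λ i c → c i) (upTo N)) (applyUpTo (λ j i → m i j) N)
    ≡⟨ cong (D (map (λ i c → c i) (upTo N))) (map-upTo (λ j i → m i j) N) ⟨
  D (map (λ i c → c i) (upTo N)) (map (λ j i → m i j) (upTo N))
    ≡⟨ D-map (λ j i → m i j) (map (λ i c → c i) (upTo N)) (upTo N) ⟩
  D (map (λ r j → r (λ i → m i j)) (map (λ i c → c i) (upTo N))) (upTo N)
    ≡⟨ cong (λ z → D (map (λ r j → r (λ i → m i j)) z) (upTo N)) (map-upTo (λ i c → c i) N) ⟩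
  D (map (λ r j → r (λ i → m i j)) (applyUpTo (λ i c → c i) N)) (upTo N)
    ≡⟨ cong (λ z → D z (upTo N)) (map-applyUpTo (λ i c → c i) (λ r j → r (λ i → m i j)) N) ⟩
  D (applyUpTo (λ i j → m i j) N) (upTo N) ∎)
  where open ≡-Reasoning

Δ : ℕ → ℚ → ℚ
Δ N x = D (applyUpTo (entry x) N) (upTo N)

-- Below its top entry 1, column 0 has negative lower indices, so it is a unit vector.
Δ-border : ∀ N x → Δ (suc N) x ≡
  D (applyUpTo (λ i j → entry x (suc i) (suc j)) N) (upTo N)
Δ-border N x = begin
  D (entry x 0 ∷ applyUpTo (λ i → entry x (suc i)) N) (0 ∷ applyUpTo suc N)
    ≡⟨ D-unit-column {c = 0} {r = entry x 0} refl (All.applyUpTo⁺₂ (λ i → entry x (suc i)) N λ i → refl) (applyUpTo suc N) ⟩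
  D (applyUpTo (λ i → entry x (suc i)) N) (applyUpTo suc N)
    ≡⟨ cong (D (applyUpTo (λ i → entry x (suc i)) N)) (map-upTo suc N) ⟨
  D (applyUpTo (λ i → entry x (suc i)) N) (map suc (upTo N))
    ≡⟨ D-map suc (applyUpTo (λ i → entry x (suc i)) N) (upTo N) ⟩
  D (map (λ r j → r (suc j)) (applyUpTo (λ i → entry x (suc i)) N)) (upTo N)
    ≡⟨ cong (λ z → D z (upTo N)) (map-applyUpTo (λ i → entry x (suc i)) (λ r j → r (suc j)) N) ⟩
  D (applyUpTo (λ i j → entry x (suc i) (suc j)) N) (upTo N) ∎
  where open ≡-Reasoning

-- The shift by 2 in x gives `entry x (suc i) (suc j)` and `entry (x + fromℕ 2) i j` the same upper
-- index; the other two entries share the upper index one less. So only two neighbouring rows of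
-- Pascal's triangle are involved. For i = 0 the missing entry is harmless because `rowShift x 0` is
-- 0.
entry-contiguous : ∀ x i j →
  colScale x j * entry x (suc i) (suc j) + colShift x j * entry x (suc i) j
  ≡ rowScale x i * entry (x + fromℕ 2) i j
    + rowShift x i * previous (λ _ → 0ℚ) (entry (x + fromℕ 2)) i j
entry-contiguous x i j = begin
  colScale x j * binomial (x + fromℕ (suc i ℕ.+ suc j)) (2 ℕ.* suc j ⊖ suc i)
    + colShift x j * binomial a m
    ≡⟨ cong₂ (λ y z → colScale x j * binomial y z + colShift x j * binomial a m) up₁ lo₁ ⟩
  colScale x j * binomial (a + 1ℚ) (1ℤ ℤ.+ (1ℤ ℤ.+ m)) + colShift x j * binomial a m
    ≡⟨ binomial-contiguous x i j m m≡ ⟩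
  rowScale x i * binomial (a + 1ℚ) (1ℤ ℤ.+ m) + rowShift x i * binomial a (1ℤ ℤ.+ (1ℤ ℤ.+ m))
    ≡⟨ cong₂ (λ y z → rowScale x i * binomial y z + rowShift x i * binomial a (1ℤ ℤ.+ (1ℤ ℤ.+ m))) up₂ lo₂ ⟩
  rowScale x i * entry (x + fromℕ 2) i j + rowShift x i * binomial a (1ℤ ℤ.+ (1ℤ ℤ.+ m))
    ≡⟨ cong (λ z → rowScale x i * entry (x + fromℕ 2) i j + z) (last i) ⟩
  rowScale x i * entry (x + fromℕ 2) i j
    + rowShift x i * previous (λ _ → 0ℚ) (entry (x + fromℕ 2)) i j ∎
  where
  open ≡-Reasoning
  a : ℚ
  a = x + fromℕ (suc i ℕ.+ j)
  m : ℤ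
  m = 2 ℕ.* j ⊖ suc i
  1+⊖ : ∀ k l → 1ℤ ℤ.+ (k ⊖ suc l) ≡ k ⊖ l
  1+⊖ k l = trans (ℤ.distribʳ-⊖-+-pos 1 k (suc l)) (ℤ.[1+m]⊖[1+n]≡m⊖n k l)
  lo₂ : 1ℤ ℤ.+ m ≡ 2 ℕ.* j ⊖ i
  lo₂ = 1+⊖ (2 ℕ.* j) i
  lo₁ : 2 ℕ.* suc j ⊖ suc i ≡ 1ℤ ℤ.+ (1ℤ ℤ.+ m)
  lo₁ = begin
    2 ℕ.* suc j ⊖ suc i        ≡⟨ cong (_⊖ suc i) (ℕ.*-suc 2 j) ⟩
    suc (suc (2 ℕ.* j)) ⊖ suc i ≡⟨ ℤ.[1+m]⊖[1+n]≡m⊖n (suc (2 ℕ.* j)) i ⟩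
    suc (2 ℕ.* j) ⊖ i          ≡⟨ ℤ.distribʳ-⊖-+-pos 1 (2 ℕ.* j) i ⟨
    1ℤ ℤ.+ (2 ℕ.* j ⊖ i)       ≡⟨ cong (λ z → 1ℤ ℤ.+ z) lo₂ ⟨
    1ℤ ℤ.+ (1ℤ ℤ.+ m)          ∎
  m≡ : fromℤ m ≡ fromℕ 2 * fromℕ j - (1ℚ + fromℕ i)
  m≡ = trans (fromℤ-⊖ (2 ℕ.* j) (suc i)) (cong₂ _-_ (fromℕ-* 2 j) (fromℕ-suc i))
  up₁ : x + fromℕ (suc i ℕ.+ suc j) ≡ a + 1ℚ
  up₁ = begin
    x + fromℕ (suc i ℕ.+ suc j)   ≡⟨ cong (λ k → x + fromℕ k) (ℕ.+-suc (suc i) j) ⟩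
    x + fromℕ (suc (suc i ℕ.+ j)) ≡⟨ cong (λ z → x + z) (fromℕ-suc (suc i ℕ.+ j)) ⟩
    x + (1ℚ + fromℕ (suc i ℕ.+ j)) ≡⟨ solve 2 (λ x y → x :+ (con 1ℚ :+ y) := x :+ y :+ con 1ℚ) refl x (fromℕ (suc i ℕ.+ j)) ⟩
    x + fromℕ (suc i ℕ.+ j) + 1ℚ ∎
  up₂ : a + 1ℚ ≡ x + fromℕ 2 + fromℕ (i ℕ.+ j)
  up₂ = trans (cong (λ z → x + z + 1ℚ) (fromℕ-suc (i ℕ.+ j)))
    (solve 2 (λ x y → x :+ (con 1ℚ :+ y) :+ con 1ℚ := x :+ con (fromℕ 2) :+ y) refl x (fromℕ (i ℕ.+ j)))
  last : ∀ k → rowShift x k * binomial (x + fromℕ (suc k ℕ.+ j)) (1ℤ ℤ.+ (1ℤ ℤ.+ (2 ℕ.* j ⊖ suc k)))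
             ≡ rowShift x k * previous (λ _ → 0ℚ) (entry (x + fromℕ 2)) k j
  last zero    = trans (cong (_* binomial (x + fromℕ (1 ℕ.+ j)) (1ℤ ℤ.+ (1ℤ ℤ.+ (2 ℕ.* j ⊖ 1)))) r≡0)
    (trans (*-zeroˡ (binomial (x + fromℕ (1 ℕ.+ j)) (1ℤ ℤ.+ (1ℤ ℤ.+ (2 ℕ.* j ⊖ 1))))) (sym (*-zeroʳ (rowShift x 0))))
    where
    r≡0 : rowShift x 0 ≡ 0ℚ
    r≡0 = *-zeroˡ (fromℕ 4 * x + fromℕ 7)
  last (suc k) = cong₂ (λ y z → rowShift x (suc k) * binomial y z)
    (trans (cong (λ z → x + z) (fromℕ-+ 2 (k ℕ.+ j))) (sym (ℚ.+-assoc x (fromℕ 2) (fromℕ (k ℕ.+ j)))))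
    (trans (cong (λ z → 1ℤ ℤ.+ z) (1+⊖ (2 ℕ.* j) (suc k))) (1+⊖ (2 ℕ.* j) k))

Δ-recurrence : ∀ N x → Δ (suc N) x * ∏ (colScale x) N ≡ ∏ (rowScale x) N * Δ N (x + fromℕ 2)
Δ-recurrence N x = begin
  Δ (suc N) x * ∏ (colScale x) N
    ≡⟨ *-comm (Δ (suc N) x) _ ⟩
  ∏ (colScale x) N * Δ (suc N) x
    ≡⟨ cong (λ z → ∏ (colScale x) N * z) (trans (Δ-border N x) (D-transpose (λ i j → entry x (suc i) (suc j)) N)) ⟩
  ∏ (colScale x) N * D evals (applyUpTo (λ j i → entry x (suc i) (suc j)) N)
    ≡⟨ bidiagonal (D-columns (upTo N)) (colScale x) (colShift x) (λ j i → entry x (suc i) (suc j)) (λ j i → w i j) N columns ⟨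
  D evals (applyUpTo (λ j i → w i j) N)
    ≡⟨ D-transpose w N ⟨
  D (applyUpTo w N) (upTo N)
    ≡⟨ bidiagonal (D-rows (upTo N)) (rowScale x) (rowShift x) (entry (x + fromℕ 2)) w N (λ i j → refl) ⟩
  ∏ (rowScale x) N * Δ N (x + fromℕ 2) ∎
  where
  open ≡-Reasoning
  evals : List ((ℕ → ℚ) → ℚ)
  evals = map (λ i c → c i) (upTo N)
  w : ℕ → ℕ → ℚ
  w i j = rowScale x i * entry (x + fromℕ 2) i j
          + rowShift x i * previous (λ _ → 0ℚ) (entry (x + fromℕ 2)) i j
  columns : ∀ j i → w i j ≡ colScale x j * entry x (suc i) (suc j)
    + colShift x j * previous (λ _ → 0ℚ) (λ j i → entry x (suc i) (suc j)) j i
  -- There is no column before column 0, but `entry x (suc i) 0` has a negative lower index and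
  -- computes to the default 0 of `previous`.
  columns zero    i = sym (entry-contiguous x i 0)
  columns (suc j) i = sym (entry-contiguous x i (suc j))

-- Polynomial functions

evaluate : List ℚ → ℚ → ℚ
evaluate []       x = 0ℚ
evaluate (c ∷ cs) x = c + x * evaluate cs x

Polynomial : (ℚ → ℚ) → Set
Polynomial f = ∃[ cs ] f ≗ evaluate cs

addCoeffs : List ℚ → List ℚ → List ℚ
addCoeffs []       ds       = ds
addCoeffs (c ∷ cs) []       = c ∷ cs
addCoeffs (c ∷ cs) (d ∷ ds) = c + d ∷ addCoeffs cs ds

evaluate-add : ∀ cs ds x → evaluate (addCoeffs cs ds) x ≡ evaluate cs x + evaluate ds x
evaluate-add []       ds       x = sym (ℚ.+-identityˡ (evaluate ds x))
evaluate-add (c ∷ cs) []       x = sym (+-identityʳ (c + x * evaluate cs x))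
evaluate-add (c ∷ cs) (d ∷ ds) x = trans
  (cong (λ z → c + d + x * z) (evaluate-add cs ds x))
  (solve 5 (λ c d x y z → c :+ d :+ x :* (y :+ z) := c :+ x :* y :+ (d :+ x :* z)) refl
    c d x (evaluate cs x) (evaluate ds x))

evaluate-scale : ∀ s cs x → evaluate (map (s *_) cs) x ≡ s * evaluate cs x
evaluate-scale s []       x = sym (*-zeroʳ s)
evaluate-scale s (c ∷ cs) x = trans
  (cong (λ z → s * c + x * z) (evaluate-scale s cs x))
  (solve 4 (λ s c x y → s :* c :+ x :* (s :* y) := s :* (c :+ x :* y)) refl s c x (evaluate cs x))

mulCoeffs : List ℚ → List ℚ → List ℚ
mulCoeffs []       ds = []
mulCoeffs (c ∷ cs) ds = addCoeffs (map (c *_) ds) (0ℚ ∷ mulCoeffs cs ds)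

evaluate-mul : ∀ cs ds x → evaluate (mulCoeffs cs ds) x ≡ evaluate cs x * evaluate ds x
evaluate-mul []       ds x = sym (*-zeroˡ (evaluate ds x))
evaluate-mul (c ∷ cs) ds x = begin
  evaluate (addCoeffs (map (c *_) ds) (0ℚ ∷ mulCoeffs cs ds)) x
    ≡⟨ evaluate-add (map (c *_) ds) (0ℚ ∷ mulCoeffs cs ds) x ⟩
  evaluate (map (c *_) ds) x + (0ℚ + x * evaluate (mulCoeffs cs ds) x)
    ≡⟨ cong₂ (λ y z → y + (0ℚ + x * z)) (evaluate-scale c ds x) (evaluate-mul cs ds x) ⟩
  c * evaluate ds x + (0ℚ + x * (evaluate cs x * evaluate ds x))
    ≡⟨ solve 4 (λ c x y z → c :* z :+ (con 0ℚ :+ x :* (y :* z)) := (c :+ x :* y) :* z) refl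
         c x (evaluate cs x) (evaluate ds x) ⟩
  (c + x * evaluate cs x) * evaluate ds x ∎
  where open ≡-Reasoning

constant-polynomial : ∀ c → Polynomial (λ _ → c)
constant-polynomial c = c ∷ [] , λ x → solve 2 (λ c x → c := c :+ x :* con 0ℚ) refl c x

identity-polynomial : Polynomial (λ x → x)
identity-polynomial = 0ℚ ∷ 1ℚ ∷ [] ,
  solve 1 (λ x → x := con 0ℚ :+ x :* (con 1ℚ :+ x :* con 0ℚ)) refl

polynomial-cong : ∀ {f g} → f ≗ g → Polynomial g → Polynomial f
polynomial-cong e (cs , p) = cs , λ x → trans (e x) (p x)

+-polynomial : ∀ {f g} → Polynomial f → Polynomial g → Polynomial (λ x → f x + g x)
+-polynomial (cs , p) (ds , q) = addCoeffs cs ds , λ x →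
  trans (cong₂ _+_ (p x) (q x)) (sym (evaluate-add cs ds x))

*-polynomial : ∀ {f g} → Polynomial f → Polynomial g → Polynomial (λ x → f x * g x)
*-polynomial (cs , p) (ds , q) = mulCoeffs cs ds , λ x →
  trans (cong₂ _*_ (p x) (q x)) (sym (evaluate-mul cs ds x))

neg-polynomial : ∀ {f} → Polynomial f → Polynomial (λ x → - f x)
neg-polynomial {f} p = polynomial-cong (λ x → solve 1 (λ y → :- y := :- con 1ℚ :* y) refl (f x))
  (*-polynomial (constant-polynomial (- 1ℚ)) p)

-- Horner's scheme: the coefficients of the quotient are the values at `b` of the tails of the
-- coefficient list. The length is recorded for a later induction on it.
divide : ∀ c cs b → ∃[ qs ] length qs ≡ length cs ×
  (∀ x → evaluate (c ∷ cs) x ≡ evaluate (c ∷ cs) b + (x - b) * evaluate qs x)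
divide c []       b = [] , refl ,
  λ x → solve 3 (λ c b x → c :+ x :* con 0ℚ := c :+ b :* con 0ℚ :+ (x :- b) :* con 0ℚ) refl c b x
divide c (d ∷ ds) b with divide d ds b
... | qs , l , e = evaluate (d ∷ ds) b ∷ qs , cong suc l , λ x → trans
  (cong (λ z → c + x * z) (e x))
  (solve 5 (λ c b x y z → c :+ x :* (y :+ (x :- b) :* z)
                       := c :+ b :* y :+ (x :- b) :* (y :+ x :* z)) refl
    c b x (evaluate (d ∷ ds) b) (evaluate qs x))

difference-zero : ∀ {p q} → p - q ≡ 0ℚ → p ≡ q
difference-zero {p} {q} e = trans (solve 2 (λ p q → p := (p :- q) :+ q) refl p q)
  (trans (cong (_+ q) e) (ℚ.+-identityˡ q))

-- Dividing by the root a + k shortens the list and keeps all later points of the progression as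
-- roots. The length is a separate argument since the quotient is not a part of the original list.
infinitely-many-roots : ∀ l cs → length cs ≡ l → ∀ a k →
  (∀ m → k ℕ.≤ m → evaluate cs (a + fromℕ m) ≡ 0ℚ) → ∀ x → evaluate cs x ≡ 0ℚ
infinitely-many-roots l       []       _ a k z x = refl
infinitely-many-roots (suc l) (c ∷ cs) e a k z x with divide c cs (a + fromℕ k)
... | qs , l≡ , d = trans (d x) (trans (cong₂ (λ y z → y + (x - (a + fromℕ k)) * z) (z k ℕ.≤-refl) (q≡0 x))
        (solve 1 (λ y → con 0ℚ :+ y :* con 0ℚ := con 0ℚ) refl (x - (a + fromℕ k))))
  where
  roots : ∀ m → suc k ℕ.≤ m → evaluate qs (a + fromℕ m) ≡ 0ℚ
  roots m k<m with no-zero-divisors {a + fromℕ m - (a + fromℕ k)} (begin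
    (a + fromℕ m - (a + fromℕ k)) * evaluate qs (a + fromℕ m)
      ≡⟨ ℚ.+-identityˡ _ ⟨
    0ℚ + (a + fromℕ m - (a + fromℕ k)) * evaluate qs (a + fromℕ m)
      ≡⟨ cong (λ y → y + (a + fromℕ m - (a + fromℕ k)) * evaluate qs (a + fromℕ m)) (z k ℕ.≤-refl) ⟨
    evaluate (c ∷ cs) (a + fromℕ k) + (a + fromℕ m - (a + fromℕ k)) * evaluate qs (a + fromℕ m)
      ≡⟨ d (a + fromℕ m) ⟨
    evaluate (c ∷ cs) (a + fromℕ m)
      ≡⟨ z m (ℕ.<⇒≤ k<m) ⟩
    0ℚ ∎)
    where open ≡-Reasoning
  ... | inj₂ q≡0 = q≡0
  ... | inj₁ m-k≡0 = contradiction (ℤ.+-injective (fromℤ-injective (difference-zero (trans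
          (solve 3 (λ a m k → m :- k := a :+ m :- (a :+ k)) refl a (fromℕ m) (fromℕ k)) m-k≡0))))
          (ℕ.<⇒≢ k<m ∘ sym)
  q≡0 : ∀ x → evaluate qs x ≡ 0ℚ
  q≡0 = infinitely-many-roots l qs (trans l≡ (ℕ.suc-injective e)) a (suc k) roots

-- An algebraic substitute for continuity: the points a + m with m at least 1 are infinitely many
-- roots avoiding a.
polynomial-continuity : ∀ {f} → Polynomial f → ∀ a → (∀ x → x ≢ a → f x ≡ 0ℚ) → ∀ x → f x ≡ 0ℚ
polynomial-continuity (cs , p) a z x = trans (p x)
  (infinitely-many-roots (length cs) cs refl a 1 (λ m 1≤m → trans (sym (p _)) (z _ (distinct m 1≤m))) x)
  where
  distinct : ∀ m → 1 ℕ.≤ m → a + fromℕ m ≢ a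
  distinct m 1≤m e = ℕ.<⇒≢ 1≤m (sym (ℤ.+-injective (fromℤ-injective (trans
    (solve 2 (λ a m → m := a :+ m :- a) refl a (fromℕ m)) (trans (cong (_- a) e) (ℚ.+-inverseʳ a))))))

contract-polynomial : ∀ {K : Set} (a : ℚ → K → ℚ) (g : ℚ → List K → ℚ) →
  (∀ c → Polynomial (λ x → a x c)) → (∀ cs → Polynomial (λ x → g x cs)) →
  ∀ cs → Polynomial (λ x → contract (a x) (g x) cs)
contract-polynomial a g p q []       = constant-polynomial 0ℚ
contract-polynomial a g p q (c ∷ cs) = +-polynomial (*-polynomial (p c) (q cs))
  (neg-polynomial (contract-polynomial a (λ x ds → g x (c ∷ ds)) p (λ ds → q (c ∷ ds)) cs))

D-polynomial : ∀ {K : Set} (m : ℚ → ℕ → K → ℚ) → (∀ i c → Polynomial (λ x → m x i c)) →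
  ∀ N cs → Polynomial (λ x → D (applyUpTo (m x) N) cs)
D-polynomial m p zero    []      = constant-polynomial 1ℚ
D-polynomial m p zero    (_ ∷ _) = constant-polynomial 0ℚ
D-polynomial m p (suc N) cs      = contract-polynomial (λ x → m x 0) _ (p 0)
  (D-polynomial (λ x i → m x (suc i)) (λ i → p (suc i)) N) cs

binomial-polynomial : ∀ {f} → Polynomial f → ∀ m → Polynomial (λ x → binomial (f x) m)
binomial-polynomial {f} p (+ m)    = *-polynomial (falling m) (constant-polynomial (1/! m))
  where
  falling : ∀ m → Polynomial (λ x → fallingFactorial (f x) m)
  falling zero    = constant-polynomial 1ℚ
  falling (suc m) = *-polynomial (falling m) (+-polynomial p (constant-polynomial (- fromℕ m)))
binomial-polynomial p -[1+ _ ] = constant-polynomial 0ℚ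

Δ-polynomial : ∀ N → Polynomial (Δ N)
Δ-polynomial N = D-polynomial entry
  (λ i j → binomial-polynomial (+-polynomial identity-polynomial (constant-polynomial (fromℕ (i ℕ.+ j)))) (2 ℕ.* j ⊖ i))
  N (upTo N)

-- Products of linear factors and their division

linearProduct : List ℚ → ℚ → ℚ
linearProduct bs x = productℚ (map (λ b → x + b) bs)

linearProduct-++ : ∀ as bs x → linearProduct (as ++ bs) x ≡ linearProduct as x * linearProduct bs x
linearProduct-++ []       bs x = sym (*-identityˡ (linearProduct bs x))
linearProduct-++ (a ∷ as) bs x = trans (cong ((x + a) *_) (linearProduct-++ as bs x))
  (sym (*-assoc (x + a) (linearProduct as x) (linearProduct bs x)))

linearProduct-polynomial : ∀ bs → Polynomial (linearProduct bs)
linearProduct-polynomial []       = constant-polynomial 1ℚ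
linearProduct-polynomial (b ∷ bs) =
  *-polynomial (+-polynomial identity-polynomial (constant-polynomial b)) (linearProduct-polynomial bs)

-- The condition on c makes every zero of f a zero of one of the linear factors; division relies on
-- this.
Splits : (ℚ → ℚ) → Set
Splits f = ∃[ c ] ∃[ bs ] (c ≢ 0ℚ × (∀ x → f x ≡ c * linearProduct bs x))

constant-splits : ∀ {c} → c ≢ 0ℚ → Splits (λ _ → c)
constant-splits {c} c≢0 = c , [] , c≢0 , λ x → sym (ℚ.*-identityʳ c)

linear-splits : ∀ b → Splits (λ x → x + b)
linear-splits b = 1ℚ , b ∷ [] , (λ ()) , λ x →
  solve 2 (λ x b → x :+ b := con 1ℚ :* ((x :+ b) :* con 1ℚ)) refl x b

*-splits : ∀ {f g} → Splits f → Splits g → Splits (λ x → f x * g x)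
*-splits (c , as , c≢0 , p) (d , bs , d≢0 , q) = c * d , as ++ bs , *-nonzero c≢0 d≢0 , λ x → trans
  (cong₂ _*_ (p x) (q x)) (trans
  (solve 4 (λ c d y z → c :* y :* (d :* z) := c :* d :* (y :* z)) refl c d (linearProduct as x) (linearProduct bs x))
  (cong (c * d *_) (sym (linearProduct-++ as bs x))))

∏-splits : ∀ (s : ℚ → ℕ → ℚ) → (∀ k → Splits (λ x → s x k)) → ∀ N → Splits (λ x → ∏ (s x) N)
∏-splits s p zero    = constant-splits λ ()
∏-splits s p (suc N) = *-splits (p 0) (∏-splits (λ x k → s x (suc k)) (λ k → p (suc k)) N)

shift-splits : ∀ {f} → Splits f → ∀ a → Splits (λ x → f (x + a))
shift-splits (c , bs , c≢0 , p) a = c , map (λ b → a + b) bs , c≢0 , λ x →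
  trans (p (x + a)) (cong (c *_) (shift bs x))
  where
  shift : ∀ bs x → linearProduct bs (x + a) ≡ linearProduct (map (λ b → a + b) bs) x
  shift []       x = refl
  shift (b ∷ bs) x = cong₂ _*_ (ℚ.+-assoc x a b) (shift bs x)

linearProduct-root : ∀ bs a → linearProduct bs (- a) ≡ 0ℚ →
  ∃[ cs ] (∀ x → linearProduct bs x ≡ (x + a) * linearProduct cs x)
linearProduct-root (b ∷ bs) a z with no-zero-divisors {(- a) + b} z
... | inj₁ -a+b≡0 = bs , λ x → cong (λ y → (x + y) * linearProduct bs x)
        (trans (solve 2 (λ a b → b := :- a :+ b :+ a) refl a b) (trans (cong (_+ a) -a+b≡0) (ℚ.+-identityˡ a)))
... | inj₂ z′ with linearProduct-root bs a z′
... | cs , e = b ∷ cs , λ x → trans (cong ((x + b) *_) (e x))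
        (solve 4 (λ x a b y → (x :+ b) :* ((x :+ a) :* y) := (x :+ a) :* ((x :+ b) :* y)) refl x a b (linearProduct cs x))

-- At -a the given product vanishes, so x + a occurs among the factors of its splitting and can be
-- removed from both sides: by cancellation for x other than -a, and at -a itself because both sides
-- are polynomials.
splits-divide-linear : ∀ {f} → Polynomial f → ∀ as → Splits (λ x → f x * linearProduct as x) → Splits f
splits-divide-linear {f} p []       (c , bs , c≢0 , e) = c , bs , c≢0 , λ x →
  trans (sym (ℚ.*-identityʳ (f x))) (e x)
splits-divide-linear {f} p (a ∷ as) (c , bs , c≢0 , e) = step (linearProduct-root bs a root)
  where
  root : linearProduct bs (- a) ≡ 0ℚ
  root = [ (λ c≡0 → contradiction c≡0 c≢0) , id ]′ (no-zero-divisors {c} {linearProduct bs (- a)} (trans (sym (e (- a)))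
    (solve 3 (λ a y z → y :* ((:- a :+ a) :* z) := con 0ℚ) refl a (f (- a)) (linearProduct as (- a)))))
  step : ∃[ cs ] (∀ x → linearProduct bs x ≡ (x + a) * linearProduct cs x) → Splits f
  step (cs , d) = splits-divide-linear {f} p as (c , cs , c≢0 , λ x →
    difference-zero {f x * linearProduct as x} {c * linearProduct cs x} (cancelled x))
   where
   open ≡-Reasoning
   g h : ℚ → ℚ
   g x = f x * linearProduct as x
   h x = c * linearProduct cs x
   g-polynomial : Polynomial g
   g-polynomial = *-polynomial {f} p (linearProduct-polynomial as)
   h-polynomial : Polynomial h
   h-polynomial = *-polynomial {λ _ → c} (constant-polynomial c) (linearProduct-polynomial cs)
   agree : ∀ x → x ≢ - a → g x - h x ≡ 0ℚ
   agree x x≢-a = trans (cong (_- h x) (*-cancel-nonzero {x + a} {g x} {h x} x+a≢0 (begin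
       (x + a) * (f x * linearProduct as x)
         ≡⟨ solve 3 (λ y z w → y :* (z :* w) := z :* (y :* w)) refl (x + a) (f x) (linearProduct as x) ⟩
       f x * ((x + a) * linearProduct as x)
         ≡⟨ e x ⟩
       c * linearProduct bs x
         ≡⟨ cong (c *_) (d x) ⟩
       c * ((x + a) * linearProduct cs x)
         ≡⟨ solve 3 (λ y z w → z :* (y :* w) := y :* (z :* w)) refl (x + a) c (linearProduct cs x) ⟩
       (x + a) * (c * linearProduct cs x) ∎))) (ℚ.+-inverseʳ (h x))
     where
     x+a≢0 : x + a ≢ 0ℚ
     x+a≢0 x+a≡0 = x≢-a (difference-zero (trans (solve 2 (λ x a → x :- :- a := x :+ a) refl x a) x+a≡0))
   cancelled : ∀ x → g x - h x ≡ 0ℚ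
   cancelled = polynomial-continuity {λ x → g x - h x}
     (+-polynomial {g} g-polynomial (neg-polynomial {h} h-polynomial)) (- a) agree

splits-divide : ∀ {f g} → Polynomial f → Splits g → Splits (λ x → f x * g x) → Splits f
splits-divide {f} {g} p (c , as , c≢0 , e) (d , bs , d≢0 , e′) =
  splits-divide-linear p as ((1/ c) * d , bs , *-nonzero 1/c≢0 d≢0 , λ x → begin
    f x * linearProduct as x
      ≡⟨ ℚ.*-identityˡ _ ⟨
    1ℚ * (f x * linearProduct as x)
      ≡⟨ cong (_* (f x * linearProduct as x)) (ℚ.*-inverseˡ c) ⟨
    (1/ c) * c * (f x * linearProduct as x)
      ≡⟨ solve 4 (λ i c y z → i :* c :* (y :* z) := i :* (y :* (c :* z))) refl (1/ c) c (f x) (linearProduct as x) ⟩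
    (1/ c) * (f x * (c * linearProduct as x))
      ≡⟨ cong (λ z → (1/ c) * (f x * z)) (e x) ⟨
    (1/ c) * (f x * g x)
      ≡⟨ cong ((1/ c) *_) (e′ x) ⟩
    (1/ c) * (d * linearProduct bs x)
      ≡⟨ *-assoc (1/ c) d (linearProduct bs x) ⟨
    (1/ c) * d * linearProduct bs x ∎)
  where
  open ≡-Reasoning
  instance _ = ℚ.≢-nonZero c≢0
  1/c≢0 : 1/ c ≢ 0ℚ
  1/c≢0 1/c≡0 with trans (sym (ℚ.*-inverseˡ c)) (trans (cong (_* c) 1/c≡0) (*-zeroˡ c))
  ... | ()

splits-cong : ∀ {f g} → f ≗ g → Splits g → Splits f
splits-cong e (c , bs , c≢0 , p) = c , bs , c≢0 , λ x → trans (e x) (p x)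

fromℕ-suc≢0 : ∀ k → fromℕ (suc k) ≢ 0ℚ
fromℕ-suc≢0 k e with fromℤ-injective e
... | ()

Δ-splits : ∀ N → Splits (Δ N)
Δ-splits zero    = constant-splits λ ()
Δ-splits (suc N) = splits-divide (Δ-polynomial (suc N))
  (∏-splits colScale (λ j → *-splits (constant-splits (fromℕ-suc≢0 _)) (linear-splits (½ * fromℕ (5 ℕ.+ 3 ℕ.* j)))) N)
  (splits-cong (Δ-recurrence N) (*-splits
    (∏-splits rowScale (λ i → *-splits (constant-splits (fromℕ-suc≢0 _))
      (*-splits (linear-splits (fromℕ (2 ℕ.+ i))) (linear-splits (½ * fromℕ (5 ℕ.+ 6 ℕ.* i))))) N)
    (shift-splits (Δ-splits N) (fromℕ 2))))

det-binomialMatrix : ∀ N x → det (binomialMatrix N x) ≡ Δ N x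
det-binomialMatrix N x = trans (det≡D N (entry x ∘ toℕ) toℕ)
  (cong₂ D (tabulate-toℕ (entry x) N) (tabulate-toℕ id N))
  where
  tabulate-toℕ : ∀ {A : Set} (f : ℕ → A) N → tabulate {n = N} (f ∘ toℕ) ≡ applyUpTo f N
  tabulate-toℕ f zero    = refl
  tabulate-toℕ f (suc N) = cong (f 0 ∷_) (tabulate-toℕ (f ∘ suc) N)

-- Coverings

-- ap b k and dn b k are the up- and the down-pointing triangle of row b on the
-- left and on the right of the k-th edge in direction -60°, counted from the west.
data Tri : Set where
  ap dn : ℕ → ℕ → Tri

_≟_ : DecidableEquality Tri
ap b k ≟ ap c l = map′ (λ { (refl , refl) → refl }) (λ { refl → refl , refl }) ((b ℕ.≟ c) ×-dec (k ℕ.≟ l))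
ap b k ≟ dn c l = no λ ()
dn b k ≟ ap c l = no λ ()
dn b k ≟ dn c l = map′ (λ { (refl , refl) → refl }) (λ { refl → refl , refl }) ((b ℕ.≟ c) ×-dec (k ℕ.≟ l))

Pair : Set
Pair = Tri × Tri

abstract
  -- Opaque, so that goals contain `hit` and not the nested decisions on indices; `hit-does` gives
  -- access to these for the comparison with `covers?`.
  hit : Tri → Pair → ℕ
  hit t (u , d) = if does ((t ≟ u) ⊎-dec (t ≟ d)) then 1 else 0

  hit-outside : ∀ {t u d} → t ≢ u → t ≢ d → hit t (u , d) ≡ 0
  hit-outside {t} {u} {d} t≢u t≢d =
    cong (if_then 1 else 0) (dec-false ((t ≟ u) ⊎-dec (t ≟ d)) [ t≢u , t≢d ]′)

  hit-up : ∀ {u d} → hit u (u , d) ≡ 1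
  hit-up {u} {d} = cong (if_then 1 else 0) (dec-true ((u ≟ u) ⊎-dec (u ≟ d)) (inj₁ refl))

  hit-down : ∀ {u d} → hit d (u , d) ≡ 1
  hit-down {u} {d} = cong (if_then 1 else 0) (dec-true ((d ≟ u) ⊎-dec (d ≟ d)) (inj₂ refl))

  hit-does : ∀ t u d → hit t (u , d) ≡ (if does ((t ≟ u) ⊎-dec (t ≟ d)) then 1 else 0)
  hit-does t u d = refl

infixl 5 _⊞_

_⊞_ : (Tri → ℕ) → Pair → Tri → ℕ
(δ ⊞ ℓ) t = hit t ℓ ℕ.+ δ t

⊞-outside : ∀ δ {t u d} → t ≢ u → t ≢ d → (δ ⊞ (u , d)) t ≡ δ t
⊞-outside δ {t} t≢u t≢d = cong (ℕ._+ δ t) (hit-outside t≢u t≢d)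

complete : List Tri → (Tri → ℕ) → ℚ
complete []      δ = 1ℚ
complete (t ∷ V) δ = if δ t ≡ᵇ 1 then complete V δ else 0ℚ

-- The number of subsets of Λ which, added to δ, cover every triangle of V once.
coverings : List Pair → List Tri → (Tri → ℕ) → ℚ
coverings []      V δ = complete V δ
coverings (ℓ ∷ Λ) V δ = coverings Λ V (δ ⊞ ℓ) + coverings Λ V δ

optional : {A : Set} → Bool → A → List A
optional true  a = a ∷ []
optional false a = []

when : Bool → ℚ → ℚ
when true  q = q
when false q = 0ℚ

when-0 : ∀ b → when b 0ℚ ≡ 0ℚ
when-0 true  = refl
when-0 false = refl

coverings-optional : ∀ b ℓ Λ V δ → coverings (optional b ℓ ++ Λ) V δ
  ≡ when b (coverings Λ V (δ ⊞ ℓ)) + coverings Λ V δ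
coverings-optional true  ℓ Λ V δ = refl
coverings-optional false ℓ Λ V δ = sym (ℚ.+-identityˡ (coverings Λ V δ))

Untouched : List Pair → Tri → Set
Untouched Λ t = All (λ ℓ → hit t ℓ ≡ 0) Λ

-- No choice from Λ changes the coverage of t, so the condition at t depends on δ alone and can be
-- pulled out of the sum.
coverings-untouched : ∀ {Λ t} → Untouched Λ t → ∀ V δ →
  coverings Λ (t ∷ V) δ ≡ (if δ t ≡ᵇ 1 then coverings Λ V δ else 0ℚ)
coverings-untouched []      V δ = refl
coverings-untouched {ℓ ∷ Λ} {t} (z ∷ zs) V δ = trans
  (cong₂ _+_ (trans (coverings-untouched zs V (δ ⊞ ℓ))
                    (cong (λ h → if (h ℕ.+ δ t) ≡ᵇ 1 then coverings Λ V (δ ⊞ ℓ) else 0ℚ) z))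
             (coverings-untouched zs V δ))
  (choose (δ t ≡ᵇ 1))
  where
  choose : ∀ b → (if b then coverings Λ V (δ ⊞ ℓ) else 0ℚ) + (if b then coverings Λ V δ else 0ℚ)
               ≡ (if b then coverings (ℓ ∷ Λ) V δ else 0ℚ)
  choose true  = refl
  choose false = refl

-- u and d are the last two triangles of a partial row, γ, α and ε the lozenges
-- joining d to the triangle before it, d to u, and u to the row below.
module Step
  {u d : Tri} {γ α ε : Pair} (p q : Bool) {Λ : List Pair} (V : List Tri)
  (γ-u : hit u γ ≡ 0) (α-u : hit u α ≡ 1) (ε-u : hit u ε ≡ 1)
  (γ-d : hit d γ ≡ 1) (α-d : hit d α ≡ 1) (ε-d : hit d ε ≡ 0)
  (u-untouched : Untouched Λ u) (d-untouched : Untouched Λ d)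
  where

  total : (Tri → ℕ) → ℚ
  total δ = coverings (optional p γ ++ α ∷ optional q ε ++ Λ) (u ∷ d ∷ V) δ

  private
    bit : Bool → ℕ
    bit b = if b then 1 else 0

    add : Bool → Pair → (Tri → ℕ) → Tri → ℕ
    add b ℓ δ = if b then δ ⊞ ℓ else δ

    add-miss : ∀ b {ℓ t} δ → hit t ℓ ≡ 0 → add b ℓ δ t ≡ δ t
    add-miss true  {t = t} δ e = cong (ℕ._+ δ t) e
    add-miss false δ e = refl

    add-hit : ∀ b {ℓ t} δ → hit t ℓ ≡ 1 → add b ℓ δ t ≡ bit b ℕ.+ δ t
    add-hit true  {t = t} δ e = cong (ℕ._+ δ t) e
    add-hit false δ e = refl

    state : Bool → Bool → Bool → (Tri → ℕ) → Tri → ℕ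
    state a b c δ = add c ε (add b α (add a γ δ))

    value : ℕ → ℕ → Bool → Bool → Bool → (Tri → ℕ) → ℚ
    value m n a b c δ =
      if (bit c ℕ.+ (bit b ℕ.+ m)) ≡ᵇ 1
      then if (bit b ℕ.+ (bit a ℕ.+ n)) ≡ᵇ 1 then coverings Λ V (state a b c δ) else 0ℚ
      else 0ℚ

    leaf : ∀ a b c {δ m n} → δ u ≡ m → δ d ≡ n →
           coverings Λ (u ∷ d ∷ V) (state a b c δ) ≡ value m n a b c δ
    leaf a b c {δ} {m} {n} δu δd = begin
      coverings Λ (u ∷ d ∷ V) s
        ≡⟨ coverings-untouched u-untouched (d ∷ V) s ⟩
      (if s u ≡ᵇ 1 then coverings Λ (d ∷ V) s else 0ℚ)
        ≡⟨ cong (λ z → if s u ≡ᵇ 1 then z else 0ℚ) (coverings-untouched d-untouched V s) ⟩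
      (if s u ≡ᵇ 1 then if s d ≡ᵇ 1 then coverings Λ V s else 0ℚ else 0ℚ)
        ≡⟨ cong₂ (λ y z → if y ≡ᵇ 1 then if z ≡ᵇ 1 then coverings Λ V s else 0ℚ else 0ℚ) su sd ⟩
      value m n a b c δ ∎
      where
      open ≡-Reasoning
      s : Tri → ℕ
      s = state a b c δ
      su : s u ≡ bit c ℕ.+ (bit b ℕ.+ m)
      su = trans (add-hit c (add b α (add a γ δ)) ε-u) (cong (bit c ℕ.+_)
          (trans (add-hit b (add a γ δ) α-u) (cong (bit b ℕ.+_) (trans (add-miss a δ γ-u) δu))))
      sd : s d ≡ bit b ℕ.+ (bit a ℕ.+ n)
      sd = trans (add-miss c (add b α (add a γ δ)) ε-d) (trans (add-hit b (add a γ δ) α-d)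
          (cong (bit b ℕ.+_) (trans (add-hit a δ γ-d) (cong (bit a ℕ.+_) δd))))

    expand : ∀ {δ m n} → δ u ≡ m → δ d ≡ n → total δ ≡
      when p ((when q (value m n true true true δ) + value m n true true false δ)
              + (when q (value m n true false true δ) + value m n true false false δ))
      + ((when q (value m n false true true δ) + value m n false true false δ)
         + (when q (value m n false false true δ) + value m n false false false δ))
    expand {δ} {m} {n} δu δd = trans (coverings-optional p γ (α ∷ optional q ε ++ Λ) (u ∷ d ∷ V) δ)
      (cong₂ (λ y z → when p y + z) (cong₂ _+_ (part true true) (part true false))
                                    (cong₂ _+_ (part false true) (part false false)))
      where
      part : ∀ a b → coverings (optional q ε ++ Λ) (u ∷ d ∷ V) (add b α (add a γ δ))
             ≡ when q (value m n a b true δ) + value m n a b false δ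
      part a b = trans (coverings-optional q ε Λ (u ∷ d ∷ V) (add b α (add a γ δ)))
        (cong₂ (λ y z → when q y + z) (leaf a b true δu δd) (leaf a b false δu δd))

  -- The indices are the values of δ at u and d. Of the eight subsets of γ, α, ε those survive that
  -- bring both values to 1: here the empty one, then γ alone, then either γ with ε or α alone, and
  -- finally ε alone.
  step₁₁ : ∀ {δ} → δ u ≡ 1 → δ d ≡ 1 → total δ ≡ coverings Λ V δ
  step₁₁ δu δd = trans (expand δu δd) (lemma p q)
    where
    lemma : ∀ p q {z} → when p ((when q 0ℚ + 0ℚ) + (when q 0ℚ + 0ℚ)) + ((when q 0ℚ + 0ℚ) + (when q 0ℚ + z)) ≡ z
    lemma true  true  {z} = trans (ℚ.+-identityˡ _) (trans (ℚ.+-identityˡ _) (ℚ.+-identityˡ z))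
    lemma true  false {z} = trans (ℚ.+-identityˡ _) (trans (ℚ.+-identityˡ _) (ℚ.+-identityˡ z))
    lemma false true  {z} = trans (ℚ.+-identityˡ _) (trans (ℚ.+-identityˡ _) (ℚ.+-identityˡ z))
    lemma false false {z} = trans (ℚ.+-identityˡ _) (trans (ℚ.+-identityˡ _) (ℚ.+-identityˡ z))

  step₁₀ : ∀ {δ} → δ u ≡ 1 → δ d ≡ 0 → total δ ≡ when p (coverings Λ V (δ ⊞ γ))
  step₁₀ δu δd = trans (expand δu δd) (lemma p q)
    where
    lemma : ∀ p q {z} → when p ((when q 0ℚ + 0ℚ) + (when q 0ℚ + z)) + ((when q 0ℚ + 0ℚ) + (when q 0ℚ + 0ℚ)) ≡ when p z
    lemma true  true  {z} = trans (ℚ.+-identityʳ _) (trans (ℚ.+-identityˡ _) (ℚ.+-identityˡ z))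
    lemma true  false {z} = trans (ℚ.+-identityʳ _) (trans (ℚ.+-identityˡ _) (ℚ.+-identityˡ z))
    lemma false true  = refl
    lemma false false = refl

  step₀₀ : ∀ {δ} → δ u ≡ 0 → δ d ≡ 0 → total δ ≡
    when p (when q (coverings Λ V (δ ⊞ γ ⊞ ε))) + coverings Λ V (δ ⊞ α)
  step₀₀ δu δd = trans (expand δu δd) (lemma p q)
    where
    lemma : ∀ p q {y z} → when p ((when q 0ℚ + 0ℚ) + (when q y + 0ℚ)) + ((when q 0ℚ + z) + (when q 0ℚ + 0ℚ))
                        ≡ when p (when q y) + z
    lemma true  true  {y} {z} = cong₂ _+_ (trans (ℚ.+-identityˡ _) (ℚ.+-identityʳ y))
                                          (trans (ℚ.+-identityʳ _) (ℚ.+-identityˡ z))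
    lemma true  false {y} {z} = cong (λ w → 0ℚ + w) (trans (ℚ.+-identityʳ _) (ℚ.+-identityˡ z))
    lemma false true  {y} {z} = cong (λ w → 0ℚ + w) (trans (ℚ.+-identityʳ _) (ℚ.+-identityˡ z))
    lemma false false {y} {z} = cong (λ w → 0ℚ + w) (trans (ℚ.+-identityʳ _) (ℚ.+-identityˡ z))

  step₀₁ : ∀ {δ} → δ u ≡ 0 → δ d ≡ 1 → total δ ≡ when q (coverings Λ V (δ ⊞ ε))
  step₀₁ δu δd = trans (expand δu δd) (lemma p q)
    where
    lemma : ∀ p q {z} → when p ((when q 0ℚ + 0ℚ) + (when q 0ℚ + 0ℚ)) + ((when q 0ℚ + 0ℚ) + (when q z + 0ℚ)) ≡ when q z
    lemma true  true  {z} = trans (ℚ.+-identityˡ _) (trans (ℚ.+-identityˡ _) (ℚ.+-identityʳ z))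
    lemma true  false {z} = refl
    lemma false true  {z} = trans (ℚ.+-identityˡ _) (trans (ℚ.+-identityˡ _) (ℚ.+-identityʳ z))
    lemma false false {z} = refl

-- Partial rows and the coverage that earlier choices leave behind

bit : Bool → ℕ
bit true  = 1
bit false = 0

-- Whether `ap b K` belongs to the row; only the westernmost can be missing.
hasLeft : Bool → ℕ → Bool
hasLeft o zero    = o
hasLeft o (suc _) = true

-- Lozenges and triangles of row b up to its K-th edge in direction -60°.  The
-- triangle ap b 0 is present only in rows starting with an up-pointing triangle
-- (o = true).  Below ap b k lies dn (b+1) k or dn (b+1) (k-1), according to o;
-- e tells whether there is a row below at all.
rowΛ : Bool → Bool → ℕ → ℕ → List Pair → List Pair
rowΛ o     e b (suc K) rest =
  optional (hasLeft o K) (ap b K , dn b K) ++ (ap b (suc K) , dn b K) ∷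
  optional e (ap b (suc K) , dn (suc b) (K ℕ.+ bit o)) ++ rowΛ o e b K rest
rowΛ true  e b zero    rest = optional e (ap b 0 , dn (suc b) 0) ++ rest
rowΛ false e b zero    rest = rest

rowV : Bool → ℕ → ℕ → List Tri → List Tri
rowV o b zero    rest = optional o (ap b 0) ++ rest
rowV o b (suc K) rest = ap b (suc K) ∷ dn b K ∷ rowV o b K rest

-- Serves to show that `ap b (suc K)` and `dn b K`, the next two triangles of the row, are new and
-- hence untouched by the lozenges listed so far.
Inside : ℕ → ℕ → Tri → Set
Inside b K (ap b′ k) = b ℕ.< b′ ⊎ (b′ ≡ b × k ℕ.≤ K)
Inside b K (dn b′ k) = b ℕ.< b′ ⊎ (b′ ≡ b × k ℕ.< K)

Inside₂ : ℕ → ℕ → Pair → Set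
Inside₂ b K (u , d) = Inside b K u × Inside b K d

Below : ℕ → Tri → Set
Below b (ap b′ _) = b ℕ.≤ b′
Below b (dn b′ _) = b ℕ.≤ b′

Below₂ : ℕ → Pair → Set
Below₂ b (u , d) = Below b u × Below b d

Inside-suc : ∀ {b K} t → Inside b K t → Inside b (suc K) t
Inside-suc (ap _ _) (inj₁ p)       = inj₁ p
Inside-suc (ap _ _) (inj₂ (e , p)) = inj₂ (e , ℕ.m≤n⇒m≤1+n p)
Inside-suc (dn _ _) (inj₁ p)       = inj₁ p
Inside-suc (dn _ _) (inj₂ (e , p)) = inj₂ (e , ℕ.m≤n⇒m≤1+n p)

Below-Inside : ∀ {b K} t → Below (suc b) t → Inside b K t
Below-Inside (ap _ _) p = inj₁ p
Below-Inside (dn _ _) p = inj₁ p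

Inside-Below : ∀ {b K} t → Inside b K t → Below b t
Inside-Below (ap _ _) (inj₁ p)          = ℕ.<⇒≤ p
Inside-Below (ap _ _) (inj₂ (refl , _)) = ℕ.≤-refl
Inside-Below (dn _ _) (inj₁ p)          = ℕ.<⇒≤ p
Inside-Below (dn _ _) (inj₂ (refl , _)) = ℕ.≤-refl

All-optional : ∀ {A : Set} {P : A → Set} b {a} → P a → All P (optional b a)
All-optional true  p = p ∷ []
All-optional false p = []

rowΛ-Inside : ∀ o e b K {rest} → All (Below₂ (suc b)) rest → All (Inside₂ b K) (rowΛ o e b K rest)
rowΛ-Inside true  e b zero    B = All.++⁺ (All-optional e (inj₂ (refl , ℕ.z≤n) , inj₁ ℕ.≤-refl))
  (All.map (λ {(u , d)} (p , q) → Below-Inside u p , Below-Inside d q) B)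
rowΛ-Inside false e b zero    B = All.map (λ {(u , d)} (p , q) → Below-Inside u p , Below-Inside d q) B
rowΛ-Inside o     e b (suc K) B =
  All.++⁺ (All-optional (hasLeft o K) (inj₂ (refl , ℕ.n≤1+n K) , inj₂ (refl , ℕ.≤-refl)))
    ((inj₂ (refl , ℕ.≤-refl) , inj₂ (refl , ℕ.≤-refl)) ∷
     All.++⁺ (All-optional e (inj₂ (refl , ℕ.≤-refl) , inj₁ ℕ.≤-refl))
       (All.map (λ {(u , d)} (p , q) → Inside-suc u p , Inside-suc d q) (rowΛ-Inside o e b K B)))

rowV-Inside : ∀ o b K {rest} → All (Below (suc b)) rest → All (Inside b K) (rowV o b K rest)
rowV-Inside o b zero    B = All.++⁺ (All-optional o (inj₂ (refl , ℕ.z≤n))) (All.map (λ {t} → Below-Inside t) B)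
rowV-Inside o b (suc K) B = inj₂ (refl , ℕ.≤-refl) ∷ inj₂ (refl , ℕ.≤-refl) ∷
  All.map (λ {t} → Inside-suc t) (rowV-Inside o b K B)

ap∉Inside : ∀ {b K} → ∀ t → Inside b K t → ap b (suc K) ≢ t
ap∉Inside _ (inj₁ b<b)       refl = ℕ.<-irrefl refl b<b
ap∉Inside _ (inj₂ (_ , K<K)) refl = ℕ.<-irrefl refl K<K

dn∉Inside : ∀ {b K} → ∀ t → Inside b K t → dn b K ≢ t
dn∉Inside _ (inj₁ b<b)       refl = ℕ.<-irrefl refl b<b
dn∉Inside _ (inj₂ (_ , K<K)) refl = ℕ.<-irrefl refl K<K

dn≢ : ∀ {b b′ k k′} → k ≢ k′ → dn b k ≢ dn b′ k′
dn≢ k≢k refl = k≢k refl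

ap≢ : ∀ {b b′ k k′} → k ≢ k′ → ap b k ≢ ap b′ k′
ap≢ k≢k refl = k≢k refl

dn≢ᵇ : ∀ {b b′ k k′} → b ≢ b′ → dn b k ≢ dn b′ k′
dn≢ᵇ b≢b refl = b≢b refl

ap≢ᵇ : ∀ {b b′ k k′} → b ≢ b′ → ap b k ≢ ap b′ k′
ap≢ᵇ b≢b refl = b≢b refl

Covered : Bool → ℕ → Set
Covered true  v = v ≡ 0 ⊎ v ≡ 1
Covered false v = v ≡ 0

-- The coverings δ that the rows above row b can leave behind.
record Frontier (e : Bool) (b : ℕ) (δ : Tri → ℕ) : Set where
  field
    first : ∀ k → Covered e (δ (dn b k))
    downs : ∀ {b′} k → b ℕ.< b′ → δ (dn b′ k) ≡ 0
    ups   : ∀ {b′} k → b ℕ.≤ b′ → δ (ap b′ k) ≡ 0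

-- The analogue of `Frontier` when row b is still present up to its K-th edge. Lozenges already
-- chosen in this row may reach into row suc b, but only from index K + bit o on. The triangle
-- `ap b K` is left out; its coverage is a parameter of the claims below.
record RowFrontier (o e : Bool) (b K : ℕ) (δ : Tri → ℕ) : Set where
  field
    upper      : ∀ {k} → k ℕ.< K → Covered true (δ (dn b k))
    lower      : ∀ k → Covered e (δ (dn (suc b) k))
    lower-left : ∀ {k} → k ℕ.< K ℕ.+ bit o → δ (dn (suc b) k) ≡ 0
    left       : ∀ {k} → k ℕ.< K → δ (ap b k) ≡ 0
    downs      : ∀ {b′} k → suc b ℕ.< b′ → δ (dn b′ k) ≡ 0
    ups        : ∀ {b′} k → b ℕ.< b′ → δ (ap b′ k) ≡ 0

-- Equality wherever coverage still matters once row b is cut at its K-th edge, except at `ap b K`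
-- and at the triangle below the step, which the step may cover.
record Agrees (o : Bool) (b K : ℕ) (δ δ′ : Tri → ℕ) : Set where
  field
    upper : ∀ {k} → k ℕ.< K → δ′ (dn b k) ≡ δ (dn b k)
    lower : ∀ {k} → k ≢ K ℕ.+ bit o → δ′ (dn (suc b) k) ≡ δ (dn (suc b) k)
    left  : ∀ {k} → k ℕ.< K → δ′ (ap b k) ≡ δ (ap b k)
    downs : ∀ {b′} k → suc b ℕ.< b′ → δ′ (dn b′ k) ≡ δ (dn b′ k)
    ups   : ∀ {b′} k → b ℕ.< b′ → δ′ (ap b′ k) ≡ δ (ap b′ k)

Agrees-refl : ∀ {o b K δ} → Agrees o b K δ δ
Agrees-refl = record { upper = λ _ → refl ; lower = λ _ → refl ; left = λ _ → refl
                     ; downs = λ _ _ → refl ; ups = λ _ _ → refl }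

Agrees-trans : ∀ {o b K δ δ′ δ″} → Agrees o b K δ δ′ → Agrees o b K δ′ δ″ → Agrees o b K δ δ″
Agrees-trans A B = record
  { upper = λ p → trans (B.upper p) (A.upper p)
  ; lower = λ p → trans (B.lower p) (A.lower p)
  ; left  = λ p → trans (B.left p) (A.left p)
  ; downs = λ k p → trans (B.downs k p) (A.downs k p)
  ; ups   = λ k p → trans (B.ups k p) (A.ups k p)
  }
  where
  module A = Agrees A
  module B = Agrees B

Agrees-right : ∀ {o b K δ} l → K ℕ.≤ l → Agrees o b K δ (δ ⊞ (ap b l , dn b K))
Agrees-right {δ = δ} l K≤l = record
  { upper = λ k<K → ⊞-outside δ (λ ()) (dn≢ (ℕ.<⇒≢ k<K))
  ; lower = λ _ → ⊞-outside δ (λ ()) (dn≢ᵇ ℕ.1+n≢n)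
  ; left  = λ k<K → ⊞-outside δ (ap≢ (ℕ.<⇒≢ (ℕ.<-≤-trans k<K K≤l))) (λ ())
  ; downs = λ k b<b′ → ⊞-outside δ (λ ()) (dn≢ᵇ (ℕ.<⇒≢ (ℕ.<-trans (ℕ.n<1+n _) b<b′) ∘ sym))
  ; ups   = λ k b<b′ → ⊞-outside δ (ap≢ᵇ (ℕ.<⇒≢ b<b′ ∘ sym)) (λ ())
  }

Agrees-below : ∀ {o b K δ} → Agrees o b K δ (δ ⊞ (ap b (suc K) , dn (suc b) (K ℕ.+ bit o)))
Agrees-below {δ = δ} = record
  { upper = λ _ → ⊞-outside δ (λ ()) (dn≢ᵇ (ℕ.1+n≢n ∘ sym))
  ; lower = λ k≢κ → ⊞-outside δ (λ ()) (dn≢ k≢κ)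
  ; left  = λ k<K → ⊞-outside δ (ap≢ (ℕ.<⇒≢ (ℕ.m≤n⇒m≤1+n k<K))) (λ ())
  ; downs = λ k b<b′ → ⊞-outside δ (λ ()) (dn≢ᵇ (ℕ.<⇒≢ b<b′ ∘ sym))
  ; ups   = λ k b<b′ → ⊞-outside δ (ap≢ᵇ (ℕ.<⇒≢ b<b′ ∘ sym)) (λ ())
  }

RowFrontier-shrink : ∀ {o e b K δ δ′} → RowFrontier o e b (suc K) δ → Agrees o b K δ δ′ →
  Covered e (δ′ (dn (suc b) (K ℕ.+ bit o))) → RowFrontier o e b K δ′
RowFrontier-shrink {o} {e} {b} {K} {δ} {δ′} G A c = record
  { upper      = λ k<K → subst (Covered true) (sym (A.upper k<K)) (G.upper (ℕ.m≤n⇒m≤1+n k<K))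
  ; lower      = lower
  ; lower-left = λ k<κ → trans (A.lower (ℕ.<⇒≢ k<κ)) (G.lower-left (ℕ.m≤n⇒m≤1+n k<κ))
  ; left       = λ k<K → trans (A.left k<K) (G.left (ℕ.m≤n⇒m≤1+n k<K))
  ; downs      = λ k p → trans (A.downs k p) (G.downs k p)
  ; ups        = λ k p → trans (A.ups k p) (G.ups k p)
  }
  where
  module G = RowFrontier G
  module A = Agrees A
  lower : ∀ k → Covered e (δ′ (dn (suc b) k))
  lower k with k ℕ.≟ K ℕ.+ bit o
  ... | yes refl = c
  ... | no  k≢κ  = subst (Covered e) (sym (A.lower k≢κ)) (G.lower k)

select : {A : Set} → ℕ → A → List A
select zero    a = []
select (suc _) a = a ∷ []

module Selection (P : ℕ → ℕ → ℕ → ℚ) where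

  -- The exits upwards from row b, from west to east, as rows of the determinant.
  selected : (Tri → ℕ) → ℕ → ℕ → ℕ → List (ℕ → ℚ)
  selected δ b k zero    = []
  selected δ b k (suc m) = select (δ (dn b k)) (P b k) ++ selected δ b (suc k) m

  selected-cong : ∀ {δ δ′} b k m → (∀ {i} → k ℕ.≤ i → i ℕ.< k ℕ.+ m → δ (dn b i) ≡ δ′ (dn b i)) →
                  selected δ b k m ≡ selected δ′ b k m
  selected-cong b k zero    e = refl
  selected-cong b k (suc m) e = cong₂ (λ v s → select v (P b k) ++ s)
    (e ℕ.≤-refl (ℕ.m<m+n k ℕ.z<s))
    (selected-cong b (suc k) m λ {i} k<i i<k+m → e (ℕ.<⇒≤ k<i) (subst (i ℕ.<_) (sym (ℕ.+-suc k m)) i<k+m))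

  selected-snoc : ∀ δ b k m → selected δ b k (suc m) ≡
                  selected δ b k m ++ select (δ (dn b (k ℕ.+ m))) (P b (k ℕ.+ m))
  selected-snoc δ b k zero    = trans (++-identityʳ _)
    (cong (λ i → select (δ (dn b i)) (P b i)) (sym (ℕ.+-identityʳ k)))
  selected-snoc δ b k (suc m) = begin
    s ++ selected δ b (suc k) (suc m)
      ≡⟨ cong (s ++_) (selected-snoc δ b (suc k) m) ⟩
    s ++ selected δ b (suc k) m ++ select (δ (dn b (suc k ℕ.+ m))) (P b (suc k ℕ.+ m))
      ≡⟨ ++-assoc s (selected δ b (suc k) m) _ ⟨
    (s ++ selected δ b (suc k) m) ++ select (δ (dn b (suc k ℕ.+ m))) (P b (suc k ℕ.+ m))
      ≡⟨ cong (λ i → (s ++ selected δ b (suc k) m) ++ select (δ (dn b i)) (P b i)) (ℕ.+-suc k m) ⟨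
    (s ++ selected δ b (suc k) m) ++ select (δ (dn b (k ℕ.+ suc m))) (P b (k ℕ.+ suc m)) ∎
    where
    open ≡-Reasoning
    s : List (ℕ → ℚ)
    s = select (δ (dn b k)) (P b k)

  selected-All : ∀ {Q : (ℕ → ℚ) → Set} δ b → (∀ k → Q (P b k)) → ∀ k m → All Q (selected δ b k m)
  selected-All δ b q k zero    = []
  selected-All δ b q k (suc m) with δ (dn b k)
  ... | zero  = selected-All δ b q (suc k) m
  ... | suc _ = q k ∷ selected-All δ b q (suc k) m

-- Growing the region along one row

D-no-columns : ∀ {K : Set} (us : List (K → ℚ)) v vs → D (us ++ v ∷ vs) [] ≡ 0ℚ
D-no-columns []      v vs = refl
D-no-columns (_ ∷ _) v vs = refl

-- The base case at the western end. In an even row the source is edge 0: column `c` is a unit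
-- vector if a path crosses this edge; otherwise it is zero, matching the guard on the left. In an
-- odd row a path can cross edge 0 only after coming up through `ap b 0`, which is why `P b 0` may
-- be exchanged for `P (suc b) 0`.
row-start : ∀ P o e b {W} c cs X restΛ restV →
  (o ≡ true → ∀ j → P b 0 j ≡ P (suc b) 0 j) →
  (o ≡ false → P b 0 c ≡ 1ℚ) →
  (∀ k → P (suc b) k c ≡ 0ℚ) →
  All (λ r → r c ≡ 0ℚ) X →
  All (Below₂ (suc b)) restΛ →
  (e ≡ false → o ≡ true × cs ≡ []) →
  (∀ δ → Frontier e (suc b) δ →
    coverings restΛ restV δ ≡ D (Selection.selected P δ (suc b) 0 W ++ X) cs) →
  ∀ M → bit o ℕ.+ M ≡ W → ∀ β δ → RowFrontier o e b 0 δ → δ (ap b 0) ≡ bit (not β) →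
  when (β ∨ o) (coverings (rowΛ o e b 0 restΛ) (rowV o b 0 restV) δ)
  ≡ D (optional β (P b 0) ++ Selection.selected P δ (suc b) (bit o) M ++ X) (if o then cs else c ∷ cs)
row-start P false e b c cs X restΛ restV _ unit vanish exit-vanish _ bottom below M refl β δ G δ≡ = go β
  where
  open Selection P
  G′ : Frontier e (suc b) δ
  G′ = record { first = RowFrontier.lower G ; downs = RowFrontier.downs G ; ups = RowFrontier.ups G }
  vanish-all : All (λ r → r c ≡ 0ℚ) (selected δ (suc b) 0 M ++ X)
  vanish-all = All.++⁺ (selected-All {λ r → r c ≡ 0ℚ} δ (suc b) vanish 0 M) exit-vanish
  go : ∀ β → when (β ∨ false) (coverings restΛ restV δ)
             ≡ D (optional β (P b 0) ++ selected δ (suc b) 0 M ++ X) (c ∷ cs)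
  go true  = trans (below δ G′) (sym (D-unit-column {c = c} {P b 0} (unit refl) vanish-all cs))
  go false = sym (D-zero-column vanish-all cs)
row-start P true e b c cs X restΛ restV start _ _ _ restΛ-below bottom below M refl β δ G δ≡ = go β δ≡
  where
  open Selection P
  open ≡-Reasoning
  ε : Pair
  ε = ap b 0 , dn (suc b) 0
  V : List Tri
  V = ap b 0 ∷ restV
  untouched : Untouched restΛ (ap b 0)
  untouched = All.map (λ {(u , d)} (p , q) → hit-outside (out u p) (out d q)) restΛ-below
    where
    out : ∀ t → Below (suc b) t → ap b 0 ≢ t
    out _ b<b refl = ℕ.<-irrefl refl b<b
  δ₀≡0 : δ (dn (suc b) 0) ≡ 0
  δ₀≡0 = RowFrontier.lower-left G ℕ.z<s
  expand : ∀ {v} → δ (ap b 0) ≡ v → coverings (optional e ε ++ restΛ) V δ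
    ≡ when e (if suc v ≡ᵇ 1 then coverings restΛ restV (δ ⊞ ε) else 0ℚ)
      + (if v ≡ᵇ 1 then coverings restΛ restV δ else 0ℚ)
  expand {v} δ≡v = trans (coverings-optional e ε restΛ V δ) (cong₂ (λ y z → when e y + z)
    (trans (coverings-untouched untouched restV (δ ⊞ ε))
      (cong (λ h → if h ≡ᵇ 1 then coverings restΛ restV (δ ⊞ ε) else 0ℚ) (cong₂ ℕ._+_ (hit-up {ap b 0}) δ≡v)))
    (trans (coverings-untouched untouched restV δ)
      (cong (λ h → if h ≡ᵇ 1 then coverings restΛ restV δ else 0ℚ) δ≡v)))
  G′ : Frontier e (suc b) δ
  G′ = record { first = RowFrontier.lower G ; downs = RowFrontier.downs G ; ups = RowFrontier.ups G }
  G″ : e ≡ true → Frontier e (suc b) (δ ⊞ ε)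
  G″ refl = record
    { first = first
    ; downs = λ k b<b′ → trans (⊞-outside δ (λ ()) (dn≢ᵇ (ℕ.<⇒≢ b<b′ ∘ sym))) (RowFrontier.downs G k b<b′)
    ; ups   = λ k b<b′ → trans (⊞-outside δ (ap≢ᵇ (ℕ.<⇒≢ b<b′ ∘ sym)) (λ ())) (RowFrontier.ups G k b<b′)
    }
    where
    first : ∀ k → Covered true ((δ ⊞ ε) (dn (suc b) k))
    first zero    = inj₂ (cong₂ ℕ._+_ (hit-down {ap b 0}) δ₀≡0)
    first (suc k) = subst (Covered true) (sym (⊞-outside δ {t = dn (suc b) (suc k)} (λ ()) (dn≢ (λ ()))))
      (RowFrontier.lower G (suc k))
  below-ε : e ≡ true → coverings restΛ restV (δ ⊞ ε) ≡ D (P b 0 ∷ selected δ (suc b) 1 M ++ X) cs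
  below-ε e≡t = begin
    coverings restΛ restV (δ ⊞ ε)
      ≡⟨ below (δ ⊞ ε) (G″ e≡t) ⟩
    D ((select ((δ ⊞ ε) (dn (suc b) 0)) (P (suc b) 0) ++ selected (δ ⊞ ε) (suc b) 1 M) ++ X) cs
      ≡⟨ cong₂ (λ v s → D ((select v (P (suc b) 0) ++ s) ++ X) cs)
           (cong₂ ℕ._+_ (hit-down {ap b 0}) δ₀≡0)
           (selected-cong (suc b) 1 M λ 0<i _ → ⊞-outside δ (λ ()) (dn≢ (ℕ.<⇒≢ 0<i ∘ sym))) ⟩
    D (P (suc b) 0 ∷ selected δ (suc b) 1 M ++ X) cs
      ≡⟨ congruent (D-rows cs) [] (selected δ (suc b) 1 M ++ X) (λ j → sym (start refl j)) ⟩
    D (P b 0 ∷ selected δ (suc b) 1 M ++ X) cs ∎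
  when-below : ∀ e′ {q v} → (e′ ≡ true → q ≡ v) → (e′ ≡ false → v ≡ 0ℚ) → when e′ q + 0ℚ ≡ v
  when-below true  t f = trans (ℚ.+-identityʳ _) (t refl)
  when-below false t f = sym (f refl)
  go : ∀ β → δ (ap b 0) ≡ bit (not β) → when (β ∨ true) (coverings (optional e ε ++ restΛ) V δ)
       ≡ D (optional β (P b 0) ++ selected δ (suc b) 1 M ++ X) cs
  -- In the bottom row nothing below can cover `ap b 0`, and the determinant vanishes because it has
  -- a row but no columns.
  go true  δ≡0 = trans (expand δ≡0) (when-below e below-ε
    λ e≡f → cong (D (P b 0 ∷ selected δ (suc b) 1 M ++ X)) (proj₂ (bottom e≡f)))
  go false δ≡1 = begin
    coverings (optional e ε ++ restΛ) V δ
      ≡⟨ expand δ≡1 ⟩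
    when e 0ℚ + coverings restΛ restV δ
      ≡⟨ cong (_+ coverings restΛ restV δ) (when-0 e) ⟩
    0ℚ + coverings restΛ restV δ
      ≡⟨ ℚ.+-identityˡ _ ⟩
    coverings restΛ restV δ
      ≡⟨ below δ G′ ⟩
    D ((select (δ (dn (suc b) 0)) (P (suc b) 0) ++ selected δ (suc b) 1 M) ++ X) cs
      ≡⟨ cong (λ v → D ((select v (P (suc b) 0) ++ selected δ (suc b) 1 M) ++ X) cs) δ₀≡0 ⟩
    D (selected δ (suc b) 1 M ++ X) cs ∎

-- An arbitrary `P` isolates what is needed of the path numbers: Pascal's rule for the two ways to
-- reach an edge, the values at the westernmost edge, and that paths never descend, so that the
-- column of a source in row b is zero on all exits from lower rows.
module Row
  (P : ℕ → ℕ → ℕ → ℚ) (o e : Bool) (b W : ℕ) (c : ℕ) (cs : List ℕ) (X : List (ℕ → ℚ))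
  (restΛ : List Pair) (restV : List Tri)
  (pascal      : ∀ K j → P b (suc K) j ≡ P b K j + P (suc b) (K ℕ.+ bit o) j)
  (odd-start   : o ≡ true → ∀ j → P b 0 j ≡ P (suc b) 0 j)
  (even-start  : o ≡ false → P b 0 c ≡ 1ℚ)
  (vanish      : ∀ k → P (suc b) k c ≡ 0ℚ)
  (exit-vanish : All (λ r → r c ≡ 0ℚ) X)
  (restΛ-below : All (Below₂ (suc b)) restΛ)
  (bottom      : e ≡ false → o ≡ true × cs ≡ [])
  where

  open Selection P

  columns : List ℕ
  columns = if o then cs else c ∷ cs

  Below-claim : Set
  Below-claim = ∀ δ → Frontier e (suc b) δ →
    coverings restΛ restV δ ≡ D (selected δ (suc b) 0 W ++ X) cs

  -- The places where paths can leave the partial region, from west to east: upwards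
  -- from row b, through its K-th edge, upwards from row b+1, and through the boundary.
  rows : Bool → ℕ → ℕ → (Tri → ℕ) → List (ℕ → ℚ)
  rows β K M δ = selected δ b 0 K ++ optional β (P b K) ++ selected δ (suc b) (K ℕ.+ bit o) M ++ X

  bottom-columns : e ≡ false → columns ≡ []
  bottom-columns e≡f with bottom e≡f
  ... | refl , cs≡[] = cs≡[]

  no-lower : e ≡ false → ∀ us v vs → D (us ++ v ∷ vs) columns ≡ 0ℚ
  no-lower e≡f us v vs = trans (cong (D (us ++ v ∷ vs)) (bottom-columns e≡f)) (D-no-columns us v vs)

  -- β says whether a path crosses the K-th edge of row b. If so, `ap b K` is still to be covered;
  -- if not, the lozenge across that edge has covered it. The guard excludes such a lozenge across
  -- edge 0 of an even row, where `ap b 0` is absent.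
  Claim : ℕ → ℕ → Set
  Claim K M = ∀ β δ → RowFrontier o e b K δ → δ (ap b K) ≡ bit (not β) →
    when (β ∨ hasLeft o K) (coverings (rowΛ o e b K restΛ) (rowV o b K restV) δ)
    ≡ D (rows β K M δ) columns

  untouched : ∀ K t → (∀ t′ → Inside b K t′ → t ≢ t′) → Untouched (rowΛ o e b K restΛ) t
  untouched K t out = All.map (λ {(u , d)} (p , q) → hit-outside (out u p) (out d q))
    (rowΛ-Inside o e b K restΛ-below)

  module Extend (K M : ℕ) (IH : Claim K (suc M)) (δ : Tri → ℕ) (G : RowFrontier o e b (suc K) δ) where

    κ : ℕ
    κ = K ℕ.+ bit o

    us vs : List (ℕ → ℚ)
    us = selected δ b 0 K
    vs = selected δ (suc b) (suc κ) M ++ X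

    γ α ε : Pair
    γ = ap b K , dn b K
    α = ap b (suc K) , dn b K
    ε = ap b (suc K) , dn (suc b) κ

    K≢1+K : K ≢ suc K
    K≢1+K = ℕ.1+n≢n ∘ sym

    γ-misses-u : hit (ap b (suc K)) γ ≡ 0
    γ-misses-u = hit-outside {ap b (suc K)} {ap b K} {dn b K} (ap≢ {b} {b} (K≢1+K ∘ sym)) (λ ())

    ε-misses-d : hit (dn b K) ε ≡ 0
    ε-misses-d = hit-outside {dn b K} {ap b (suc K)} {dn (suc b) κ} (λ ()) (dn≢ᵇ {b} {suc b} {K} {κ} (ℕ.1+n≢n ∘ sym))

    open Step {ap b (suc K)} {dn b K} {γ} {α} {ε} (hasLeft o K) e {rowΛ o e b K restΛ} (rowV o b K restV)
      γ-misses-u (hit-up {ap b (suc K)} {dn b K}) (hit-up {ap b (suc K)} {dn (suc b) κ})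
      (hit-down {ap b K} {dn b K}) (hit-down {ap b (suc K)} {dn b K})
      ε-misses-d
      (untouched K (ap b (suc K)) ap∉Inside) (untouched K (dn b K) dn∉Inside)
      public

    F : Alternating (λ rs → D rs columns)
    F = D-rows columns

    δκ≡0 : δ (dn (suc b) κ) ≡ 0
    δκ≡0 = RowFrontier.lower-left G ℕ.≤-refl

    apply : ∀ β v δ′ → Agrees o b K δ δ′ → δ′ (dn (suc b) κ) ≡ v → Covered e v →
      δ′ (ap b K) ≡ bit (not β) →
      when (β ∨ hasLeft o K) (coverings (rowΛ o e b K restΛ) (rowV o b K restV) δ′)
      ≡ D (us ++ optional β (P b K) ++ select v (P (suc b) κ) ++ vs) columns
    apply β v δ′ A δ′κ≡v cov β≡ = trans
      (IH β δ′ (RowFrontier-shrink G A (subst (Covered e) (sym δ′κ≡v) cov)) β≡)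
      (cong (λ rs → D rs columns) (cong₂ (λ y z → y ++ optional β (P b K) ++ z)
        (selected-cong b 0 K λ _ i<K → Agrees.upper A i<K)
        (trans (++-assoc (select (δ′ (dn (suc b) κ)) (P (suc b) κ)) (selected δ′ (suc b) (suc κ) M) X)
          (cong₂ (λ v s → select v (P (suc b) κ) ++ s ++ X) δ′κ≡v
            (selected-cong (suc b) (suc κ) M λ κ<i _ → Agrees.lower A (ℕ.<⇒≢ κ<i ∘ sym))))))

    Covered-0 : ∀ e → Covered e 0
    Covered-0 true  = inj₁ refl
    Covered-0 false = refl

    rows-suc : ∀ β → rows β (suc K) M δ ≡ us ++ select (δ (dn b K)) (P b K) ++ optional β (P b (suc K)) ++ vs
    rows-suc β = trans (cong (_++ optional β (P b (suc K)) ++ vs) (selected-snoc δ b 0 K))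
      (++-assoc us (select (δ (dn b K)) (P b K)) (optional β (P b (suc K)) ++ vs))

    split-row : ∀ us → D (us ++ P b (suc K) ∷ vs) columns
                ≡ D (us ++ P b K ∷ vs) columns + D (us ++ P (suc b) κ ∷ vs) columns
    split-row us = trans (congruent F us vs (pascal K)) (additive F us (P b K) (P (suc b) κ) vs)

    γ-below : (δ ⊞ γ ⊞ ε) (dn (suc b) κ) ≡ 1
    γ-below = cong₂ ℕ._+_ (hit-down {ap b (suc K)} {dn (suc b) κ})
      (trans (⊞-outside δ (λ ()) (dn≢ᵇ ℕ.1+n≢n)) δκ≡0)

    γ-left : ∀ {δ′} → δ′ (ap b K) ≡ 0 → (δ′ ⊞ γ) (ap b K) ≡ 1
    γ-left e = cong₂ ℕ._+_ (hit-up {ap b K} {dn b K}) e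

    outside-ε : ∀ δ′ → (δ′ ⊞ ε) (ap b K) ≡ δ′ (ap b K)
    outside-ε δ′ = ⊞-outside δ′ (ap≢ K≢1+K) (λ ())

    δK≡0 : δ (ap b K) ≡ 0
    δK≡0 = RowFrontier.left G ℕ.≤-refl

    below-term : ∀ {q v} → (e ≡ true → q ≡ v) → (e ≡ false → v ≡ 0ℚ) → when e q ≡ v
    below-term {q} t f = go e t f
      where
      go : ∀ e {v} → (e ≡ true → q ≡ v) → (e ≡ false → v ≡ 0ℚ) → when e q ≡ v
      go true  t f = t refl
      go false t f = sym (f refl)

    covered-1 : e ≡ true → Covered e 1
    covered-1 refl = inj₂ refl

    claim : ∀ β → δ (ap b (suc K)) ≡ bit (not β) → Covered true (δ (dn b K)) →
            total δ ≡ D (rows β (suc K) M δ) columns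
    -- A path crosses edge K + 1 and none leaves through `dn b K`. Either it came along the row (α),
    -- or it came from below (ε) and edge K is free (γ).
    claim true  δu (inj₁ δd) = begin
      total δ
        ≡⟨ step₀₀ δu δd ⟩
      when (hasLeft o K) (when e (coverings (rowΛ o e b K restΛ) (rowV o b K restV) (δ ⊞ γ ⊞ ε)))
        + coverings (rowΛ o e b K restΛ) (rowV o b K restV) (δ ⊞ α)
        ≡⟨ cong₂ _+_ (trans (swap (hasLeft o K) e) (below-term
             (λ e≡t → apply false 1 (δ ⊞ γ ⊞ ε) (Agrees-trans (Agrees-right K ℕ.≤-refl) Agrees-below)
               γ-below (covered-1 e≡t) (trans (outside-ε (δ ⊞ γ)) (γ-left {δ} δK≡0)))
             (λ e≡f → no-lower e≡f us (P (suc b) κ) vs)))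
           (apply true 0 (δ ⊞ α) (Agrees-right (suc K) (ℕ.n≤1+n K))
              (trans (⊞-outside δ (λ ()) (dn≢ᵇ ℕ.1+n≢n)) δκ≡0) (Covered-0 e)
              (trans (⊞-outside δ (ap≢ K≢1+K) (λ ())) δK≡0)) ⟩
      D (us ++ P (suc b) κ ∷ vs) columns + D (us ++ P b K ∷ vs) columns
        ≡⟨ ℚ.+-comm (D (us ++ P (suc b) κ ∷ vs) columns) _ ⟩
      D (us ++ P b K ∷ vs) columns + D (us ++ P (suc b) κ ∷ vs) columns
        ≡⟨ split-row us ⟨
      D (us ++ P b (suc K) ∷ vs) columns
        ≡⟨ cong (λ v → D (us ++ select v (P b K) ++ P b (suc K) ∷ vs) columns) δd ⟨
      D (us ++ select (δ (dn b K)) (P b K) ++ P b (suc K) ∷ vs) columns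
        ≡⟨ cong (λ rs → D rs columns) (rows-suc true) ⟨
      D (rows true (suc K) M δ) columns ∎
      where
      open ≡-Reasoning
      swap : ∀ p q {z} → when p (when q z) ≡ when q (when p z)
      swap true  q     = refl
      swap false true  = refl
      swap false false = refl
    -- The path across edge K leaves through `dn b K`, so the one across edge K + 1 must come from
    -- below. Pascal's rule also offers edge K to it; this is the collision that two equal adjacent
    -- rows remove.
    claim true  δu (inj₂ δd) = begin
      total δ
        ≡⟨ step₀₁ δu δd ⟩
      when e (coverings (rowΛ o e b K restΛ) (rowV o b K restV) (δ ⊞ ε))
        ≡⟨ below-term
             (λ e≡t → apply true 1 (δ ⊞ ε) Agrees-below
               (cong₂ ℕ._+_ (hit-down {ap b (suc K)} {dn (suc b) κ}) δκ≡0) (covered-1 e≡t)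
               (trans (outside-ε δ) δK≡0))
             (λ e≡f → no-lower e≡f us (P b K) (P (suc b) κ ∷ vs)) ⟩
      D (us ++ P b K ∷ P (suc b) κ ∷ vs) columns
        ≡⟨ combined ⟨
      D (us ++ P b K ∷ P b (suc K) ∷ vs) columns
        ≡⟨ cong (λ v → D (us ++ select v (P b K) ++ P b (suc K) ∷ vs) columns) δd ⟨
      D (us ++ select (δ (dn b K)) (P b K) ++ P b (suc K) ∷ vs) columns
        ≡⟨ cong (λ rs → D rs columns) (rows-suc true) ⟨
      D (rows true (suc K) M δ) columns ∎
      where
      open ≡-Reasoning
      reassoc : ∀ ws → D (us ++ P b K ∷ ws) columns ≡ D ((us ++ P b K ∷ []) ++ ws) columns
      reassoc ws = cong (λ rs → D rs columns) (sym (++-assoc us (P b K ∷ []) ws))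
      combined : D (us ++ P b K ∷ P b (suc K) ∷ vs) columns ≡ D (us ++ P b K ∷ P (suc b) κ ∷ vs) columns
      combined = begin
        D (us ++ P b K ∷ P b (suc K) ∷ vs) columns
          ≡⟨ reassoc (P b (suc K) ∷ vs) ⟩
        D ((us ++ P b K ∷ []) ++ P b (suc K) ∷ vs) columns
          ≡⟨ split-row (us ++ P b K ∷ []) ⟩
        D ((us ++ P b K ∷ []) ++ P b K ∷ vs) columns + D ((us ++ P b K ∷ []) ++ P (suc b) κ ∷ vs) columns
          ≡⟨ cong₂ _+_ (trans (sym (reassoc (P b K ∷ vs))) (adjacent F us (P b K) vs)) (sym (reassoc (P (suc b) κ ∷ vs))) ⟩
        0ℚ + D (us ++ P b K ∷ P (suc b) κ ∷ vs) columns
          ≡⟨ ℚ.+-identityˡ _ ⟩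
        D (us ++ P b K ∷ P (suc b) κ ∷ vs) columns ∎
    -- With no path across edge K + 1, edge K is crossed exactly when a path leaves through
    -- `dn b K`; this distinguishes the last two cases.
    claim false δu (inj₁ δd) = begin
      total δ
        ≡⟨ step₁₀ δu δd ⟩
      when (hasLeft o K) (coverings (rowΛ o e b K restΛ) (rowV o b K restV) (δ ⊞ γ))
        ≡⟨ apply false 0 (δ ⊞ γ) (Agrees-right K ℕ.≤-refl)
             (trans (⊞-outside δ (λ ()) (dn≢ᵇ ℕ.1+n≢n)) δκ≡0) (Covered-0 e) (γ-left {δ} δK≡0) ⟩
      D (us ++ vs) columns
        ≡⟨ cong (λ v → D (us ++ select v (P b K) ++ vs) columns) δd ⟨
      D (us ++ select (δ (dn b K)) (P b K) ++ vs) columns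
        ≡⟨ cong (λ rs → D rs columns) (rows-suc false) ⟨
      D (rows false (suc K) M δ) columns ∎
      where open ≡-Reasoning
    claim false δu (inj₂ δd) = begin
      total δ
        ≡⟨ step₁₁ δu δd ⟩
      coverings (rowΛ o e b K restΛ) (rowV o b K restV) δ
        ≡⟨ apply true 0 δ Agrees-refl δκ≡0 (Covered-0 e) δK≡0 ⟩
      D (us ++ P b K ∷ vs) columns
        ≡⟨ cong (λ v → D (us ++ select v (P b K) ++ vs) columns) δd ⟨
      D (us ++ select (δ (dn b K)) (P b K) ++ vs) columns
        ≡⟨ cong (λ rs → D rs columns) (rows-suc false) ⟨
      D (rows false (suc K) M δ) columns ∎
      where open ≡-Reasoning

  claims : Below-claim → ∀ K M → K ℕ.+ bit o ℕ.+ M ≡ W → Claim K M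
  claims below zero    M e≡ = row-start P o e b c cs X restΛ restV
    odd-start even-start vanish exit-vanish restΛ-below bottom below M e≡
  claims below (suc K) M e≡ β δ G δ≡ = trans (when-true β)
    (Extend.claim K M (claims below K (suc M) (trans (ℕ.+-suc (K ℕ.+ bit o) M) e≡)) δ G β δ≡
      (RowFrontier.upper G ℕ.≤-refl))
    where
    when-true : ∀ β {q} → when (β ∨ true) q ≡ q
    when-true true  = refl
    when-true false = refl

  row-frontier : ∀ {δ K} → Frontier true b δ → RowFrontier o e b K δ
  row-frontier {δ} F = record
    { upper      = λ {k} _ → Frontier.first F k
    ; lower      = λ k → lower e (Frontier.downs F k ℕ.≤-refl)
    ; lower-left = λ {k} _ → Frontier.downs F k ℕ.≤-refl
    ; left       = λ {k} _ → Frontier.ups F k ℕ.≤-refl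
    ; downs      = λ k b<b′ → Frontier.downs F k (ℕ.<-trans ℕ.≤-refl b<b′)
    ; ups        = λ k b<b′ → Frontier.ups F k (ℕ.<⇒≤ b<b′)
    }
    where
    lower : ∀ e {v} → v ≡ 0 → Covered e v
    lower true  = inj₁
    lower false = id

  selected-none : ∀ {δ} → Frontier true b δ → ∀ k m → selected δ (suc b) k m ≡ []
  selected-none F k zero    = refl
  selected-none F k (suc m) = cong₂ (λ v s → select v (P (suc b) k) ++ s)
    (Frontier.downs F k ℕ.≤-refl) (selected-none F (suc k) m)

  -- A row ending with an up-pointing triangle, whose right side the last path crosses.
  exit-claim : Below-claim → ∀ K M → K ℕ.+ bit o ℕ.+ M ≡ W → ∀ δ → Frontier true b δ →
    coverings (rowΛ o e b K restΛ) (rowV o b K restV) δ ≡ D (selected δ b 0 K ++ P b K ∷ X) columns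
  exit-claim below K M e≡ δ F = trans
    (claims below K M e≡ true δ (row-frontier F) (Frontier.ups F K ℕ.≤-refl))
    (cong (λ s → D (selected δ b 0 K ++ P b K ∷ s ++ X) columns) (selected-none F (K ℕ.+ bit o) M))

  -- A row ending with a down-pointing triangle, whose eastern side is on the boundary: no path
  -- passes east of it, so it is covered from above or by the lozenge across edge K.
  last-claim : Below-claim → ∀ K → K ℕ.+ bit o ≡ W → ∀ δ → Frontier true b δ →
    coverings (optional (hasLeft o K) (ap b K , dn b K) ++ rowΛ o e b K restΛ) (dn b K ∷ rowV o b K restV) δ
    ≡ D (selected δ b 0 (suc K) ++ X) columns
  last-claim below K e≡ δ F = begin
    coverings (optional (hasLeft o K) γ ++ Λ) (dn b K ∷ V) δ
      ≡⟨ coverings-optional (hasLeft o K) γ Λ (dn b K ∷ V) δ ⟩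
    when (hasLeft o K) (coverings Λ (dn b K ∷ V) (δ ⊞ γ)) + coverings Λ (dn b K ∷ V) δ
      ≡⟨ cong₂ (λ y z → when (hasLeft o K) y + z)
           (trans (coverings-untouched dn-untouched V (δ ⊞ γ))
             (cong (λ h → if h ≡ᵇ 1 then coverings Λ V (δ ⊞ γ) else 0ℚ)
               (cong (ℕ._+ δ (dn b K)) (hit-down {ap b K}))))
           (coverings-untouched dn-untouched V δ) ⟩
    when (hasLeft o K) (if suc (δ (dn b K)) ≡ᵇ 1 then coverings Λ V (δ ⊞ γ) else 0ℚ)
      + (if δ (dn b K) ≡ᵇ 1 then coverings Λ V δ else 0ℚ)
      ≡⟨ cases (Frontier.first F K) ⟩
    D (selected δ b 0 K ++ select (δ (dn b K)) (P b K) ++ X) columns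
      ≡⟨ cong (λ rs → D rs columns) (++-assoc (selected δ b 0 K) _ X) ⟨
    D ((selected δ b 0 K ++ select (δ (dn b K)) (P b K)) ++ X) columns
      ≡⟨ cong (λ rs → D (rs ++ X) columns) (selected-snoc δ b 0 K) ⟨
    D (selected δ b 0 (suc K) ++ X) columns ∎
    where
    open ≡-Reasoning
    γ : Pair
    γ = ap b K , dn b K
    Λ : List Pair
    Λ = rowΛ o e b K restΛ
    V : List Tri
    V = rowV o b K restV
    dn-untouched : Untouched Λ (dn b K)
    dn-untouched = untouched K (dn b K) dn∉Inside
    claim : Claim K 0
    claim = claims below K 0 (trans (ℕ.+-identityʳ (K ℕ.+ bit o)) e≡)
    shrunk : RowFrontier o e b K (δ ⊞ γ)
    shrunk = RowFrontier-shrink (row-frontier F) (Agrees-right K ℕ.≤-refl)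
      (subst (Covered e) (sym (⊞-outside δ (λ ()) (dn≢ᵇ ℕ.1+n≢n)))
        (RowFrontier.lower (row-frontier {K = suc K} F) (K ℕ.+ bit o)))
    cases : Covered true (δ (dn b K)) →
      when (hasLeft o K) (if suc (δ (dn b K)) ≡ᵇ 1 then coverings Λ V (δ ⊞ γ) else 0ℚ)
        + (if δ (dn b K) ≡ᵇ 1 then coverings Λ V δ else 0ℚ)
      ≡ D (selected δ b 0 K ++ select (δ (dn b K)) (P b K) ++ X) columns
    cases (inj₁ δ≡0) = begin
      when (hasLeft o K) (if suc (δ (dn b K)) ≡ᵇ 1 then coverings Λ V (δ ⊞ γ) else 0ℚ)
        + (if δ (dn b K) ≡ᵇ 1 then coverings Λ V δ else 0ℚ)
        ≡⟨ cong (λ v → when (hasLeft o K) (if suc v ≡ᵇ 1 then coverings Λ V (δ ⊞ γ) else 0ℚ)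
                       + (if v ≡ᵇ 1 then coverings Λ V δ else 0ℚ)) δ≡0 ⟩
      when (hasLeft o K) (coverings Λ V (δ ⊞ γ)) + 0ℚ
        ≡⟨ ℚ.+-identityʳ _ ⟩
      when (hasLeft o K) (coverings Λ V (δ ⊞ γ))
        ≡⟨ claim false (δ ⊞ γ) shrunk (cong₂ ℕ._+_ (hit-up {ap b K}) (Frontier.ups F K ℕ.≤-refl)) ⟩
      D (selected (δ ⊞ γ) b 0 K ++ X) columns
        ≡⟨ cong (λ s → D (s ++ X) columns)
             (selected-cong b 0 K λ _ i<K → Agrees.upper (Agrees-right {o} {δ = δ} K ℕ.≤-refl) i<K) ⟩
      D (selected δ b 0 K ++ X) columns
        ≡⟨ cong (λ v → D (selected δ b 0 K ++ select v (P b K) ++ X) columns) δ≡0 ⟨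
      D (selected δ b 0 K ++ select (δ (dn b K)) (P b K) ++ X) columns ∎
    cases (inj₂ δ≡1) = begin
      when (hasLeft o K) (if suc (δ (dn b K)) ≡ᵇ 1 then coverings Λ V (δ ⊞ γ) else 0ℚ)
        + (if δ (dn b K) ≡ᵇ 1 then coverings Λ V δ else 0ℚ)
        ≡⟨ cong (λ v → when (hasLeft o K) (if suc v ≡ᵇ 1 then coverings Λ V (δ ⊞ γ) else 0ℚ)
                       + (if v ≡ᵇ 1 then coverings Λ V δ else 0ℚ)) δ≡1 ⟩
      when (hasLeft o K) 0ℚ + coverings Λ V δ
        ≡⟨ cong (_+ coverings Λ V δ) (when-0 (hasLeft o K)) ⟩
      0ℚ + coverings Λ V δ
        ≡⟨ ℚ.+-identityˡ _ ⟩
      coverings Λ V δ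
        ≡⟨ claim true δ (row-frontier F) (Frontier.ups F K ℕ.≤-refl) ⟩
      D (selected δ b 0 K ++ P b K ∷ X) columns
        ≡⟨ cong (λ v → D (selected δ b 0 K ++ select v (P b K) ++ X) columns) δ≡1 ⟨
      D (selected δ b 0 K ++ select (δ (dn b K)) (P b K) ++ X) columns ∎

-- Parities, halves and numbers of lattice paths

odd : ℕ → Bool
odd zero          = false
odd (suc zero)    = true
odd (suc (suc b)) = odd b

odd-suc : ∀ b → odd (suc b) ≡ not (odd b)
odd-suc zero          = refl
odd-suc (suc zero)    = refl
odd-suc (suc (suc b)) = odd-suc b

half-suc : ∀ b → ⌊ suc b /2⌋ ≡ bit (odd b) ℕ.+ ⌊ b /2⌋
half-suc zero          = refl
half-suc (suc zero)    = refl
half-suc (suc (suc b)) = trans (cong suc (half-suc b)) (sym (ℕ.+-suc (bit (odd b)) ⌊ b /2⌋))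

odd+double-half : ∀ b → bit (odd b) ℕ.+ 2 ℕ.* ⌊ b /2⌋ ≡ b
odd+double-half zero          = refl
odd+double-half (suc zero)    = refl
odd+double-half (suc (suc b)) = trans
  (cong (bit (odd b) ℕ.+_) (ℕ.*-suc 2 ⌊ b /2⌋))
  (trans (ℕ.+-suc (bit (odd b)) _) (cong suc (trans (ℕ.+-suc (bit (odd b)) _) (cong suc (odd+double-half b)))))

double-half-≤ : ∀ b → 2 ℕ.* ⌊ b /2⌋ ℕ.≤ b
double-half-≤ b = subst (2 ℕ.* ⌊ b /2⌋ ℕ.≤_) (odd+double-half b) (ℕ.m≤n+m _ (bit (odd b)))

binomial-negative : ∀ a {j k} → j ℕ.< k → binomial a (j ⊖ k) ≡ 0ℚ
binomial-negative a {j} {k} j<k = trans (cong (binomial a) (ℤ.⊖-< j<k)) (negative (ℕ.m<n⇒0<n∸m j<k))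
  where
  negative : ∀ {i} → 0 ℕ.< i → binomial a (ℤ.- + i) ≡ 0ℚ
  negative {suc i} _ = refl

-- The number of paths from the source in row 2j that leave row b upwards through dn b k.
paths : ℕ → ℕ → ℕ → ℚ
paths b k j = binomial (fromℕ k - fromℕ ⌊ b /2⌋ + fromℕ j) (2 ℕ.* j ⊖ b)

1+⊖suc : ∀ k l → 1ℤ ℤ.+ (k ⊖ suc l) ≡ k ⊖ l
1+⊖suc k l = trans (ℤ.distribʳ-⊖-+-pos 1 k (suc l)) (ℤ.[1+m]⊖[1+n]≡m⊖n k l)

fromℕ-half-suc : ∀ b → fromℕ ⌊ suc b /2⌋ ≡ fromℕ (bit (odd b)) + fromℕ ⌊ b /2⌋
fromℕ-half-suc b = trans (cong fromℕ (half-suc b)) (fromℕ-+ (bit (odd b)) ⌊ b /2⌋)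

-- In the skew coordinate k - ⌊b/2⌋ a step to the east and a step upwards both add 1. Hence the end
-- points fix the number of steps, and 2j - b of them go up. The summand `bit (odd b)` translates
-- between the edge numbers of neighbouring rows.
paths-pascal : ∀ b k j → paths b (suc k) j ≡ paths b k j + paths (suc b) (k ℕ.+ bit (odd b)) j
paths-pascal b k j = begin
  binomial (fromℕ (suc k) - H + J) (2 ℕ.* j ⊖ b)
    ≡⟨ cong₂ binomial (trans (cong (λ z → z - H + J) (fromℕ-suc k))
         (solve 3 (λ K H J → con 1ℚ :+ K :- H :+ J := K :- H :+ J :+ con 1ℚ) refl (fromℕ k) H J))
       (sym (1+⊖suc (2 ℕ.* j) b)) ⟩
  binomial (fromℕ k - H + J + 1ℚ) (1ℤ ℤ.+ m)
    ≡⟨ binomial-pascal (fromℕ k - H + J) m ⟩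
  binomial (fromℕ k - H + J) m + binomial (fromℕ k - H + J) (1ℤ ℤ.+ m)
    ≡⟨ ℚ.+-comm (binomial (fromℕ k - H + J) m) _ ⟩
  binomial (fromℕ k - H + J) (1ℤ ℤ.+ m) + binomial (fromℕ k - H + J) m
    ≡⟨ cong₂ (λ y z → binomial (fromℕ k - H + J) y + binomial z m) (1+⊖suc (2 ℕ.* j) b) upper ⟩
  paths b k j + paths (suc b) (k ℕ.+ bit (odd b)) j ∎
  where
  open ≡-Reasoning
  H J : ℚ
  H = fromℕ ⌊ b /2⌋
  J = fromℕ j
  m : ℤ
  m = 2 ℕ.* j ⊖ suc b
  upper : fromℕ k - H + J ≡ fromℕ (k ℕ.+ bit (odd b)) - fromℕ ⌊ suc b /2⌋ + J
  upper = sym (trans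
    (cong₂ (λ y z → y - z + J) (fromℕ-+ k (bit (odd b))) (fromℕ-half-suc b))
    (solve 4 (λ K B H J → K :+ B :- (B :+ H) :+ J := K :- H :+ J) refl (fromℕ k) (fromℕ (bit (odd b))) H J))

paths-vanish : ∀ {b j} k → 2 ℕ.* j ℕ.< b → paths b k j ≡ 0ℚ
paths-vanish {b} {j} k 2j<b = binomial-negative (fromℕ k - fromℕ ⌊ b /2⌋ + fromℕ j) 2j<b

paths-start-even : ∀ b → odd b ≡ false → paths b 0 ⌊ b /2⌋ ≡ 1ℚ
paths-start-even b e = cong (binomial (0ℚ - fromℕ ⌊ b /2⌋ + fromℕ ⌊ b /2⌋)) (begin
  2 ℕ.* ⌊ b /2⌋ ⊖ b                    ≡⟨ cong (2 ℕ.* ⌊ b /2⌋ ⊖_) 2h≡b ⟨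
  2 ℕ.* ⌊ b /2⌋ ⊖ (2 ℕ.* ⌊ b /2⌋)      ≡⟨ ℤ.n⊖n≡0 (2 ℕ.* ⌊ b /2⌋) ⟩
  0ℤ                                   ∎)
  where
  open ≡-Reasoning
  2h≡b : 2 ℕ.* ⌊ b /2⌋ ≡ b
  2h≡b = trans (cong (λ o → bit o ℕ.+ 2 ℕ.* ⌊ b /2⌋) (sym e)) (odd+double-half b)

-- Pascal's rule, where the term for an arrival from the west vanishes: its lower index is negative,
-- or it is C(i, 2i+1) with i = j - h - 1.
paths-start-odd : ∀ b → odd b ≡ true → ∀ j → paths b 0 j ≡ paths (suc b) 0 j
paths-start-odd b e j = begin
  binomial (0ℚ - fromℕ h + fromℕ j) (2 ℕ.* j ⊖ b)
    ≡⟨ cong₂ binomial upper (sym (1+⊖suc (2 ℕ.* j) b)) ⟩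
  binomial (a + 1ℚ) (1ℤ ℤ.+ m)
    ≡⟨ binomial-pascal a m ⟩
  binomial a m + binomial a (1ℤ ℤ.+ m)
    ≡⟨ cong (λ z → binomial a m + z) (trans (cong (binomial a) (1+⊖suc (2 ℕ.* j) b)) (zero-start (ℕ.<-≤-connex h j))) ⟩
  binomial a m + 0ℚ
    ≡⟨ ℚ.+-identityʳ (binomial a m) ⟩
  paths (suc b) 0 j ∎
  where
  open ≡-Reasoning
  h : ℕ
  h = ⌊ b /2⌋
  a : ℚ
  a = 0ℚ - fromℕ ⌊ suc b /2⌋ + fromℕ j
  m : ℤ
  m = 2 ℕ.* j ⊖ suc b
  half≡ : ⌊ suc b /2⌋ ≡ suc h
  half≡ = trans (half-suc b) (cong (λ o → bit o ℕ.+ h) e)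
  b≡ : suc (2 ℕ.* h) ≡ b
  b≡ = trans (cong (λ o → bit o ℕ.+ 2 ℕ.* h) (sym e)) (odd+double-half b)
  a≡ : a ≡ 0ℚ - (1ℚ + fromℕ h) + fromℕ j
  a≡ = cong (λ z → 0ℚ - z + fromℕ j) (trans (cong fromℕ half≡) (fromℕ-suc h))
  upper : 0ℚ - fromℕ h + fromℕ j ≡ a + 1ℚ
  upper = trans (solve 2 (λ h j → con 0ℚ :- h :+ j := con 0ℚ :- (con 1ℚ :+ h) :+ j :+ con 1ℚ) refl (fromℕ h) (fromℕ j))
    (cong (_+ 1ℚ) (sym a≡))
  zero-start : h ℕ.< j ⊎ j ℕ.≤ h → binomial a (2 ℕ.* j ⊖ b) ≡ 0ℚ
  zero-start (inj₂ j≤h) = binomial-negative a (subst (2 ℕ.* j ℕ.<_) b≡ (ℕ.s≤s (ℕ.*-monoʳ-≤ 2 j≤h)))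
  zero-start (inj₁ h<j) = trans (cong₂ binomial a≡i lower) (binomial-zero (ℕ.s≤s (ℕ.m≤m+n i (i ℕ.+ 0))))
    where
    i : ℕ
    i = j ℕ.∸ suc h
    j≡ : suc h ℕ.+ i ≡ j
    j≡ = ℕ.m+[n∸m]≡n h<j
    a≡i : a ≡ fromℕ i
    a≡i = trans a≡ (trans
      (cong (λ z → 0ℚ - (1ℚ + fromℕ h) + z) (trans (cong fromℕ (sym j≡)) (trans (fromℕ-+ (suc h) i) (cong (_+ fromℕ i) (fromℕ-suc h)))))
      (solve 2 (λ h i → con 0ℚ :- (con 1ℚ :+ h) :+ (con 1ℚ :+ h :+ i) := i) refl (fromℕ h) (fromℕ i)))
    2j≡ : suc (2 ℕ.* h) ℕ.+ suc (2 ℕ.* i) ≡ 2 ℕ.* j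
    2j≡ = begin
      suc (2 ℕ.* h) ℕ.+ suc (2 ℕ.* i)   ≡⟨ ℕ.+-suc (suc (2 ℕ.* h)) (2 ℕ.* i) ⟩
      suc (suc (2 ℕ.* h)) ℕ.+ 2 ℕ.* i   ≡⟨ cong (ℕ._+ 2 ℕ.* i) (ℕ.*-suc 2 h) ⟨
      2 ℕ.* suc h ℕ.+ 2 ℕ.* i           ≡⟨ ℕ.*-distribˡ-+ 2 (suc h) i ⟨
      2 ℕ.* (suc h ℕ.+ i)               ≡⟨ cong (2 ℕ.*_) j≡ ⟩
      2 ℕ.* j                           ∎
    lower : 2 ℕ.* j ⊖ b ≡ + suc (2 ℕ.* i)
    lower = begin
      2 ℕ.* j ⊖ b
        ≡⟨ cong₂ _⊖_ 2j≡ (trans (ℕ.+-identityʳ (suc (2 ℕ.* h))) b≡) ⟨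
      (suc (2 ℕ.* h) ℕ.+ suc (2 ℕ.* i)) ⊖ (suc (2 ℕ.* h) ℕ.+ 0)
        ≡⟨ ℤ.+-cancelˡ-⊖ (suc (2 ℕ.* h)) (suc (2 ℕ.* i)) 0 ⟩
      + suc (2 ℕ.* i) ∎

D-pointwise : ∀ {K : Set} {rs ss : List (K → ℚ)} → Pointwise _≗_ rs ss → ∀ cs → D rs cs ≡ D ss cs
D-pointwise []       []      = refl
D-pointwise []       (_ ∷ _) = refl
D-pointwise (e ∷ es) cs      = contract-cong e (D-pointwise es) cs

-- The rows of C n x from the top: the first n end with an up-pointing
-- triangle, the last n with a down-pointing one.
module Rows (x : ℕ) where

  -- The number of the boundary edge in row b: by then the eastern side has moved b units to the
  -- east and the western side ⌊b/2⌋ units to the west.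
  upperWidth : ℕ → ℕ
  upperWidth b = x ℕ.+ b ℕ.+ ⌊ b /2⌋

  -- With r rows below row b this is the index of its last down-pointing triangle; with `suc r` in
  -- place of r it is the number of these triangles.
  lowerWidth : ℕ → ℕ → ℕ
  lowerWidth b r = x ℕ.+ r ℕ.+ ⌊ b /2⌋

  positive : ℕ → Bool
  positive zero    = false
  positive (suc _) = true

  lowerΛ : ℕ → ℕ → List Pair
  lowerΛ b zero    = []
  lowerΛ b (suc r) = optional (hasLeft (odd b) K) (ap b K , dn b K) ++
    rowΛ (odd b) (positive r) b K (lowerΛ (suc b) r)
    where
    K : ℕ
    K = lowerWidth b r

  lowerV : ℕ → ℕ → List Tri
  lowerV b zero    = []
  lowerV b (suc r) = dn b (lowerWidth b r) ∷ rowV (odd b) b (lowerWidth b r) (lowerV (suc b) r)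

  columns : ℕ → ℕ → List ℕ
  columns b zero    = []
  columns b (suc r) = if odd b then columns (suc b) r else ⌊ b /2⌋ ∷ columns (suc b) r

  lowerΛ-Below : ∀ b r → All (Below₂ b) (lowerΛ b r)
  lowerΛ-Below b zero    = []
  lowerΛ-Below b (suc r) = All.++⁺ (All-optional (hasLeft (odd b) (lowerWidth b r)) (ℕ.≤-refl , ℕ.≤-refl))
    (All.map (λ {(u , d)} (p , q) → Inside-Below u p , Inside-Below d q)
      (rowΛ-Inside (odd b) (positive r) b (lowerWidth b r) (lowerΛ-Below (suc b) r)))

  width-suc : ∀ b r → lowerWidth b r ℕ.+ bit (odd b) ≡ lowerWidth (suc b) r
  width-suc b r = trans (ℕ.+-assoc (x ℕ.+ r) ⌊ b /2⌋ (bit (odd b)))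
    (cong (x ℕ.+ r ℕ.+_) (trans (ℕ.+-comm ⌊ b /2⌋ (bit (odd b))) (sym (half-suc b))))

  open Selection paths

  selected-zero : ∀ {δ} b → (∀ k → δ (dn b k) ≡ 0) → ∀ k m → selected δ b k m ≡ []
  selected-zero b z k zero    = refl
  selected-zero b z k (suc m) = cong₂ (λ v s → select v (paths b k) ++ s) (z k) (selected-zero b z (suc k) m)

  -- The parity hypothesis makes the bottom row odd. It has no source, so no column is left there,
  -- as the parameter `bottom` of `Row` demands.
  lower-coverings : ∀ r b → odd (b ℕ.+ r) ≡ false → ∀ δ → Frontier (positive r) b δ →
    coverings (lowerΛ b r) (lowerV b r) δ ≡ D (selected δ b 0 (lowerWidth b r) ++ []) (columns b r)
  lower-coverings zero    b even δ F =
    sym (cong (λ s → D (s ++ []) []) (selected-zero b (Frontier.first F) 0 (lowerWidth b 0)))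
  lower-coverings (suc r) b even δ F = trans
    (Row.last-claim paths (odd b) (positive r) b (lowerWidth (suc b) r) ⌊ b /2⌋ (columns (suc b) r) []
      (lowerΛ (suc b) r) (lowerV (suc b) r)
      (paths-pascal b) (paths-start-odd b) (paths-start-even b) (λ k → paths-vanish {j = ⌊ b /2⌋} k (ℕ.s≤s (double-half-≤ b)))
      [] (lowerΛ-Below (suc b) r) (bottom r even)
      (lower-coverings r (suc b) (trans (cong odd (sym (ℕ.+-suc b r))) even))
      (lowerWidth b r) (width-suc b r) δ F)
    (cong (λ m → D (selected δ b 0 m ++ []) (columns b (suc r)))
      (cong (ℕ._+ ⌊ b /2⌋) (sym (ℕ.+-suc x r))))
    where
    bottom : ∀ r → odd (b ℕ.+ suc r) ≡ false → positive r ≡ false → odd b ≡ true × columns (suc b) r ≡ []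
    bottom zero e _ = not-false (odd b) (trans (sym (odd-suc b)) (trans (cong odd (sym (ℕ.+-comm b 1))) e)) , refl
      where
      not-false : ∀ o → not o ≡ false → o ≡ true
      not-false true _ = refl

  module _ (n : ℕ) (1≤n : 1 ℕ.≤ n) where

    upperΛ : ℕ → ℕ → List Pair
    upperΛ b zero    = lowerΛ b n
    upperΛ b (suc s) = rowΛ (odd b) true b (upperWidth b) (upperΛ (suc b) s)

    upperV : ℕ → ℕ → List Tri
    upperV b zero    = lowerV b n
    upperV b (suc s) = rowV (odd b) b (upperWidth b) (upperV (suc b) s)

    exits : ℕ → ℕ → List (ℕ → ℚ)
    exits b zero    = []
    exits b (suc s) = paths b (upperWidth b) ∷ exits (suc b) s

    upperΛ-Below : ∀ b s → All (Below₂ b) (upperΛ b s)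
    upperΛ-Below b zero    = lowerΛ-Below b n
    upperΛ-Below b (suc s) = All.map (λ {(u , d)} (p , q) → Inside-Below u p , Inside-Below d q)
      (rowΛ-Inside (odd b) true b (upperWidth b) (upperΛ-Below (suc b) s))

    exits-vanish : ∀ {j} b s → 2 ℕ.* j ℕ.< b → All (λ r → r j ≡ 0ℚ) (exits b s)
    exits-vanish b zero    2j<b = []
    exits-vanish {j} b (suc s) 2j<b = paths-vanish {j = j} (upperWidth b) 2j<b ∷ exits-vanish (suc b) s (ℕ.m≤n⇒m≤1+n 2j<b)

    upper-coverings : ∀ s b → b ℕ.+ s ≡ n → ∀ δ → Frontier true b δ →
      coverings (upperΛ b s) (upperV b s) δ
      ≡ D (selected δ b 0 (upperWidth b) ++ exits b s) (columns b (s ℕ.+ n))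
    upper-coverings zero b b≡n δ F = trans
      (lower-coverings n b even δ (subst (λ p → Frontier p b δ) (sym (positive-n 1≤n)) F))
      (cong (λ m → D (selected δ b 0 (x ℕ.+ m ℕ.+ ⌊ b /2⌋) ++ []) (columns b n)) (trans (sym b≡n) (ℕ.+-identityʳ b)))
      where
      odd-double : ∀ m → odd (m ℕ.+ m) ≡ false
      odd-double zero    = refl
      odd-double (suc m) = trans (cong (odd ∘ suc) (ℕ.+-suc m m)) (odd-double m)
      even : odd (b ℕ.+ n) ≡ false
      even = trans (cong (λ m → odd (m ℕ.+ n)) (trans (sym (ℕ.+-identityʳ b)) b≡n)) (odd-double n)
      positive-n : ∀ {m} → 1 ℕ.≤ m → positive m ≡ true
      positive-n (ℕ.s≤s _) = refl
    upper-coverings (suc s) b b+s≡n δ F =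
      Row.exit-claim paths (odd b) true b (upperWidth (suc b)) ⌊ b /2⌋ (columns (suc b) (s ℕ.+ n)) (exits (suc b) s)
        (upperΛ (suc b) s) (upperV (suc b) s)
        (paths-pascal b) (paths-start-odd b) (paths-start-even b) (λ k → paths-vanish {j = ⌊ b /2⌋} k (ℕ.s≤s (double-half-≤ b)))
        (exits-vanish {⌊ b /2⌋} (suc b) s (ℕ.s≤s (double-half-≤ b))) (upperΛ-Below (suc b) s) (λ ())
        (upper-coverings s (suc b) (trans (sym (ℕ.+-suc b s)) b+s≡n))
        -- The 1 is the down-pointing triangle of row suc b below the horizontal step of the
        -- northeastern side; no lozenge reaches it from above.
        (upperWidth b) 1 width δ F
      where
      width : upperWidth b ℕ.+ bit (odd b) ℕ.+ 1 ≡ upperWidth (suc b)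
      width = trans (ℕ.+-comm (upperWidth b ℕ.+ bit (odd b)) 1) (trans (cong suc (width-suc b b))
        (cong (ℕ._+ ⌊ suc b /2⌋) (sym (ℕ.+-suc x b))))

    columns-double : ∀ f m b → (∀ i → f i ≡ ⌊ b /2⌋ ℕ.+ i) → odd b ≡ false → columns b (m ℕ.+ m) ≡ applyUpTo f m
    columns-double f zero    b f≡ even = refl
    columns-double f (suc m) b f≡ even = begin
      (if odd b then columns (suc b) (m ℕ.+ suc m) else ⌊ b /2⌋ ∷ columns (suc b) (m ℕ.+ suc m))
        ≡⟨ cong (if_then columns (suc b) (m ℕ.+ suc m) else ⌊ b /2⌋ ∷ columns (suc b) (m ℕ.+ suc m)) even ⟩
      ⌊ b /2⌋ ∷ columns (suc b) (m ℕ.+ suc m)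
        ≡⟨ cong (λ k → ⌊ b /2⌋ ∷ columns (suc b) k) (ℕ.+-suc m m) ⟩
      ⌊ b /2⌋ ∷ (if odd (suc b) then columns (suc (suc b)) (m ℕ.+ m) else ⌊ suc b /2⌋ ∷ columns (suc (suc b)) (m ℕ.+ m))
        ≡⟨ cong (λ o → ⌊ b /2⌋ ∷ (if o then columns (suc (suc b)) (m ℕ.+ m) else ⌊ suc b /2⌋ ∷ columns (suc (suc b)) (m ℕ.+ m)))
             (trans (odd-suc b) (cong not even)) ⟩
      ⌊ b /2⌋ ∷ columns (suc (suc b)) (m ℕ.+ m)
        ≡⟨ cong₂ _∷_ (trans (sym (ℕ.+-identityʳ ⌊ b /2⌋)) (sym (f≡ 0)))
             (columns-double (f ∘ suc) m (suc (suc b)) (λ i → trans (f≡ (suc i)) (ℕ.+-suc ⌊ b /2⌋ i)) even) ⟩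
      f 0 ∷ applyUpTo (f ∘ suc) m ∎
      where open ≡-Reasoning

    -- At the boundary edge the drift ⌊b/2⌋ of the western side cancels, leaving x + b + j as upper
    -- index.
    exits-entries : ∀ s b (f : ℕ → ℕ → ℚ) → (∀ i → f i ≗ entry (fromℕ x) (b ℕ.+ i)) →
      Pointwise _≗_ (exits b s) (applyUpTo f s)
    exits-entries zero    b f e = []
    exits-entries (suc s) b f e = (λ j → sym (trans (e 0 j) (start j))) ∷
      exits-entries s (suc b) (f ∘ suc) (λ i j → trans (e (suc i) j) (cong (λ k → entry (fromℕ x) k j) (ℕ.+-suc b i)))
      where
      start : ∀ j → entry (fromℕ x) (b ℕ.+ 0) j ≡ paths b (upperWidth b) j
      start j = trans (cong (λ k → entry (fromℕ x) k j) (ℕ.+-identityʳ b))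
        (cong (λ a → binomial a (2 ℕ.* j ⊖ b)) (begin
          fromℕ x + fromℕ (b ℕ.+ j)
            ≡⟨ cong (λ z → fromℕ x + z) (fromℕ-+ b j) ⟩
          fromℕ x + (fromℕ b + fromℕ j)
            ≡⟨ solve 4 (λ X B H J → X :+ (B :+ J) := X :+ B :+ H :- H :+ J) refl (fromℕ x) (fromℕ b) (fromℕ ⌊ b /2⌋) (fromℕ j) ⟩
          fromℕ x + fromℕ b + fromℕ ⌊ b /2⌋ - fromℕ ⌊ b /2⌋ + fromℕ j
            ≡⟨ cong (λ z → z - fromℕ ⌊ b /2⌋ + fromℕ j)
                 (trans (fromℕ-+ (x ℕ.+ b) ⌊ b /2⌋) (cong (_+ fromℕ ⌊ b /2⌋) (fromℕ-+ x b))) ⟨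
          fromℕ (upperWidth b) - fromℕ ⌊ b /2⌋ + fromℕ j ∎))
        where open ≡-Reasoning

    coverings-Δ : coverings (upperΛ 0 n) (upperV 0 n) (λ _ → 0) ≡ Δ n (fromℕ x)
    coverings-Δ = begin
      coverings (upperΛ 0 n) (upperV 0 n) (λ _ → 0)
        ≡⟨ upper-coverings n 0 refl (λ _ → 0) (record { first = λ _ → inj₁ refl ; downs = λ _ _ → refl ; ups = λ _ _ → refl }) ⟩
      D (selected (λ _ → 0) 0 0 (upperWidth 0) ++ exits 0 n) (columns 0 (n ℕ.+ n))
        ≡⟨ cong₂ (λ s cs → D (s ++ exits 0 n) cs) (selected-zero 0 (λ _ → refl) 0 (upperWidth 0))
             (columns-double id n 0 (λ _ → refl) refl) ⟩
      D (exits 0 n) (upTo n)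
        ≡⟨ D-pointwise (exits-entries n 0 (entry (fromℕ x)) (λ _ _ → refl)) (upTo n) ⟩
      Δ n (fromℕ x) ∎
      where open ≡-Reasoning

-- Counting sublists up to permutation

module _ {A : Set} where

  count : {P : A → Set} → Decidable P → List A → ℕ
  count P? xs = length (filter P? xs)

  count-∷ : ∀ {P : A → Set} (P? : Decidable P) x xs →
    count P? (x ∷ xs) ≡ (if does (P? x) then 1 else 0) ℕ.+ count P? xs
  count-∷ P? x xs with does (P? x)
  ... | true  = refl
  ... | false = refl

  count-++ : ∀ {P : A → Set} (P? : Decidable P) xs ys → count P? (xs ++ ys) ≡ count P? xs ℕ.+ count P? ys
  count-++ P? xs ys = trans (cong length (filter-++ P? xs ys)) (length-++ (filter P? xs))

  count-⇔ : ∀ {P Q : A → Set} (P? : Decidable P) (Q? : Decidable Q) → (∀ x → P x ⇔ Q x) →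
            ∀ xs → count P? xs ≡ count Q? xs
  count-⇔ P? Q? e []       = refl
  count-⇔ P? Q? e (x ∷ xs) = trans (count-∷ P? x xs) (trans
    (cong₂ (λ b m → (if b then 1 else 0) ℕ.+ m) (does-⇔ (e x) (P? x) (Q? x)) (count-⇔ P? Q? e xs))
    (sym (count-∷ Q? x xs)))

count-map : ∀ {A B : Set} {P : B → Set} (P? : Decidable P) (f : A → B) xs →
            count P? (map f xs) ≡ count (P? ∘ f) xs
count-map P? f []       = refl
count-map P? f (x ∷ xs) = trans (count-∷ P? (f x) (map f xs))
  (trans (cong ((if does (P? (f x)) then 1 else 0) ℕ.+_) (count-map P? f xs)) (sym (count-∷ (P? ∘ f) x xs)))

count-sublists-∷ : ∀ {A : Set} {P : List A → Set} (P? : Decidable P) x xs →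
  count P? (sublists (x ∷ xs)) ≡ count (P? ∘ (x ∷_)) (sublists xs) ℕ.+ count P? (sublists xs)
count-sublists-∷ P? x xs = trans (count-++ P? (map (x ∷_) (sublists xs)) (sublists xs))
  (cong (ℕ._+ count P? (sublists xs)) (count-map P? (x ∷_) (sublists xs)))

-- Makes the count independent of the order in which a region lists its lozenges. In the case of a
-- swap, the sublists containing exactly one of x and y trade places.
count-sublists-↭ : ∀ {A : Set} {P : List A → Set} (P? : Decidable P) →
  (∀ {xs ys} → xs ↭ ys → P xs → P ys) →
  ∀ {xs ys} → xs ↭ ys → count P? (sublists xs) ≡ count P? (sublists ys)
count-sublists-↭ P? resp ↭.refl = refl
count-sublists-↭ P? resp (↭.prep {xs} {ys} x p) = begin
  count P? (sublists (x ∷ xs))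
    ≡⟨ count-sublists-∷ P? x xs ⟩
  count (P? ∘ (x ∷_)) (sublists xs) ℕ.+ count P? (sublists xs)
    ≡⟨ cong₂ ℕ._+_ (count-sublists-↭ (P? ∘ (x ∷_)) (resp ∘ ↭.prep x) p) (count-sublists-↭ P? resp p) ⟩
  count (P? ∘ (x ∷_)) (sublists ys) ℕ.+ count P? (sublists ys)
    ≡⟨ count-sublists-∷ P? x ys ⟨
  count P? (sublists (x ∷ ys)) ∎
  where open ≡-Reasoning
count-sublists-↭ {P = P} P? resp (↭.swap {xs} {ys} x y p) = begin
  count P? (sublists (x ∷ y ∷ xs))
    ≡⟨ expand x y xs ⟩
  (count (P? ∘ (x ∷_) ∘ (y ∷_)) (sublists xs) ℕ.+ count (P? ∘ (x ∷_)) (sublists xs))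
    ℕ.+ (count (P? ∘ (y ∷_)) (sublists xs) ℕ.+ count P? (sublists xs))
    ≡⟨ cong₂ ℕ._+_
         (cong₂ ℕ._+_
           (trans (count-sublists-↭ (P? ∘ (x ∷_) ∘ (y ∷_)) (resp ∘ ↭.prep x ∘ ↭.prep y) p)
             (count-⇔ (P? ∘ (x ∷_) ∘ (y ∷_)) (P? ∘ (y ∷_) ∘ (x ∷_))
               (λ T → mk⇔ (resp (↭.swap x y ↭.refl)) (resp (↭.swap y x ↭.refl))) (sublists ys)))
           (count-sublists-↭ (P? ∘ (x ∷_)) (resp ∘ ↭.prep x) p))
         (cong₂ ℕ._+_ (count-sublists-↭ (P? ∘ (y ∷_)) (resp ∘ ↭.prep y) p) (count-sublists-↭ P? resp p)) ⟩
  (count (P? ∘ (y ∷_) ∘ (x ∷_)) (sublists ys) ℕ.+ count (P? ∘ (x ∷_)) (sublists ys))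
    ℕ.+ (count (P? ∘ (y ∷_)) (sublists ys) ℕ.+ count P? (sublists ys))
    ≡⟨ interchange (count (P? ∘ (y ∷_) ∘ (x ∷_)) (sublists ys)) _ _ _ ⟩
  (count (P? ∘ (y ∷_) ∘ (x ∷_)) (sublists ys) ℕ.+ count (P? ∘ (y ∷_)) (sublists ys))
    ℕ.+ (count (P? ∘ (x ∷_)) (sublists ys) ℕ.+ count P? (sublists ys))
    ≡⟨ expand y x ys ⟨
  count P? (sublists (y ∷ x ∷ ys)) ∎
  where
  open ≡-Reasoning
  open import Algebra.Properties.CommutativeSemigroup ℕ.+-commutativeSemigroup using (interchange)
  expand : ∀ x y zs → count P? (sublists (x ∷ y ∷ zs)) ≡
    (count (P? ∘ (x ∷_) ∘ (y ∷_)) (sublists zs) ℕ.+ count (P? ∘ (x ∷_)) (sublists zs))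
    ℕ.+ (count (P? ∘ (y ∷_)) (sublists zs) ℕ.+ count P? (sublists zs))
  expand x y zs = trans (count-sublists-∷ P? x (y ∷ zs))
    (cong₂ ℕ._+_ (count-sublists-∷ (P? ∘ (x ∷_)) y zs) (count-sublists-∷ P? y zs))
count-sublists-↭ P? resp (↭.trans p q) = trans (count-sublists-↭ P? resp p) (count-sublists-↭ P? resp q)

-- The triangles and lozenges of C n x

⊖-injective : ∀ {a b c d} → a ⊖ b ≡ c ⊖ d → a ℕ.+ d ≡ c ℕ.+ b
⊖-injective {a} {b} {c} {d} e = ℤ.+-injective (begin
  + (a ℕ.+ d)                          ≡⟨ cancel a b d ⟨
  (a ⊖ b) ℤ.+ + (b ℕ.+ d)              ≡⟨ cong₂ (λ z k → z ℤ.+ + k) e (ℕ.+-comm b d) ⟩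
  (c ⊖ d) ℤ.+ + (d ℕ.+ b)              ≡⟨ cancel c d b ⟩
  + (c ℕ.+ b)                          ∎)
  where
  open ≡-Reasoning
  cancel : ∀ a b d → (a ⊖ b) ℤ.+ + (b ℕ.+ d) ≡ + (a ℕ.+ d)
  cancel a b d = begin
    (a ⊖ b) ℤ.+ + (b ℕ.+ d)        ≡⟨ ℤ.distribˡ-⊖-+-pos (b ℕ.+ d) a b ⟩
    (a ℕ.+ (b ℕ.+ d)) ⊖ b          ≡⟨ cong₂ _⊖_ (rearrange a b d) (sym (ℕ.+-identityʳ b)) ⟩
    (b ℕ.+ (a ℕ.+ d)) ⊖ (b ℕ.+ 0)  ≡⟨ ℤ.+-cancelˡ-⊖ b (a ℕ.+ d) 0 ⟩
    + (a ℕ.+ d)                    ∎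
    where
    open import Algebra.Properties.CommutativeSemigroup ℕ.+-commutativeSemigroup using ()
      renaming (x∙yz≈y∙xz to rearrange)

-- The k-th edge of row b starts at k - ⌊b/2⌋, since the western side has drifted by ⌊b/2⌋. An
-- up-pointing triangle is named by its base, which is at depth b + 1 and starts one unit further
-- west.
enc : Tri → Triangle
enc (ap b k) = up   , k ⊖ suc ⌊ b /2⌋ , + suc b
enc (dn b k) = down , k ⊖ ⌊ b /2⌋ , + b

⊖-injectiveˡ : ∀ {a c} b → a ⊖ b ≡ c ⊖ b → a ≡ c
⊖-injectiveˡ {a} {c} b e = ℕ.+-cancelʳ-≡ b a c (⊖-injective {a} {b} e)

enc-injective : ∀ {s t} → enc s ≡ enc t → s ≡ t
enc-injective {ap b k} {ap c l} e with ℤ.+-injective (cong (proj₂ ∘ proj₂) e)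
... | refl = cong (ap b) (⊖-injectiveˡ (suc ⌊ b /2⌋) (cong (proj₁ ∘ proj₂) e))
enc-injective {dn b k} {dn c l} e with ℤ.+-injective (cong (proj₂ ∘ proj₂) e)
... | refl = cong (dn b) (⊖-injectiveˡ ⌊ b /2⌋ (cong (proj₁ ∘ proj₂) e))
enc-injective {ap b k} {dn c l} ()
enc-injective {dn b k} {ap c l} ()

enc₂ : Pair → Lozenge
enc₂ (u , d) = enc u , enc d

enc₂-injective : ∀ {ℓ m} → enc₂ ℓ ≡ enc₂ m → ℓ ≡ m
enc₂-injective e = cong₂ _,_ (enc-injective (cong proj₁ e)) (enc-injective (cong proj₂ e))

multiplicity : Tri → List Lozenge → ℕ
multiplicity t T = count (covers? (enc t)) T

multiplicity-∷ : ∀ t ℓ T → multiplicity t (enc₂ ℓ ∷ T) ≡ hit t ℓ ℕ.+ multiplicity t T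
multiplicity-∷ t (u , d) T = trans (count-∷ (covers? (enc t)) (enc₂ (u , d)) T)
  (cong (ℕ._+ multiplicity t T) (trans
    (cong (if_then 1 else 0) (does-⇔ (mk⇔ (Sum.map enc-injective enc-injective) (Sum.map (cong enc) (cong enc)))
      (covers? (enc t) (enc u , enc d)) ((t ≟ u) ⊎-dec (t ≟ d))))
    (sym (hit-does t u d))))

CoversOnce : List Tri → (Tri → ℕ) → List Lozenge → Set
CoversOnce V δ T = All (λ t → δ t ℕ.+ multiplicity t T ≡ 1) V

coversOnce? : ∀ V δ → Decidable (CoversOnce V δ)
coversOnce? V δ T = all? (λ t → δ t ℕ.+ multiplicity t T ℕ.≟ 1) V

coverings-count : ∀ Λ V δ → fromℕ (count (coversOnce? V δ) (sublists (map enc₂ Λ))) ≡ coverings Λ V δ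
coverings-count []      V δ = trans
  (cong fromℕ (trans (count-∷ (coversOnce? V δ) [] []) (ℕ.+-identityʳ _))) (base V)
  where
  base : ∀ V → fromℕ (if does (coversOnce? V δ []) then 1 else 0) ≡ complete V δ
  base []      = refl
  base (t ∷ V) = trans (cong (λ m → fromℕ (if (m ≡ᵇ 1) ∧ does (coversOnce? V δ []) then 1 else 0)) (ℕ.+-identityʳ (δ t)))
    (choose (δ t ≡ᵇ 1))
    where
    choose : ∀ b → fromℕ (if b ∧ does (coversOnce? V δ []) then 1 else 0) ≡ (if b then complete V δ else 0ℚ)
    choose true  = base V
    choose false = refl
coverings-count (ℓ ∷ Λ) V δ = begin
  fromℕ (count (coversOnce? V δ) (sublists (enc₂ ℓ ∷ map enc₂ Λ)))
    ≡⟨ cong fromℕ (count-sublists-∷ (coversOnce? V δ) (enc₂ ℓ) (map enc₂ Λ)) ⟩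
  fromℕ (count (coversOnce? V δ ∘ (enc₂ ℓ ∷_)) S ℕ.+ count (coversOnce? V δ) S)
    ≡⟨ fromℕ-+ (count (coversOnce? V δ ∘ (enc₂ ℓ ∷_)) S) _ ⟩
  fromℕ (count (coversOnce? V δ ∘ (enc₂ ℓ ∷_)) S) + fromℕ (count (coversOnce? V δ) S)
    ≡⟨ cong₂ _+_ (trans (cong fromℕ (count-⇔ (coversOnce? V δ ∘ (enc₂ ℓ ∷_)) (coversOnce? V (δ ⊞ ℓ)) equiv S))
                   (coverings-count Λ V (δ ⊞ ℓ)))
                 (coverings-count Λ V δ) ⟩
  coverings Λ V (δ ⊞ ℓ) + coverings Λ V δ ∎
  where
  open ≡-Reasoning
  open import Algebra.Properties.CommutativeSemigroup ℕ.+-commutativeSemigroup using (x∙yz≈yx∙z)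
  S : List (List Lozenge)
  S = sublists (map enc₂ Λ)
  move : ∀ T t → δ t ℕ.+ multiplicity t (enc₂ ℓ ∷ T) ≡ (δ ⊞ ℓ) t ℕ.+ multiplicity t T
  move T t = trans (cong (δ t ℕ.+_) (multiplicity-∷ t ℓ T)) (x∙yz≈yx∙z (δ t) (hit t ℓ) (multiplicity t T))
  equiv : ∀ T → CoversOnce V δ (enc₂ ℓ ∷ T) ⇔ CoversOnce V (δ ⊞ ℓ) T
  equiv T = mk⇔ (All.map (λ {t} e → trans (sym (move T t)) e)) (All.map (λ {t} e → trans (move T t) e))

IsTiling-resp-↭ : ∀ R {T T′} → T ↭ T′ → IsTiling R T → IsTiling R T′
IsTiling-resp-↭ R p = All.map (λ {t} e → trans (sym (↭.↭-length (↭.filter-↭ (covers? t) p))) e)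

L-coverings : ∀ R V Λ → R ↭ map enc V → lozengesIn R ↭ map enc₂ Λ →
              fromℕ (L R) ≡ coverings Λ V (λ _ → 0)
L-coverings R V Λ R↭ Λ↭ = begin
  fromℕ (count (isTiling? R) (sublists (lozengesIn R)))
    ≡⟨ cong fromℕ (count-sublists-↭ (isTiling? R) (IsTiling-resp-↭ R) Λ↭) ⟩
  fromℕ (count (isTiling? R) (sublists (map enc₂ Λ)))
    ≡⟨ cong fromℕ (count-⇔ (isTiling? R) (coversOnce? V (λ _ → 0))
         (λ T → mk⇔ (All.map⁻ ∘ ↭.All-resp-↭ R↭) (↭.All-resp-↭ (↭-sym R↭) ∘ All.map⁺)) (sublists (map enc₂ Λ))) ⟩
  fromℕ (count (coversOnce? V (λ _ → 0)) (sublists (map enc₂ Λ)))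
    ≡⟨ coverings-count Λ V (λ _ → 0) ⟩
  coverings Λ V (λ _ → 0) ∎
  where open ≡-Reasoning

-- The common side has direction -60°, -120° or 0°, respectively. Written with `suc l`, the equation
-- in `downwards` has no solution for k = 0 in an even row, where `ap b 0` would lie outside the
-- region.
data Adjacent : Pair → Set where
  rightwards : ∀ {b k} → Adjacent (ap b k , dn b k)
  leftwards  : ∀ {b k} → Adjacent (ap b (suc k) , dn b k)
  downwards  : ∀ {b k l} → suc l ≡ k ℕ.+ bit (odd b) → Adjacent (ap b k , dn (suc b) l)

⊖-suc : ∀ k h → (k ⊖ suc h) ℤ.+ 1ℤ ≡ k ⊖ h
⊖-suc k h = trans (ℤ.+-comm (k ⊖ suc h) 1ℤ) (1+⊖suc k h)

Adjacent⇒ShareEdge : ∀ {ℓ} → Adjacent ℓ → ShareEdge (enc₂ ℓ)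
Adjacent⇒ShareEdge (rightwards {b} {k}) =
  there (there (here (there (here (cong₂ (λ y z → (y , z) , SE) (⊖-suc k ⌊ b /2⌋) refl)))))
Adjacent⇒ShareEdge (leftwards {b} {k}) =
  there (here (there (there (here (cong₂ (λ y z → (y , z) , SW)
    (cong (ℤ._+ 1ℤ) (ℤ.[1+m]⊖[1+n]≡m⊖n k ⌊ b /2⌋)) (cong +_ (sym (ℕ.+-identityʳ b))))))))
Adjacent⇒ShareEdge (downwards {b} {k} {l} e) = here (here (cong (λ y → (y , + suc b) , E) (begin
  k ⊖ suc h                            ≡⟨ ℤ.+-cancelˡ-⊖ o k (suc h) ⟨
  (o ℕ.+ k) ⊖ (o ℕ.+ suc h)            ≡⟨ cong₂ _⊖_ (trans (ℕ.+-comm o k) (sym e)) (trans (ℕ.+-suc o h) (cong suc (sym (half-suc b)))) ⟩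
  suc l ⊖ suc ⌊ suc b /2⌋              ≡⟨ ℤ.[1+m]⊖[1+n]≡m⊖n l ⌊ suc b /2⌋ ⟩
  l ⊖ ⌊ suc b /2⌋                      ∎)))
  where
  open ≡-Reasoning
  h o : ℕ
  h = ⌊ b /2⌋
  o = bit (odd b)

ShareEdge⇒Adjacent : ∀ b k c l → ShareEdge (enc₂ (ap b k , dn c l)) → Adjacent (ap b k , dn c l)
ShareEdge⇒Adjacent b k c l (here (here e)) = horizontal (ℤ.+-injective (cong (proj₂ ∘ proj₁) e)) (cong (proj₁ ∘ proj₁) e)
  where
  horizontal : ∀ {c} → suc b ≡ c → k ⊖ suc ⌊ b /2⌋ ≡ l ⊖ ⌊ c /2⌋ → Adjacent (ap b k , dn c l)
  horizontal refl e = downwards (ℕ.+-cancelʳ-≡ ⌊ b /2⌋ (suc l) (k ℕ.+ bit (odd b)) (begin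
    suc l ℕ.+ ⌊ b /2⌋               ≡⟨ ℕ.+-suc l ⌊ b /2⌋ ⟨
    l ℕ.+ suc ⌊ b /2⌋               ≡⟨ ⊖-injective {k} {suc ⌊ b /2⌋} e ⟨
    k ℕ.+ ⌊ suc b /2⌋               ≡⟨ cong (k ℕ.+_) (half-suc b) ⟩
    k ℕ.+ (bit (odd b) ℕ.+ ⌊ b /2⌋) ≡⟨ ℕ.+-assoc k (bit (odd b)) ⌊ b /2⌋ ⟨
    k ℕ.+ bit (odd b) ℕ.+ ⌊ b /2⌋   ∎))
    where open ≡-Reasoning
ShareEdge⇒Adjacent b k c l (here (there (here ())))
ShareEdge⇒Adjacent b k c l (here (there (there (here ()))))
ShareEdge⇒Adjacent b k c l (there (here (here ())))
ShareEdge⇒Adjacent b k c l (there (here (there (here ()))))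
ShareEdge⇒Adjacent b k c l (there (here (there (there (here e))))) =
  slanted (trans (ℤ.+-injective (cong (proj₂ ∘ proj₁) e)) (ℕ.+-identityʳ c)) (cong (proj₁ ∘ proj₁) e)
  where
  slanted : ∀ {c} → b ≡ c → (k ⊖ suc ⌊ b /2⌋) ℤ.+ 1ℤ ≡ (l ⊖ ⌊ c /2⌋) ℤ.+ 1ℤ → Adjacent (ap b k , dn c l)
  slanted refl e = subst (λ k → Adjacent (ap b k , dn b l)) (sym k≡) leftwards
    where
    k≡ : k ≡ suc l
    k≡ = ⊖-injectiveˡ ⌊ b /2⌋ (trans (sym (⊖-suc k ⌊ b /2⌋)) (trans e
      (trans (ℤ.+-comm (l ⊖ ⌊ b /2⌋) 1ℤ) (ℤ.distribʳ-⊖-+-pos 1 l ⌊ b /2⌋))))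
ShareEdge⇒Adjacent b k c l (there (there (here (here ()))))
ShareEdge⇒Adjacent b k c l (there (there (here (there (here e))))) =
  slanted (ℤ.+-injective (cong (proj₂ ∘ proj₁) e)) (cong (proj₁ ∘ proj₁) e)
  where
  slanted : ∀ {c} → b ≡ c → (k ⊖ suc ⌊ b /2⌋) ℤ.+ 1ℤ ≡ l ⊖ ⌊ c /2⌋ → Adjacent (ap b k , dn c l)
  slanted refl e = subst (λ k → Adjacent (ap b k , dn b l)) (sym (⊖-injectiveˡ ⌊ b /2⌋ (trans (sym (⊖-suc k ⌊ b /2⌋)) e))) rightwards
ShareEdge⇒Adjacent b k c l (there (there (here (there (there (here ()))))))

-- The row-by-row lists contain exactly the lozenges of the region

∈-optional : ∀ {A : Set} {a : A} {b} → b ≡ true → a ∈ optional b a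
∈-optional refl = here refl

Sound : List Tri → Pair → Set
Sound V ℓ = (proj₁ ℓ ∈ V × proj₂ ℓ ∈ V) × Adjacent ℓ

Complete : List Tri → List Pair → Set
Complete V Λ = ∀ {b k c l} → ap b k ∈ V → dn c l ∈ V → Adjacent (ap b k , dn c l) → (ap b k , dn c l) ∈ Λ

dn∈rowV : ∀ o b {i} K {rest} → i ℕ.< K → dn b i ∈ rowV o b K rest
dn∈rowV o b (suc K) i<1+K with ℕ.m≤n⇒m<n∨m≡n (ℕ.s≤s⁻¹ i<1+K)
... | inj₁ i<K  = there (there (dn∈rowV o b K i<K))
... | inj₂ refl = there (here refl)

rest⊆rowV : ∀ o b K {rest t} → t ∈ rest → t ∈ rowV o b K rest
rest⊆rowV o b zero    t∈ = ∈-++⁺ʳ (optional o (ap b 0)) t∈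
rest⊆rowV o b (suc K) t∈ = there (there (rest⊆rowV o b K t∈))

dn∈rest : ∀ o b K {rest c l} → dn c l ∈ rowV o b K rest → c ≢ b → dn c l ∈ rest
dn∈rest true  b zero    (there t∈)         c≢b = t∈
dn∈rest false b zero    t∈                 c≢b = t∈
dn∈rest o     b (suc K) (there (here refl)) c≢b = contradiction refl c≢b
dn∈rest o     b (suc K) (there (there t∈)) c≢b = dn∈rest o b K t∈ c≢b

last-ap∈rowV : ∀ o b K {rest} → hasLeft o K ≡ true → ap b K ∈ rowV o b K rest
last-ap∈rowV true b zero    _ = here refl
last-ap∈rowV o    b (suc K) _ = here refl

All-optional′ : ∀ {A : Set} {P : A → Set} b {a} → (b ≡ true → P a) → All P (optional b a)
All-optional′ true  p = p refl ∷ []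
All-optional′ false p = []

Unique-optional : ∀ {A : Set} b {a : A} {xs} → All (a ≢_) xs → Unique xs → Unique (optional b a ++ xs)
Unique-optional true  p u = p ∷ u
Unique-optional false p u = u

module _ {b : ℕ} {restΛ : List Pair} {restV : List Tri}
  (Λ-below : All (Below₂ (suc b)) restΛ) (V-below : All (Below (suc b)) restV) where

  ap∉rest : ∀ {k} → ap b k ∉ restV
  ap∉rest t∈ = ℕ.<-irrefl refl (All.lookup V-below {ap b _} t∈)

  dn∉rest : ∀ {k} → dn b k ∉ restV
  dn∉rest t∈ = ℕ.<-irrefl refl (All.lookup V-below t∈)

  row-inside : ∀ o K {t} → t ∈ rowV o b K restV → Inside b K t
  row-inside o K = All.lookup (rowV-Inside o b K V-below)

  last-hasLeft : ∀ o K → ap b K ∈ rowV o b K restV → hasLeft o K ≡ true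
  last-hasLeft o     (suc K) _  = refl
  last-hasLeft true  zero    _  = refl
  last-hasLeft false zero    t∈ = contradiction t∈ ap∉rest

  -- Of the three possible partners of `dn b K` only the western one can be present: the eastern one
  -- is added later, and the one above belongs to a row not yet reached.
  new-dn : ∀ o K {c k} → ap c k ∈ rowV o b K restV → Adjacent (ap c k , dn b K) →
           (ap c k , dn b K) ∈ optional {Pair} (hasLeft o K) (ap b K , dn b K)
  new-dn o K u∈ rightwards    = ∈-optional (last-hasLeft o K u∈)
  new-dn o K u∈ leftwards     = contradiction refl (ap∉Inside (ap b (suc K)) (row-inside o K u∈))
  new-dn o K {c} {k} u∈ (downwards _) = contradiction (Inside-Below (ap c k) (row-inside o K u∈)) (ℕ.<⇒≱ ℕ.≤-refl)

  module _ (o e : Bool) (o≡ : o ≡ odd b) where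

    rowΛ-sound : ∀ K → (e ≡ true → ∀ {i} → i ℕ.< K ℕ.+ bit o → dn (suc b) i ∈ restV) →
      All (Sound restV) restΛ → All (Sound (rowV o b K restV)) (rowΛ o e b K restΛ)
    rowΛ-sound zero    wide S = start o o≡ wide
      where
      start : ∀ o → o ≡ odd b → (e ≡ true → ∀ {i} → i ℕ.< bit o → dn (suc b) i ∈ restV) →
              All (Sound (rowV o b 0 restV)) (rowΛ o e b 0 restΛ)
      start false _  _    = S
      start true  o≡ wide = All.++⁺
        (All-optional′ e λ e≡ → (here refl , there (wide e≡ ℕ.z<s)) , downwards (cong bit o≡))
        (All.map (λ ((p , q) , a) → (there p , there q) , a) S)
    rowΛ-sound (suc K) wide S = All.++⁺
      (All-optional′ (hasLeft o K) λ h → (there (there (last-ap∈rowV o b K h)) , there (here refl)) , rightwards)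
      (((here refl , there (here refl)) , leftwards) ∷
       All.++⁺ (All-optional′ e λ e≡ →
           (here refl , there (there (rest⊆rowV o b K (wide e≡ ℕ.≤-refl)))) , downwards (cong (λ o → suc (K ℕ.+ bit o)) o≡))
         (All.map (λ ((p , q) , a) → (there (there p) , there (there q)) , a)
           (rowΛ-sound K (λ e≡ i< → wide e≡ (ℕ.m≤n⇒m≤1+n i<)) S)))

    module _ (bottom : e ≡ false → restV ≡ []) (C : Complete restV restΛ) where

      not-bottom : ∀ {t} → t ∈ restV → e ≡ true
      not-bottom = go e bottom
        where
        go : ∀ e → (e ≡ false → restV ≡ []) → ∀ {t} → t ∈ restV → e ≡ true
        go true  _ _  = refl
        go false f t∈ with subst (_ ∈_) (f refl) t∈
        ... | ()

      rowΛ-complete : ∀ K → Complete (rowV o b K restV) (rowΛ o e b K restΛ)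
      rowΛ-complete zero = start o o≡
        where
        ε : Pair
        ε = ap b 0 , dn (suc b) 0
        first : odd b ≡ true → ∀ {c l} → dn c l ∈ restV → Adjacent (ap b 0 , dn c l) → (ap b 0 , dn c l) ∈ optional e ε
        first odd-b d∈ rightwards = contradiction d∈ dn∉rest
        first odd-b d∈ (downwards s) = subst (λ l → (ap b 0 , dn (suc b) l) ∈ optional e ε)
          (sym (ℕ.suc-injective (trans s (cong bit odd-b)))) (∈-optional (not-bottom d∈))
        start : ∀ o → o ≡ odd b → Complete (rowV o b 0 restV) (rowΛ o e b 0 restΛ)
        start false _  u∈           d∈         a = C u∈ d∈ a
        start true  o≡ (here refl)  (there d∈) a = ∈-++⁺ˡ (first (sym o≡) d∈ a)
        start true  o≡ (there u∈)   (there d∈) a = ∈-++⁺ʳ (optional e ε) (C u∈ d∈ a)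
      rowΛ-complete (suc K) = go
        where
        γ α ε : Pair
        γ = ap b K , dn b K
        α = ap b (suc K) , dn b K
        ε = ap b (suc K) , dn (suc b) (K ℕ.+ bit o)
        new-ap : ∀ {c l} → dn c l ∈ rowV o b K restV → Adjacent (ap b (suc K) , dn c l) →
                 (ap b (suc K) , dn c l) ∈ optional e ε
        new-ap d∈ rightwards with row-inside o K d∈
        ... | inj₁ b<b         = contradiction b<b (ℕ.<-irrefl refl)
        ... | inj₂ (_ , 1+K<K) = contradiction 1+K<K (ℕ.<⇒≯ ℕ.≤-refl)
        new-ap d∈ leftwards = contradiction refl (dn∉Inside _ (row-inside o K d∈))
        new-ap d∈ (downwards s) = subst (λ l → (ap b (suc K) , dn (suc b) l) ∈ optional e ε)
          (sym (trans (ℕ.suc-injective s) (cong (λ o → K ℕ.+ bit o) (sym o≡))))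
          (∈-optional (not-bottom (dn∈rest o b K d∈ ℕ.1+n≢n)))
        go : Complete (rowV o b (suc K) restV) (rowΛ o e b (suc K) restΛ)
        go (here refl)        (there (here refl)) a = ∈-++⁺ʳ (optional (hasLeft o K) γ) (here refl)
        go (here refl)        (there (there d∈))  a = ∈-++⁺ʳ (optional (hasLeft o K) γ) (there (∈-++⁺ˡ (new-ap d∈ a)))
        go (there (there u∈)) (there (here refl)) a = ∈-++⁺ˡ (new-dn o K u∈ a)
        go (there (there u∈)) (there (there d∈))  a = ∈-++⁺ʳ (optional (hasLeft o K) γ) (there
          (∈-++⁺ʳ (optional e ε) (rowΛ-complete K u∈ d∈ a)))

    rowΛ-unique : ∀ K → Unique restΛ → Unique (rowΛ o e b K restΛ)
    rowΛ-unique zero    U = start o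
      where
      start : ∀ o → Unique (rowΛ o e b 0 restΛ)
      start false = U
      start true  = Unique-optional e
        (All.map (λ { (p , _) refl → ℕ.<-irrefl refl p }) Λ-below) U
    rowΛ-unique (suc K) U = Unique-optional (hasLeft o K)
      ((λ ()) ∷ All.++⁺ (All-optional e λ ()) (All.map (λ (_ , q) → dn∉Inside _ q ∘ cong proj₂) inside))
      (All.++⁺ (All-optional e λ ()) (All.map (λ (p , _) → ap∉Inside _ p ∘ cong proj₁) inside) ∷
       Unique-optional e (All.map (λ (p , _) → ap∉Inside _ p ∘ cong proj₁) inside) (rowΛ-unique K U))
      where
      inside : All (Inside₂ b K) (rowΛ o e b K restΛ)
      inside = rowΛ-Inside o e b K Λ-below

    rowV-unique : ∀ K → Unique restV → Unique (rowV o b K restV)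
    rowV-unique zero    U = Unique-optional o (All.map (λ { p refl → ℕ.<-irrefl refl p }) V-below) U
    rowV-unique (suc K) U =
      ((λ ()) ∷ All.map (λ p → ap∉Inside _ p) (rowV-Inside o b K V-below)) ∷
      All.map (λ p → dn∉Inside _ p) (rowV-Inside o b K V-below) ∷ rowV-unique K U

module _ (x : ℕ) where

  open Rows x

  lowerV-Below : ∀ b r → All (Below b) (lowerV b r)
  lowerV-Below b zero    = []
  lowerV-Below b (suc r) = ℕ.≤-refl ∷
    All.map (λ {t} → Inside-Below t) (rowV-Inside (odd b) b (lowerWidth b r) (lowerV-Below (suc b) r))

  lowerV-unique : ∀ b r → Unique (lowerV b r)
  lowerV-unique b zero    = []
  lowerV-unique b (suc r) =
    All.map (λ p → dn∉Inside _ p) (rowV-Inside (odd b) b (lowerWidth b r) (lowerV-Below (suc b) r)) ∷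
    rowV-unique {restΛ = lowerΛ (suc b) r} (lowerΛ-Below (suc b) r) (lowerV-Below (suc b) r) (odd b) true refl
      (lowerWidth b r) (lowerV-unique (suc b) r)

  lowerΛ-unique : ∀ b r → Unique (lowerΛ b r)
  lowerΛ-unique b zero    = []
  lowerΛ-unique b (suc r) = Unique-optional (hasLeft (odd b) (lowerWidth b r))
    (All.map (λ (_ , q) → dn∉Inside _ q ∘ cong proj₂)
      (rowΛ-Inside (odd b) (positive r) b (lowerWidth b r) (lowerΛ-Below (suc b) r)))
    (rowΛ-unique (lowerΛ-Below (suc b) r) (lowerV-Below (suc b) r) (odd b) (positive r) refl
      (lowerWidth b r) (lowerΛ-unique (suc b) r))

  dn∈lowerV : ∀ b r {i} → i ℕ.< lowerWidth b (suc r) → dn b i ∈ lowerV b (suc r)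
  dn∈lowerV b r {i} i< with ℕ.m≤n⇒m<n∨m≡n (ℕ.s≤s⁻¹ (subst (i ℕ.<_) (cong (ℕ._+ ⌊ b /2⌋) (ℕ.+-suc x r)) i<))
  ... | inj₁ i<K  = there (dn∈rowV (odd b) b (lowerWidth b r) i<K)
  ... | inj₂ refl = here refl

  lowerΛ-sound : ∀ b r → All (Sound (lowerV b r)) (lowerΛ b r)
  lowerΛ-sound b zero    = []
  lowerΛ-sound b (suc r) = All.++⁺
    (All-optional′ (hasLeft (odd b) K) λ h → (there (last-ap∈rowV (odd b) b K h) , here refl) , rightwards)
    (All.map (λ ((p , q) , a) → (there p , there q) , a)
      (rowΛ-sound (lowerΛ-Below (suc b) r) (lowerV-Below (suc b) r) (odd b) (positive r) refl K wide (lowerΛ-sound (suc b) r)))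
    where
    K : ℕ
    K = lowerWidth b r
    wide : positive r ≡ true → ∀ {i} → i ℕ.< K ℕ.+ bit (odd b) → dn (suc b) i ∈ lowerV (suc b) r
    wide = go r (width-suc b r)
      where
      go : ∀ r {W} → W ≡ lowerWidth (suc b) r → positive r ≡ true → ∀ {i} → i ℕ.< W → dn (suc b) i ∈ lowerV (suc b) r
      go (suc r) refl _ = dn∈lowerV (suc b) r

  lowerΛ-complete : ∀ b r → Complete (lowerV b r) (lowerΛ b r)
  lowerΛ-complete b zero ()
  lowerΛ-complete b (suc r) = go
    where
    K : ℕ
    K = lowerWidth b r
    bottom : ∀ r → positive r ≡ false → lowerV (suc b) r ≡ []
    bottom zero _ = refl
    go : Complete (lowerV b (suc r)) (lowerΛ b (suc r))
    go (there u∈) (here refl) a = ∈-++⁺ˡ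
      (new-dn (lowerΛ-Below (suc b) r) (lowerV-Below (suc b) r) (odd b) K u∈ a)
    go (there u∈) (there d∈)  a = ∈-++⁺ʳ (optional (hasLeft (odd b) K) (ap b K , dn b K))
      (rowΛ-complete (lowerΛ-Below (suc b) r) (lowerV-Below (suc b) r) (odd b) (positive r) refl
        (bottom r) (lowerΛ-complete (suc b) r) K u∈ d∈ a)

  module _ (n : ℕ) (1≤n : 1 ℕ.≤ n) where

    upperV-Below : ∀ b s → All (Below b) (upperV n 1≤n b s)
    upperV-Below b zero    = lowerV-Below b n
    upperV-Below b (suc s) = All.map (λ {t} → Inside-Below t)
      (rowV-Inside (odd b) b (upperWidth b) (upperV-Below (suc b) s))

    upperV-unique : ∀ b s → Unique (upperV n 1≤n b s)
    upperV-unique b zero    = lowerV-unique b n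
    upperV-unique b (suc s) = rowV-unique (upperΛ-Below n 1≤n (suc b) s) (upperV-Below (suc b) s)
      (odd b) true refl (upperWidth b) (upperV-unique (suc b) s)

    upperΛ-unique : ∀ b s → Unique (upperΛ n 1≤n b s)
    upperΛ-unique b zero    = lowerΛ-unique b n
    upperΛ-unique b (suc s) = rowΛ-unique (upperΛ-Below n 1≤n (suc b) s) (upperV-Below (suc b) s)
      (odd b) true refl (upperWidth b) (upperΛ-unique (suc b) s)

    dn∈upperV : ∀ s b → b ℕ.+ s ≡ n → ∀ {i} → i ℕ.< upperWidth b → dn b i ∈ upperV n 1≤n b s
    dn∈upperV (suc s) b b+s≡n i< = dn∈rowV (odd b) b (upperWidth b) i<
    dn∈upperV zero    b b≡n   i< = go 1≤n (trans (sym (ℕ.+-identityʳ b)) b≡n) i<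
      where
      go : ∀ {m} → 1 ℕ.≤ m → b ≡ m → ∀ {i} → i ℕ.< upperWidth b → dn b i ∈ lowerV b m
      go {suc m} _ refl = dn∈lowerV b m

    upperΛ-sound : ∀ s b → b ℕ.+ s ≡ n → All (Sound (upperV n 1≤n b s)) (upperΛ n 1≤n b s)
    upperΛ-sound zero    b _     = lowerΛ-sound b n
    upperΛ-sound (suc s) b b+s≡n = rowΛ-sound (upperΛ-Below n 1≤n (suc b) s) (upperV-Below (suc b) s)
      (odd b) true refl (upperWidth b)
      (λ _ {i} i< → dn∈upperV s (suc b) b+s≡n′ (ℕ.<-trans (subst (i ℕ.<_) (width-suc b b) i<) (ℕ.+-monoˡ-< ⌊ suc b /2⌋ (ℕ.+-monoʳ-< x ℕ.≤-refl))))
      (upperΛ-sound s (suc b) b+s≡n′)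
      where
      b+s≡n′ : suc b ℕ.+ s ≡ n
      b+s≡n′ = trans (sym (ℕ.+-suc b s)) b+s≡n

    upperΛ-complete : ∀ b s → Complete (upperV n 1≤n b s) (upperΛ n 1≤n b s)
    upperΛ-complete b zero    = lowerΛ-complete b n
    upperΛ-complete b (suc s) = rowΛ-complete (upperΛ-Below n 1≤n (suc b) s) (upperV-Below (suc b) s)
      (odd b) true refl (λ ()) (upperΛ-complete (suc b) s) (upperWidth b)

Unique-resp-↭ : ∀ {A : Set} {xs ys : List A} → xs ↭ ys → Unique xs → Unique ys
Unique-resp-↭ ↭.refl          u = u
Unique-resp-↭ (↭.prep x p)    (h ∷ u) = ↭.All-resp-↭ p h ∷ Unique-resp-↭ p u
Unique-resp-↭ (↭.swap x y p)  ((x≢y ∷ hx) ∷ hy ∷ u) =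
  ((x≢y ∘ sym) ∷ ↭.All-resp-↭ p hy) ∷ ↭.All-resp-↭ p hx ∷ Unique-resp-↭ p u
Unique-resp-↭ (↭.trans p q)   u = Unique-resp-↭ q (Unique-resp-↭ p u)

-- Repetition-free lists with the same members are permutations of each other, so the order produced
-- by `cartesianProduct` never has to be described.
lozengesIn-↭ : ∀ {R V Λ} → R ↭ map enc V → Unique V → Unique Λ → All (Sound V) Λ → Complete V Λ →
               lozengesIn R ↭ map enc₂ Λ
lozengesIn-↭ {R} {V} {Λ} R↭ UV UΛ S C = ∼bag⇒↭ (unique∧set⇒bag unique (Unique.map⁺ enc₂-injective UΛ) (mk⇔ to from))
  where
  UR : Unique R
  UR = Unique-resp-↭ (↭-sym R↭) (Unique.map⁺ enc-injective UV)
  isOrientation? : ∀ o (t : Triangle) → _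
  isOrientation? o t = proj₁ t ≟ᴼ o
  unique : Unique (lozengesIn R)
  unique = Unique.filter⁺ shareEdge?
    (Unique.cartesianProduct⁺ (Unique.filter⁺ (isOrientation? up) UR) (Unique.filter⁺ (isOrientation? down) UR))
  to : ∀ {ℓ} → ℓ ∈ lozengesIn R → ℓ ∈ map enc₂ Λ
  to {u , d} ℓ∈ with ∈-filter⁻ shareEdge? {xs = cartesianProduct (oriented up R) (oriented down R)} ℓ∈
  ... | ud∈ , share with ∈-cartesianProduct⁻ (oriented up R) (oriented down R) ud∈
  ... | u∈ , d∈ with ∈-filter⁻ (isOrientation? up) {xs = R} u∈ | ∈-filter⁻ (isOrientation? down) {xs = R} d∈
  ... | u∈R , u-up | d∈R , d-down with ∈-map⁻ enc (↭.∈-resp-↭ R↭ u∈R) | ∈-map⁻ enc (↭.∈-resp-↭ R↭ d∈R)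
  ... | ap b k , u∈V , refl | dn c l , d∈V , refl = ∈-map⁺ enc₂ (C u∈V d∈V (ShareEdge⇒Adjacent b k c l share))
  to ℓ∈ | _ | _ | (_ , ()) | _ | dn _ _ , _ , refl | _
  to ℓ∈ | _ | _ | _ | (_ , ()) | _ | ap _ _ , _ , refl
  from : ∀ {ℓ} → ℓ ∈ map enc₂ Λ → ℓ ∈ lozengesIn R
  from ℓ∈ with ∈-map⁻ enc₂ ℓ∈
  ... | (u , d) , ℓ∈Λ , refl with All.lookup S ℓ∈Λ
  ... | (u∈V , d∈V) , adjacent = ∈-filter⁺ shareEdge?
    (∈-cartesianProduct⁺ (∈-filter⁺ (isOrientation? up) (into u∈V) (proj₁ (oriented-pair adjacent)))
                         (∈-filter⁺ (isOrientation? down) (into d∈V) (proj₂ (oriented-pair adjacent))))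
    (Adjacent⇒ShareEdge adjacent)
    where
    into : ∀ {t} → t ∈ V → enc t ∈ R
    into t∈V = ↭.∈-resp-↭ (↭-sym R↭) (∈-map⁺ enc t∈V)
    oriented-pair : ∀ {u d} → Adjacent (u , d) → proj₁ (enc u) ≡ up × proj₁ (enc d) ≡ down
    oriented-pair rightwards    = refl , refl
    oriented-pair leftwards     = refl , refl
    oriented-pair (downwards _) = refl , refl

-- The boundary walks and the strips between them

westDirection : Bool → Point
westDirection false = SE
westDirection true  = SW

west : ℕ → ℕ → List Edge
west b zero    = []
west b (suc r) = ((0 ⊖ ⌊ b /2⌋ , + b) , westDirection (odd b)) ∷ west (suc b) r

+1≡suc : ∀ b → + b ℤ.+ 1ℤ ≡ + suc b
+1≡suc b = cong +_ (ℕ.+-comm b 1)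

⊖-pred : ∀ h → (0 ⊖ h) ℤ.+ -1ℤ ≡ 0 ⊖ suc h
⊖-pred h = trans (ℤ.distribˡ-⊖-+-neg 0 0 h) (cong (0 ⊖_) (cong suc (ℕ.+-identityʳ h)))

-- The zig-zag has period two, so the induction advances by two rows and starts at even b.
descending-west : ∀ m b → odd b ≡ false →
  descending (walk (0 ⊖ ⌊ b /2⌋ , + b) (repeat m (SE ∷ SW ∷ []))) ≡ west b (m ℕ.+ m)
descending-west zero    b even = refl
descending-west (suc m) b even = begin
  (p , SE) ∷ (p ⊕ SE , SW) ∷ descending (walk (p ⊕ SE ⊕ SW) (repeat m (SE ∷ SW ∷ [])))
    ≡⟨ cong₂ (λ q r → (p , SE) ∷ (q , SW) ∷ descending (walk r (repeat m (SE ∷ SW ∷ [])))) p⊕SE p⊕SE⊕SW ⟩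
  (p , SE) ∷ ((0 ⊖ ⌊ suc b /2⌋ , + suc b) , SW) ∷
    descending (walk (0 ⊖ ⌊ suc (suc b) /2⌋ , + suc (suc b)) (repeat m (SE ∷ SW ∷ [])))
    ≡⟨ cong (λ es → (p , SE) ∷ ((0 ⊖ ⌊ suc b /2⌋ , + suc b) , SW) ∷ es) (descending-west m (suc (suc b)) even) ⟩
  (p , SE) ∷ ((0 ⊖ ⌊ suc b /2⌋ , + suc b) , SW) ∷ west (suc (suc b)) (m ℕ.+ m)
    ≡⟨ cong₂ (λ o o′ → (p , westDirection o) ∷ ((0 ⊖ ⌊ suc b /2⌋ , + suc b) , westDirection o′) ∷ west (suc (suc b)) (m ℕ.+ m))
         even (trans (odd-suc b) (cong not even)) ⟨
  west b (suc (suc (m ℕ.+ m)))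
    ≡⟨ cong (λ r → west b (suc r)) (ℕ.+-suc m m) ⟨
  west b (suc m ℕ.+ suc m) ∎
  where
  open ≡-Reasoning
  p : Point
  p = 0 ⊖ ⌊ b /2⌋ , + b
  half : ⌊ suc b /2⌋ ≡ ⌊ b /2⌋
  half = trans (half-suc b) (cong (λ o → bit o ℕ.+ ⌊ b /2⌋) even)
  p⊕SE : p ⊕ SE ≡ (0 ⊖ ⌊ suc b /2⌋ , + suc b)
  p⊕SE = cong₂ _,_ (trans (ℤ.+-identityʳ (0 ⊖ ⌊ b /2⌋)) (cong (0 ⊖_) (sym half))) (+1≡suc b)
  p⊕SE⊕SW : p ⊕ SE ⊕ SW ≡ (0 ⊖ ⌊ suc (suc b) /2⌋ , + suc (suc b))
  p⊕SE⊕SW = cong₂ _,_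
    (trans (cong (ℤ._+ -1ℤ) (ℤ.+-identityʳ (0 ⊖ ⌊ b /2⌋))) (⊖-pred ⌊ b /2⌋))
    (trans (cong (ℤ._+ 1ℤ) (+1≡suc b)) (+1≡suc (suc b)))

applyUpTo-cong : ∀ {A : Set} {f g : ℕ → A} → (∀ i → f i ≡ g i) → ∀ m → applyUpTo f m ≡ applyUpTo g m
applyUpTo-cong e zero    = refl
applyUpTo-cong e (suc m) = cong₂ _∷_ (e 0) (applyUpTo-cong (e ∘ suc) m)

segments-count : ∀ {a b c d k} → c ℤ.- a ≡ + k → segments (a , b) (c , d) ≡ applyUpTo (λ i → (a ℤ.+ + i , b)) k
segments-count {a} {b} {c} {k = k} e with c ℤ.- a | e
... | .(+ k) | refl = map-upTo (λ i → (a ℤ.+ + i , b)) k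

distance : ∀ c h → + c ℤ.- (0 ⊖ h) ≡ + (c ℕ.+ h)
distance c h = trans (cong (λ z → + c ℤ.+ z) (sym (ℤ.⊖-swap h 0))) refl

map-segments : ∀ o {a b c d k} (f : ℕ → Tri) → c ℤ.- a ≡ + k →
  (∀ i → (o , (a ℤ.+ + i , b)) ≡ enc (f i)) →
  map (o ,_) (segments (a , b) (c , d)) ≡ map enc (applyUpTo f k)
map-segments o {a} {b} {c} {d} {k} f e p = begin
  map (o ,_) (segments (a , b) (c , d))                 ≡⟨ cong (map (o ,_)) (segments-count {a} {b} {c} {d} {k} e) ⟩
  map (o ,_) (applyUpTo (λ i → (a ℤ.+ + i , b)) k)      ≡⟨ map-applyUpTo (λ i → (a ℤ.+ + i , b)) (o ,_) k ⟩
  applyUpTo (λ i → (o , (a ℤ.+ + i , b))) k             ≡⟨ applyUpTo-cong p k ⟩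
  applyUpTo (enc ∘ f) k                                 ≡⟨ map-applyUpTo f enc k ⟨
  map enc (applyUpTo f k)                               ∎
  where open ≡-Reasoning

downs-of-row : ∀ b c d → map (down ,_) (segments (0 ⊖ ⌊ b /2⌋ , + b) (+ c , d))
               ≡ map enc (applyUpTo (dn b) (c ℕ.+ ⌊ b /2⌋))
downs-of-row b c d = map-segments down {0 ⊖ ⌊ b /2⌋} {+ b} {+ c} {d} (dn b) (distance c ⌊ b /2⌋)
  (λ i → cong (λ z → down , (z , + b)) (ℤ.distribˡ-⊖-+-pos i 0 ⌊ b /2⌋))

ups-of-row : ∀ b c d → map (up ,_) (segments ((0 ⊖ ⌊ b /2⌋ , + b) ⊕ westDirection (odd b)) (+ c , d))
             ≡ map enc (optional (odd b) (ap b 0) ++ applyUpTo (ap b ∘ suc) (c ℕ.+ ⌊ b /2⌋))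
ups-of-row b c d = go (odd b)
  where
  h : ℕ
  h = ⌊ b /2⌋
  go : ∀ o → map (up ,_) (segments ((0 ⊖ h , + b) ⊕ westDirection o) (+ c , d))
             ≡ map enc (optional o (ap b 0) ++ applyUpTo (ap b ∘ suc) (c ℕ.+ h))
  go false = map-segments up {(0 ⊖ h) ℤ.+ 0ℤ} {+ b ℤ.+ 1ℤ} {+ c} {d} (ap b ∘ suc)
    (trans (cong (λ z → + c ℤ.- z) (ℤ.+-identityʳ (0 ⊖ h))) (distance c h))
    (λ i → cong₂ (λ y z → up , (y , z))
      (trans (cong (ℤ._+ + i) (ℤ.+-identityʳ (0 ⊖ h))) (trans (ℤ.distribˡ-⊖-+-pos i 0 h) (sym (ℤ.[1+m]⊖[1+n]≡m⊖n i h))))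
      (+1≡suc b))
  -- In an odd row the western edge ends one unit further west, which accounts for the additional
  -- triangle `ap b 0`.
  go true = map-segments up {(0 ⊖ h) ℤ.+ -1ℤ} {+ b ℤ.+ 1ℤ} {+ c} {d} {suc (c ℕ.+ h)} (ap b)
    (trans (cong (λ z → + c ℤ.- z) (⊖-pred h)) (trans (distance c (suc h)) (cong +_ (ℕ.+-suc c h))))
    (λ i → cong₂ (λ y z → up , (y , z))
      (trans (cong (ℤ._+ + i) (⊖-pred h)) (ℤ.distribˡ-⊖-+-pos i 0 (suc h)))
      (+1≡suc b))

rowV-++ : ∀ o b K rest → rowV o b K rest ≡ rowV o b K [] ++ rest
rowV-++ true  b zero    rest = refl
rowV-++ false b zero    rest = refl
rowV-++ o     b (suc K) rest = cong (λ ts → ap b (suc K) ∷ dn b K ∷ ts) (rowV-++ o b K rest)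

-- `strip` lists the down-pointing triangles and then the up-pointing ones, each from the west,
-- whereas `rowV` alternates from the east. The induction brings the last triangle of each kind to
-- the front.
row-↭ : ∀ o b K → applyUpTo (dn b) K ++ (optional o (ap b 0) ++ applyUpTo (ap b ∘ suc) K) ↭ rowV o b K []
row-↭ o b zero    = ↭-refl
row-↭ o b (suc K) = begin
  applyUpTo (dn b) (suc K) ++ (O ++ applyUpTo (ap b ∘ suc) (suc K))
    ≡⟨ cong₂ (λ as bs → as ++ (O ++ bs)) (applyUpTo-∷ʳ (dn b) K) (applyUpTo-∷ʳ (ap b ∘ suc) K) ⟨
  (A ++ [ dn b K ]) ++ (O ++ (B ++ [ ap b (suc K) ]))
    ≡⟨ cong ((A ++ [ dn b K ]) ++_) (++-assoc O B [ ap b (suc K) ]) ⟨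
  (A ++ [ dn b K ]) ++ ((O ++ B) ++ [ ap b (suc K) ])
    ≡⟨ ++-assoc (A ++ [ dn b K ]) (O ++ B) [ ap b (suc K) ] ⟨
  ((A ++ [ dn b K ]) ++ (O ++ B)) ++ [ ap b (suc K) ]
    ↭⟨ ↭.∷↭∷ʳ (ap b (suc K)) _ ⟨
  ap b (suc K) ∷ ((A ++ [ dn b K ]) ++ (O ++ B))
    ≡⟨ cong (ap b (suc K) ∷_) (++-assoc A [ dn b K ] (O ++ B)) ⟩
  ap b (suc K) ∷ (A ++ [ dn b K ] ++ (O ++ B))
    ↭⟨ ↭.prep (ap b (suc K)) (↭.shift (dn b K) A (O ++ B)) ⟩
  ap b (suc K) ∷ dn b K ∷ (A ++ (O ++ B))
    ↭⟨ ↭.prep (ap b (suc K)) (↭.prep (dn b K) (row-↭ o b K)) ⟩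
  rowV o b (suc K) [] ∎
  where
  open ↭.PermutationReasoning
  A O B : List Tri
  A = applyUpTo (dn b) K
  O = optional o (ap b 0)
  B = applyUpTo (ap b ∘ suc) K

row-last-↭ : ∀ o b K → applyUpTo (dn b) (suc K) ++ (optional o (ap b 0) ++ applyUpTo (ap b ∘ suc) K)
             ↭ dn b K ∷ rowV o b K []
row-last-↭ o b K = begin
  applyUpTo (dn b) (suc K) ++ U          ≡⟨ cong (_++ U) (applyUpTo-∷ʳ (dn b) K) ⟨
  (applyUpTo (dn b) K ++ [ dn b K ]) ++ U ≡⟨ ++-assoc (applyUpTo (dn b) K) [ dn b K ] U ⟩
  applyUpTo (dn b) K ++ [ dn b K ] ++ U  ↭⟨ ↭.shift (dn b K) (applyUpTo (dn b) K) U ⟩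
  dn b K ∷ (applyUpTo (dn b) K ++ U)     ↭⟨ ↭.prep (dn b K) (row-↭ o b K) ⟩
  dn b K ∷ rowV o b K []                 ∎
  where
  open ↭.PermutationReasoning
  U : List Tri
  U = optional o (ap b 0) ++ applyUpTo (ap b ∘ suc) K

module _ (x : ℕ) where

  open Rows x

  lowerEast : ℕ → ℕ → List Edge
  lowerEast b zero    = []
  lowerEast b (suc r) = ((+ (x ℕ.+ suc r) , + b) , SW) ∷ lowerEast (suc b) r

  step-SW : ∀ r → + (x ℕ.+ suc r) ℤ.+ -1ℤ ≡ + (x ℕ.+ r)
  step-SW r = cong (λ k → + k ℤ.+ -1ℤ) (ℕ.+-suc x r)

  descending-lowerEast : ∀ r b → descending (walk (+ (x ℕ.+ r) , + b) (repeat r (SW ∷ []))) ≡ lowerEast b r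
  descending-lowerEast zero    b = refl
  descending-lowerEast (suc r) b = cong (((+ (x ℕ.+ suc r) , + b) , SW) ∷_) (trans
    (cong₂ (λ y z → descending (walk (y , z) (repeat r (SW ∷ [])))) (step-SW r) (+1≡suc b))
    (descending-lowerEast r (suc b)))

  strip-lower : ∀ b r → strip ((0 ⊖ ⌊ b /2⌋ , + b) , westDirection (odd b)) ((+ (x ℕ.+ suc r) , + b) , SW)
                ↭ map enc (dn b (lowerWidth b r) ∷ rowV (odd b) b (lowerWidth b r) [])
  strip-lower b r = begin
    map (down ,_) (segments w e) ++ map (up ,_) (segments (w ⊕ westDirection (odd b)) (e ⊕ SW))
      ≡⟨ cong₂ _++_ (downs-of-row b (x ℕ.+ suc r) (+ b))
           (trans (cong (λ z → map (up ,_) (segments (w ⊕ westDirection (odd b)) (z , + b ℤ.+ 1ℤ))) (step-SW r))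
             (ups-of-row b (x ℕ.+ r) (+ b ℤ.+ 1ℤ))) ⟩
    map enc (applyUpTo (dn b) (x ℕ.+ suc r ℕ.+ ⌊ b /2⌋)) ++ map enc U
      ≡⟨ cong (λ k → map enc (applyUpTo (dn b) (k ℕ.+ ⌊ b /2⌋)) ++ map enc U) (ℕ.+-suc x r) ⟩
    map enc (applyUpTo (dn b) (suc K)) ++ map enc U
      ≡⟨ map-++ enc (applyUpTo (dn b) (suc K)) U ⟨
    map enc (applyUpTo (dn b) (suc K) ++ U)
      ↭⟨ ↭.map⁺ enc (row-last-↭ (odd b) b K) ⟩
    map enc (dn b K ∷ rowV (odd b) b K []) ∎
    where
    open ↭.PermutationReasoning
    w e : Point
    w = 0 ⊖ ⌊ b /2⌋ , + b
    e = + (x ℕ.+ suc r) , + b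
    K : ℕ
    K = lowerWidth b r
    U : List Tri
    U = optional (odd b) (ap b 0) ++ applyUpTo (ap b ∘ suc) K

  strip-upper : ∀ b → strip ((0 ⊖ ⌊ b /2⌋ , + b) , westDirection (odd b)) ((+ (x ℕ.+ b) , + b) , SE)
                ↭ map enc (rowV (odd b) b (upperWidth b) [])
  strip-upper b = begin
    map (down ,_) (segments w e) ++ map (up ,_) (segments (w ⊕ westDirection (odd b)) (e ⊕ SE))
      ≡⟨ cong₂ _++_ (downs-of-row b (x ℕ.+ b) (+ b))
           (trans (cong (λ z → map (up ,_) (segments (w ⊕ westDirection (odd b)) (z , + b ℤ.+ 1ℤ))) (ℤ.+-identityʳ (+ (x ℕ.+ b))))
             (ups-of-row b (x ℕ.+ b) (+ b ℤ.+ 1ℤ))) ⟩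
    map enc (applyUpTo (dn b) K) ++ map enc U
      ≡⟨ map-++ enc (applyUpTo (dn b) K) U ⟨
    map enc (applyUpTo (dn b) K ++ U)
      ↭⟨ ↭.map⁺ enc (row-↭ (odd b) b K) ⟩
    map enc (rowV (odd b) b K []) ∎
    where
    open ↭.PermutationReasoning
    w e : Point
    w = 0 ⊖ ⌊ b /2⌋ , + b
    e = + (x ℕ.+ b) , + b
    K : ℕ
    K = upperWidth b
    U : List Tri
    U = optional (odd b) (ap b 0) ++ applyUpTo (ap b ∘ suc) K

  lower-region : ∀ r b → concat (zipWith strip (west b r) (lowerEast b r)) ↭ map enc (lowerV b r)
  lower-region zero    b = ↭-refl
  lower-region (suc r) b = begin
    strip ((0 ⊖ ⌊ b /2⌋ , + b) , westDirection (odd b)) ((+ (x ℕ.+ suc r) , + b) , SW)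
      ++ concat (zipWith strip (west (suc b) r) (lowerEast (suc b) r))
      ↭⟨ ↭.++⁺ (strip-lower b r) (lower-region r (suc b)) ⟩
    map enc (dn b K ∷ rowV (odd b) b K []) ++ map enc (lowerV (suc b) r)
      ≡⟨ map-++ enc (dn b K ∷ rowV (odd b) b K []) (lowerV (suc b) r) ⟨
    map enc (dn b K ∷ rowV (odd b) b K [] ++ lowerV (suc b) r)
      ≡⟨ cong (λ ts → map enc (dn b K ∷ ts)) (rowV-++ (odd b) b K (lowerV (suc b) r)) ⟨
    map enc (lowerV b (suc r)) ∎
    where
    open ↭.PermutationReasoning
    K : ℕ
    K = lowerWidth b r

  module _ (n : ℕ) (1≤n : 1 ≤ n) where

    upperEast : ℕ → ℕ → List Edge
    upperEast b zero    = lowerEast b n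
    upperEast b (suc s) = ((+ (x ℕ.+ b) , + b) , SE) ∷ upperEast (suc b) s

    -- The horizontal steps are filtered out by computation; all they leave is a shift of the start
    -- of the next edge.
    descending-upperEast : ∀ s b → b ℕ.+ s ≡ n →
      descending (walk (+ (x ℕ.+ b) , + b) (repeat s (SE ∷ E ∷ []) ++ repeat n (SW ∷ []))) ≡ upperEast b s
    descending-upperEast zero b b≡n = trans
      (cong (λ k → descending (walk (+ (x ℕ.+ k) , + b) (repeat n (SW ∷ [])))) (trans (sym (ℕ.+-identityʳ b)) b≡n))
      (descending-lowerEast n b)
    descending-upperEast (suc s) b b+s≡n = cong (((+ (x ℕ.+ b) , + b) , SE) ∷_) (trans
      (cong₂ (λ y z → descending (walk (y , z) (repeat s (SE ∷ E ∷ []) ++ repeat n (SW ∷ []))))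
        (trans (cong (ℤ._+ 1ℤ) (ℤ.+-identityʳ (+ (x ℕ.+ b)))) (trans (+1≡suc (x ℕ.+ b)) (cong +_ (sym (ℕ.+-suc x b)))))
        (trans (ℤ.+-identityʳ (+ b ℤ.+ 1ℤ)) (+1≡suc b)))
      (descending-upperEast s (suc b) (trans (sym (ℕ.+-suc b s)) b+s≡n)))

    upper-region : ∀ s b → concat (zipWith strip (west b (s ℕ.+ n)) (upperEast b s)) ↭ map enc (upperV n 1≤n b s)
    upper-region zero    b = lower-region n b
    upper-region (suc s) b = begin
      strip ((0 ⊖ ⌊ b /2⌋ , + b) , westDirection (odd b)) ((+ (x ℕ.+ b) , + b) , SE)
        ++ concat (zipWith strip (west (suc b) (s ℕ.+ n)) (upperEast (suc b) s))
        ↭⟨ ↭.++⁺ (strip-upper b) (upper-region s (suc b)) ⟩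
      map enc (rowV (odd b) b (upperWidth b) []) ++ map enc (upperV n 1≤n (suc b) s)
        ≡⟨ map-++ enc (rowV (odd b) b (upperWidth b) []) (upperV n 1≤n (suc b) s) ⟨
      map enc (rowV (odd b) b (upperWidth b) [] ++ upperV n 1≤n (suc b) s)
        ≡⟨ cong (map enc) (rowV-++ (odd b) b (upperWidth b) (upperV n 1≤n (suc b) s)) ⟨
      map enc (upperV n 1≤n b (suc s)) ∎
      where open ↭.PermutationReasoning

    C-↭ : C n x ↭ map enc (upperV n 1≤n 0 n)
    C-↭ = begin
      concat (zipWith strip (descending (westSide n)) (descending (eastSide n x)))
        ≡⟨ cong₂ (λ ws es → concat (zipWith strip ws es)) (descending-west n 0 refl)
             (trans (cong (λ k → descending (walk (+ k , 0ℤ) (repeat n (SE ∷ E ∷ []) ++ repeat n (SW ∷ []))))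
                      (sym (ℕ.+-identityʳ x)))
               (descending-upperEast n 0 refl)) ⟩
      concat (zipWith strip (west 0 (n ℕ.+ n)) (upperEast 0 n))
        ↭⟨ upper-region n 0 ⟩
      map enc (upperV n 1≤n 0 n) ∎
      where open ↭.PermutationReasoning

    L-Δ : fromℕ (L (C n x)) ≡ Δ n (fromℕ x)
    L-Δ = trans
      (L-coverings (C n x) (upperV n 1≤n 0 n) (upperΛ n 1≤n 0 n) C-↭
        (lozengesIn-↭ C-↭ (upperV-unique x n 1≤n 0 n) (upperΛ-unique x n 1≤n 0 n)
          (upperΛ-sound x n 1≤n n 0 refl) (upperΛ-complete x n 1≤n 0 n)))
      (coverings-Δ n 1≤n)

mainTheorem8 : (n : ℕ) → 1 ≤ n →
    ((x : ℕ) → fromℤ (+ L (C n x)) ≡ det (binomialMatrix n (fromℤ (+ x))))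
    × (∃[ c ] ∃[ bs ] (c ≢ 0ℚ × ((x : ℚ) →
    det (binomialMatrix n x) ≡ c * productℚ (map (λ b → x + b) bs))))
mainTheorem8 n 1≤n =
  (λ x → trans (L-Δ x n 1≤n) (sym (det-binomialMatrix n (fromℕ x)))) ,
  splits-cong (det-binomialMatrix n) (Δ-splits n)
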